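{- Let $\varphi(\vec{Y},X)$ be a formula of monadic second-order logic (MSO) over the full infinite binary tree, with free set variables $\vec{Y}=(Y_1,\dots,Y_n)$ and $X$, such that whenever $\varphi(\vec{Y},X)$ holds, the set $X$ is well-founded. Define \[\eta_{\varphi}=\sup_{\vec{Y}}\ \min_{X}\ \mathrm{rank}(X),\] where $\vec{Y}$ ranges over the tuples for which some $X$ with $\varphi(\vec{Y},X)$ exists, and for each such $\vec{Y}$ the minimum ranges over the sets $X$ with $\varphi(\vec{Y},X)$. Then $\eta_\varphi$ is either strictly smaller than $\omega^2$ or equal to $\omega_1$. Moreover, it can be effectively decided (given $\varphi$) which of the two cases holds, and in the former case one can compute a number $N\in\mathbb{N}$ such that $\eta_\varphi<\omega\cdot N$.
   Context: The full infinite binary tree has node set $\{\mathtt{L},\mathtt{R}\}^*$ (finite words over two directions), with root the empty word; MSO over it uses the left- and right-successor relations ($u\mapsto u\mathtt{L}$, $u\mapsto u\mathtt{R}$) as the only non-logical predicates, first-order variables over nodes and monadic second-order variables over sets of nodes. A node $u$ is a proper descendant of $v$ if $v$ is a proper prefix of $u$. A set $X$ of nodes is well-founded if it contains no infinite chain with respect to the descendant order (equivalently, every infinite branch contains only finitely many nodes of $X$). For a well-founded set $X$, a counting function into an ordinal $\eta$ is a map $C\colon X\to\eta$ such that $C(u)<C(v)$ whenever $u\in X$ is a proper descendant of $v\in X$; $\mathrm{rank}(X)$ is the least ordinal $\eta$ for which such a counting function exists (it is a countable ordinal). $\omega_1$ denotes the least uncountable ordinal. -}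

module Defs where

open import Data.Nat using (ℕ; zero; suc) renaming (_+_ to _+ℕ_)
open import Data.Fin using (Fin)
open import Data.Vec using (Vec; lookup; _∷_)
open import Data.List using (List; []; _∷_; _++_; [_])
open import Data.Bool using (Bool; true)
open import Data.Product using (Σ; _×_; ∃)
open import Data.Empty using (⊥)
open import Data.Maybe using (Maybe; just; nothing)
open import Relation.Nullary using (¬_)
open import Relation.Binary.PropositionalEquality using (_≡_)

data Dir : Set where
  L R : Dir

Node : Set
Node = List Dir

-- Sets of nodes (characteristic functions; under excluded middle these
-- are all subsets).
NodeSet : Set
NodeSet = Node → Bool

_∈ₛ_ : Node → NodeSet → Set
u ∈ₛ X = X u ≡ true

ProperDesc : Node → Node → Set
ProperDesc u v = Σ Dir λ d → Σ Node λ w → u ≡ v ++ (d ∷ w)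

WellFoundedSet : NodeSet → Set
WellFoundedSet X =
  ¬ (Σ (ℕ → Node) λ c → (i : ℕ) → (c i ∈ₛ X) × ProperDesc (c (suc i)) (c i))

data Formula (m k : ℕ) : Set where
  succL : Fin m → Fin m → Formula m k
  succR : Fin m → Fin m → Formula m k
  _≐_   : Fin m → Fin m → Formula m k
  _∈̇_   : Fin m → Fin k → Formula m k
  ¬̇_    : Formula m k → Formula m k
  _∧̇_   : Formula m k → Formula m k → Formula m k
  ∃¹    : Formula (suc m) k → Formula m k
  ∃²    : Formula m (suc k) → Formula m k

Sat : ∀ {m k} → Formula m k → Vec Node m → Vec NodeSet k → Set
Sat (succL x y) ρ σ = lookup ρ y ≡ lookup ρ x ++ [ L ]
Sat (succR x y) ρ σ = lookup ρ y ≡ lookup ρ x ++ [ R ]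
Sat (x ≐ y)     ρ σ = lookup ρ x ≡ lookup ρ y
Sat (x ∈̇ Z)     ρ σ = lookup ρ x ∈ₛ lookup σ Z
Sat (¬̇ φ)       ρ σ = ¬ Sat φ ρ σ
Sat (φ ∧̇ ψ)     ρ σ = Sat φ ρ σ × Sat ψ ρ σ
Sat (∃¹ φ)      ρ σ = Σ Node λ u → Sat φ (u ∷ ρ) σ
Sat (∃² φ)      ρ σ = Σ NodeSet λ Z → Sat φ ρ (Z ∷ σ)

-- A formula φ(Y₁,…,Yₙ,X) with free set variables only; the set variable
-- with index 0 is X, indices 1..n are Y₁..Yₙ.
Holds : ∀ {n} → Formula 0 (suc n) → Vec NodeSet n → NodeSet → Set
Holds φ Ys X = Sat φ Data.Vec.[] (X ∷ Ys)

-- Countable ordinals as Brouwer trees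

data Ord : Set where
  oz : Ord
  os : Ord → Ord
  ol : (ℕ → Ord) → Ord

infix 4 _≤ₒ_ _<ₒ_
data _≤ₒ_ : Ord → Ord → Set where
  z≤       : ∀ {x} → oz ≤ₒ x
  s≤s      : ∀ {x y} → x ≤ₒ y → os x ≤ₒ os y
  ≤-cocone : ∀ {x f} k → x ≤ₒ f k → x ≤ₒ ol f
  ≤-limit  : ∀ {f x} → (∀ k → f k ≤ₒ x) → ol f ≤ₒ x

_<ₒ_ : Ord → Ord → Set
x <ₒ y = os x ≤ₒ y

_+ₒ_ : Ord → ℕ → Ord
x +ₒ zero  = x
x +ₒ suc k = os (x +ₒ k)

ω·_ : ℕ → Ord
ω· zero  = oz
ω· suc N = ol λ k → (ω· N) +ₒ k

IsCounting : NodeSet → Ord → (Node → Ord) → Set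
IsCounting X η C =
  (∀ u → u ∈ₛ X → C u <ₒ η) ×
  (∀ u v → u ∈ₛ X → v ∈ₛ X → ProperDesc u v → C u <ₒ C v)

RankLe : NodeSet → Ord → Set
RankLe X η = Σ (Node → Ord) (IsCounting X η)

-- η_φ < β₀  (where η_φ = sup_Y min_X rank X):
-- some β < β₀ bounds min_X rank X for every Y admitting a solution.
EtaLt : ∀ {n} → Formula 0 (suc n) → Ord → Set
EtaLt {n} φ β₀ = Σ Ord λ β → (β <ₒ β₀) ×
  ((Ys : Vec NodeSet n) → (Σ NodeSet λ X → Holds φ Ys X) →
     Σ NodeSet λ X → Holds φ Ys X × RankLe X β)

-- η_φ = ω₁ : for every countable ordinal α some Y admits a solution and
-- every solution X has rank(X) > α.
EtaIsω₁ : ∀ {n} → Formula 0 (suc n) → Set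
EtaIsω₁ {n} φ = (α : Ord) → Σ (Vec NodeSet n) λ Ys →
  (Σ NodeSet λ X → Holds φ Ys X) ×
  ((X : NodeSet) → Holds φ Ys X → ¬ RankLe X α)

ForcesWF : ∀ {n} → Formula 0 (suc n) → Set
ForcesWF {n} φ = (Ys : Vec NodeSet n) (X : NodeSet) → Holds φ Ys X → WellFoundedSet X

Case : ∀ {n} → Maybe ℕ → Formula 0 (suc n) → Set
Case (just N) φ = EtaLt φ (ω· N)
Case nothing  φ = EtaIsω₁ φ

{-# OPTIONS --safe #-}
module Submission where

-- The proof goes through Rabin's theorem.  A formula is turned into a parity tree automaton; negation is a
-- game argument: a tree is rejected iff the player choosing the branch has a positional winning strategy,
-- and an automaton can guess that strategy and check, by a deterministic automaton on every branch, that
-- no run consistent with it is accepting.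
-- For the dichotomy, consider claims "every accepting run from state q at node u has rank at least α".
-- They propagate down the tree, and the sets of states with claims ≥ α₀ , ≥ α₁ , … at one node (α₀ > α₁ > ⋯)
-- form a chain with boundedly many members.  Forgetting the ordinals but not their order gives a finite game
-- whose constructor produces Y, an accepting run and consistent claims.  If he wins, his strategy can be
-- followed with any countable ordinals and η = ω₁.  Otherwise his opponent has a positional winning strategy;
-- an instance Y of rank ≥ ω·N, with N large compared with the number of positions, would supply true claims
-- forming a play against that strategy long enough for a chain of descending claims to close a cycle, and
-- going round the cycle beats the strategy.  Hence η < ω·(N+1).

open import Defs
open import Data.Nat using (ℕ; zero; suc; _+_; _*_; _∸_; _⊔_; _⊓_; _≤_; _<_; z≤n; s≤s; _≤?_; _≤′_; ≤′-refl; ≤′-step)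
open import Data.Nat.Properties
  hiding (_≟_; ≡-decSetoid; ≡-isDecEquivalence; eq?; ≡-irrelevant; suc-injective)
open import Data.Fin using (Fin; zero; suc; toℕ; fromℕ; fromℕ<; inject₁; combine; remQuot; join; splitAt)
open import Data.Fin.Properties using (suc-injective; remQuot-combine; splitAt-join; toℕ<n; toℕ-injective; toℕ-fromℕ<; toℕ-fromℕ; toℕ-inject₁; any?; all?; pigeonhole) renaming (_≟_ to _≟F_)
open import Data.Vec using (Vec; lookup; tabulate; replicate) renaming ([] to []ᵥ; _∷_ to _∷ᵥ_; map to mapᵥ)
open import Data.Vec.Properties using (lookup∘tabulate; lookup-map; lookup-replicate)
open import Data.List using (List; []; _∷_; _++_; [_]; length; map; reverse) renaming (lookup to lookupᴸ)
open import Data.Bool using (Bool; true; false; not; _∧_; _∨_; if_then_else_)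
open import Data.Bool.Properties using (not-injective; not-involutive) renaming (_≟_ to _≟B_)
open import Data.Product using (Σ; _×_; ∃; _,_; proj₁; proj₂)
open import Data.Sum using (_⊎_; inj₁; inj₂; [_,_]′)
open import Data.Empty using (⊥; ⊥-elim)
open import Data.Unit using (⊤; tt)
open import Data.Maybe using (Maybe; just; nothing)
open import Function using (_∘_; id; case_of_)
open import Level using (0ℓ)
open import Relation.Nullary using (¬_; Dec; yes; no; does)
open import Relation.Nullary.Decidable using (_×-dec_; _→-dec_; ¬?; map′; dec-true; dec-false)
open import Relation.Binary.PropositionalEquality using (_≡_; _≢_; refl; sym; trans; cong; cong₂; subst; subst₂)
open import Relation.Binary.Definitions using (DecidableEquality; tri<; tri≈; tri>)
open import Axiom.ExcludedMiddle using (ExcludedMiddle)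
open import Induction.WellFounded using (Acc; acc)
open import Data.Nat.Induction using (<-wellFounded)
open import Data.Nat.Properties using () renaming (_≟_ to _≟ℕ_)
open import Data.List.Properties using (≡-dec; length-map; ++-assoc; reverse-involutive; reverse-++; unfold-reverse)
open import Data.List.Relation.Unary.All using (All) renaming ([] to []ᴬ; _∷_ to _∷ᴬ_; map to mapᴬ)
open import Data.List.Relation.Unary.All.Properties using () renaming (++⁺ to All-++)
open import Data.List.Relation.Unary.Any using (Any; here; there) renaming (map to mapᴱ)
open import Data.List.Relation.Unary.Any.Properties using () renaming (++⁺ˡ to Any-++ˡ; ++⁺ʳ to Any-++ʳ; ++⁻ to Any-++⁻)
open import Data.List.Membership.Propositional using () renaming (_∈_ to _∈ᴸ_)
open import Data.List.Relation.Unary.Unique.Propositional using (Unique)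
open import Data.List.Relation.Unary.AllPairs using () renaming ([] to []ᵁ; _∷_ to _∷ᵁ_)

-- Why the gap sits at `ω²`: when a claim about ranks is handed down, the direction that preserves
-- it may depend on the ordinal, so a single claim "rank at least α" cannot simply be entrusted to
-- one child. A claim valid at `ω·s + k` for all `k` can be: one of the two directions serves
-- unboundedly many `k`, hence all of them. Claims counted in units of `ω` thus survive ordinary
-- steps, and a unit is lost only where a mark has been forced; finitely many positions leave room
-- for finitely many losses before a cycle closes. Effectivity is expressed by the quantifier order:
-- the decision function comes before the hypothesis of excluded middle. So automata, the claim game
-- and its evaluation are built without it, and it enters only the correctness proofs. This is why
-- finite types carry explicit codings into `Fin`, strategies stored in labels and moves are tables,
-- and the finite game is evaluated by bounded search, positional determinacy serving only to
-- certify the outcome.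

Classical : Set₁
Classical = ExcludedMiddle 0ℓ

-- Infinite sequences: infinitely often, eventually, and the parity condition.

Inf Ev : (ℕ → Set) → Set
Inf P = ∀ n → ∃ λ m → n ≤ m × P m
Ev P  = ∃ λ n → ∀ m → n ≤ m → P m

inf-map : ∀ {P Q} → (∀ m → P m → Q m) → Inf P → Inf Q
inf-map f i n with i n
... | m , n≤m , p = m , n≤m , f m p

inf-ev : ∀ {P Q} → Inf P → Ev Q → Inf (λ m → P m × Q m)
inf-ev i (k , q) n with i (n + k)
... | m , le , p = m , ≤-trans (m≤m+n n k) le , p , q m (≤-trans (m≤n+m k n) le)

inf-shift : ∀ {P} k → Inf P → Inf (λ m → P (k + m))
inf-shift {P} k i n with i (k + n)
... | m , le , p = m ∸ k , m+n≤o⇒n≤o∸m k le , subst P (sym (m+[n∸m]≡n (≤-trans (m≤m+n k n) le))) p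
  where
  m+n≤o⇒n≤o∸m : ∀ k {n m} → k + n ≤ m → n ≤ m ∸ k
  m+n≤o⇒n≤o∸m zero le = le
  m+n≤o⇒n≤o∸m (suc k) (s≤s le) = m+n≤o⇒n≤o∸m k le

inf-unshift : ∀ {P} k → Inf (λ m → P (k + m)) → Inf P
inf-unshift k i n with i n
... | m , le , p = k + m , ≤-trans le (m≤n+m m k) , p

ev-shift : ∀ {P} k → Ev P → Ev (λ m → P (k + m))
ev-shift k (n , p) = n , λ m le → p (k + m) (≤-trans le (m≤n+m m k))

ev-unshift : ∀ {P} k → Ev (λ m → P (k + m)) → Ev P
ev-unshift {P} k (n , p) = k + n , λ m le →
  subst P (m+[n∸m]≡n (≤-trans (m≤m+n k n) le)) (p (m ∸ k) (subst (_≤ m ∸ k) (m+n∸m≡n k n) (∸-monoˡ-≤ k le)))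

even : ℕ → Bool
even zero = true
even (suc n) = not (even n)

-- Min-parity condition: the least number occurring infinitely often has parity b (true = even).
Parity : Bool → (ℕ → ℕ) → Set
Parity b c = ∃ λ p → even p ≡ b × Inf (λ m → c m ≡ p) × Ev (λ m → p ≤ c m)

parity-cong : ∀ {b c c'} → (∀ m → c m ≡ c' m) → Parity b c → Parity b c'
parity-cong eq (p , e , i , k , l) =
  p , e , inf-map (λ m x → trans (sym (eq m)) x) i , k , λ m le → subst (p ≤_) (eq m) (l m le)

parity-shift : ∀ {b c} k → Parity b c → Parity b (λ m → c (k + m))
parity-shift k (p , e , i , l) = p , e , inf-shift k i , ev-shift k l

parity-unshift : ∀ {b c} k → Parity b (λ m → c (k + m)) → Parity b c
parity-unshift k (p , e , i , l) = p , e , inf-unshift k i , ev-unshift k l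

true≢false : true ≢ false
true≢false ()

-- Each witness is eventually a lower bound while the other still occurs, so they coincide. Opposing
-- winning claims about one play are refuted this way.
parity-unique : ∀ {b b' c} → Parity b c → Parity b' c → b ≡ b'
parity-unique {c = c} (p , e , i , l) (p' , e' , i' , l') =
  trans (sym e) (trans (cong even (≤-antisym (le i' l) (le i l'))) e')
  where
  le : ∀ {p p'} → Inf (λ m → c m ≡ p') → Ev (λ m → p ≤ c m) → p ≤ p'
  le i' l with inf-ev i' l 0
  ... | m , _ , refl , q = q

not-true : ∀ {b} → not b ≡ true → b ≢ true
not-true {true} ()
not-true {false} e ()

not-false : ∀ {b} → not b ≡ false → b ≡ true
not-false {true} e = refl

≢true⇒not : ∀ {b} → b ≢ true → not b ≡ true
≢true⇒not {true} n = ⊥-elim (n refl)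
≢true⇒not {false} n = refl

double-≤ : ∀ {a b} → a + a ≤ suc (b + b) → a ≤ b
double-≤ {a} {b} le = ≮⇒≥ λ lt → <-irrefl refl (≤-trans (s≤s (≤-reflexive (sym (+-suc b b)))) (≤-trans (+-mono-≤ lt lt) le))

double-< : ∀ {a b} → suc (a + a) ≤ b + b → a < b
double-< {a} {b} le = ≰⇒> λ le' → <-irrefl refl (≤-trans le (+-mono-≤ le' le'))

module _ (em : Classical) where

  dne : ∀ {P : Set} → ¬ ¬ P → P
  dne {P} nn with em {P}
  ... | yes p = p
  ... | no n = ⊥-elim (nn n)

  ¬inf→ev : ∀ {P} → ¬ Inf P → Ev (λ m → ¬ P m)
  ¬inf→ev ni = dne λ ne → ni λ n → dne λ nx → ne (n , λ m le p → nx (m , le , p))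

  ¬∀→∃¬ : ∀ {A : Set} {P : A → Set} → ¬ (∀ x → P x) → ∃ λ x → ¬ P x
  ¬∀→∃¬ nf = dne λ ne → nf λ x → dne λ np → ne (x , np)

  inf-⊎ : ∀ {P Q} → Inf (λ m → P m ⊎ Q m) → Inf P ⊎ Inf Q
  inf-⊎ {P} {Q} i with em {Inf P}
  ... | yes p = inj₁ p
  ... | no np = inj₂ λ n → case inf-ev i (¬inf→ev np) n of λ where
          (m , le , inj₁ p , x) → ⊥-elim (x p)
          (m , le , inj₂ q , x) → m , le , q

  inf-Fin : ∀ {k} {P : Fin k → ℕ → Set} → Inf (λ m → ∃ λ i → P i m) → ∃ λ i → Inf (P i)
  inf-Fin {zero} i with i 0
  ... | _ , _ , () , _
  inf-Fin {suc k} {P} i with inf-⊎ {P zero} {λ m → ∃ λ i → P (suc i) m}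
      (inf-map (λ { m (zero , p) → inj₁ p ; m (suc j , p) → inj₂ (j , p) }) i)
  ... | inj₁ x = zero , x
  ... | inj₂ y with inf-Fin y
  ...   | j , z = suc j , z

  least : ∀ {P : ℕ → Set} → ∃ P → ∃ λ n → P n × (∀ m → m < n → ¬ P m)
  least {P} (n , p) = go n p (<-wellFounded n)
    where
    go : ∀ n → P n → Acc _<_ n → ∃ λ n → P n × (∀ m → m < n → ¬ P m)
    go n p (acc rs) with em {∃ λ m → m < n × P m}
    ... | yes (m , lt , q) = go m q (rs lt)
    ... | no no' = n , p , λ m lt q → no' (m , lt , q)

  ev-below : ∀ {c : ℕ → ℕ} p → (∀ q → q < p → ¬ Inf (λ m → c m ≡ q)) → Ev (λ m → p ≤ c m)
  ev-below zero f = 0 , λ _ _ → z≤n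
  ev-below {c} (suc p) f with ev-below p (λ q lt → f q (m<n⇒m<1+n lt)) | ¬inf→ev (f p ≤-refl)
  ... | k , a | l , b = k + l , λ m le → ≤∧≢⇒< (a m (≤-trans (m≤m+n k l) le)) (λ e → b m (≤-trans (m≤n+m l k) le) (sym e))

  parity-min : ∀ {c} p → Inf (λ m → c m ≡ p) → (∀ q → q < p → ¬ Inf (λ m → c m ≡ q)) → Parity (even p) c
  parity-min p i f = p , refl , i , ev-below p f

  inf-bounded : ∀ {c : ℕ → ℕ} d → Inf (λ m → c m < d) → ∃ λ p → p < d × Inf (λ m → c m ≡ p)
  inf-bounded {c} d i with inf-Fin {d} {λ j m → c m ≡ toℕ j}
    (inf-map (λ m lt → fromℕ< lt , sym (toℕ-fromℕ< lt)) i)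
  ... | j , x = toℕ j , toℕ<n j , x

  parity-total : ∀ {c : ℕ → ℕ} d → Inf (λ m → c m < d) → Parity true c ⊎ Parity false c
  parity-total {c} d i with inf-bounded d i
  ... | p , _ , x with least (p , x)
  ...   | q , y , mn = split (even q) (parity-min q y mn)
    where
    split : ∀ b → Parity b c → Parity true c ⊎ Parity false c
    split true  = inj₁
    split false = inj₂

  nonincreasing-stabilises : (f : ℕ → ℕ) → (∀ n → f (suc n) ≤ f n) → ∃ λ k → ∀ m → f (k + m) ≡ f k
  nonincreasing-stabilises f dec with least {λ n → ∃ λ m → f m ≡ n} (f 0 , 0 , refl)
  ... | n , (k , refl) , mn = k , λ m → ≤-antisym (down k m) (≮⇒≥ λ lt → mn (f (k + m)) lt (k + m , refl))
    where
    down : ∀ k m → f (k + m) ≤ f k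
    down k zero = ≤-reflexive (cong f (+-identityʳ k))
    down k (suc m) = ≤-trans (≤-reflexive (cong f (+-suc k m))) (≤-trans (dec (k + m)) (down k m))

-- Finite types as retracts of `Fin`, and tables over them.

record Finite (A : Set) : Set where
  field
    size    : ℕ
    to      : A → Fin size
    from    : Fin size → A
    from-to : ∀ a → from (to a) ≡ a

  to-inj : ∀ {a b} → to a ≡ to b → a ≡ b
  to-inj {a} {b} e = trans (sym (from-to a)) (trans (cong from e) (from-to b))

  _≟_ : DecidableEquality A
  a ≟ b = map′ to-inj (cong to) (to a ≟F to b)

  anyF : ∀ {P : A → Set} → (∀ a → Dec (P a)) → Dec (∃ P)
  anyF {P} P? = map′ (λ (i , p) → from i , p) (λ (a , p) → to a , subst P (sym (from-to a)) p) (any? (P? ∘ from))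

  allF : ∀ {P : A → Set} → (∀ a → Dec (P a)) → Dec (∀ a → P a)
  allF {P} P? = map′ (λ f a → subst P (from-to a) (f (to a))) (λ f i → f (from i)) (all? (P? ∘ from))

open Finite public using (size; to; from; from-to; to-inj; anyF; allF)

finFin : ∀ n → Finite (Fin n)
finFin n = record { size = n ; to = id ; from = id ; from-to = λ _ → refl }

finBool : Finite Bool
finBool = record { size = 2 ; to = λ { true → zero ; false → suc zero } ; from = λ { zero → true ; (suc _) → false }
                 ; from-to = λ { true → refl ; false → refl } }

finDir : Finite Dir
finDir = record { size = 2 ; to = λ { L → zero ; R → suc zero } ; from = λ { zero → L ; (suc _) → R }
                ; from-to = λ { L → refl ; R → refl } }

fin⊤ : Finite ⊤
fin⊤ = record { size = 1 ; to = λ _ → zero ; from = λ _ → tt ; from-to = λ _ → refl }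

fin× : ∀ {A B} → Finite A → Finite B → Finite (A × B)
fin× FA FB = record
  { size = size FA * size FB
  ; to = λ (a , b) → combine (to FA a) (to FB b)
  ; from = λ i → let (x , y) = remQuot (size FB) i in from FA x , from FB y
  ; from-to = λ (a , b) → trans (cong (λ (x , y) → from FA x , from FB y) (remQuot-combine (to FA a) (to FB b)))
                                (cong₂ _,_ (from-to FA a) (from-to FB b)) }

fin⊎ : ∀ {A B} → Finite A → Finite B → Finite (A ⊎ B)
fin⊎ {A} {B} FA FB = record
  { size = size FA + size FB
  ; to = λ x → join (size FA) (size FB) (in' x)
  ; from = λ i → out (splitAt (size FA) i)
  ; from-to = λ x → trans (cong out (splitAt-join (size FA) (size FB) (in' x))) (oi x) }
  where
  in' : A ⊎ B → Fin (size FA) ⊎ Fin (size FB)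
  in' (inj₁ a) = inj₁ (to FA a)
  in' (inj₂ b) = inj₂ (to FB b)
  out : Fin (size FA) ⊎ Fin (size FB) → A ⊎ B
  out (inj₁ i) = inj₁ (from FA i)
  out (inj₂ i) = inj₂ (from FB i)
  oi : ∀ x → out (in' x) ≡ x
  oi (inj₁ a) = cong inj₁ (from-to FA a)
  oi (inj₂ b) = cong inj₂ (from-to FB b)

finVia : ∀ {A B : Set} → Finite B → (f : A → B) (g : B → A) → (∀ a → g (f a) ≡ a) → Finite A
finVia FB f g gf = record { size = size FB ; to = to FB ∘ f ; from = g ∘ from FB
                          ; from-to = λ a → trans (cong g (from-to FB (f a))) (gf a) }

finVec : ∀ {A} → Finite A → ∀ n → Finite (Vec A n)
finVec FA zero = finVia fin⊤ (λ _ → tt) (λ _ → []ᵥ) (λ { []ᵥ → refl })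
finVec FA (suc n) = finVia (fin× FA (finVec FA n)) (λ { (x ∷ᵥ xs) → x , xs }) (λ (x , xs) → x ∷ᵥ xs) (λ { (x ∷ᵥ xs) → refl })

finMaybe : ∀ {A} → Finite A → Finite (Maybe A)
finMaybe FA = finVia (fin⊎ fin⊤ FA) (λ { nothing → inj₁ tt ; (just a) → inj₂ a })
  (λ { (inj₁ _) → nothing ; (inj₂ a) → just a }) (λ { nothing → refl ; (just a) → refl })

-- Tables rather than functions, so that they form a finite type again.
Table : ∀ {A} → Finite A → Set → Set
Table FA B = Vec B (size FA)

app : ∀ {A B : Set} (FA : Finite A) → Table FA B → A → B
app FA f a = lookup f (to FA a)

lam : ∀ {A B : Set} (FA : Finite A) → (A → B) → Table FA B
lam FA f = tabulate (f ∘ from FA)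

app-lam : ∀ {A B : Set} (FA : Finite A) (f : A → B) a → app FA (lam FA f) a ≡ f a
app-lam FA f a = trans (lookup∘tabulate (f ∘ from FA) (to FA a)) (cong f (from-to FA a))

finTable : ∀ {A B} (FA : Finite A) → Finite B → Finite (Table FA B)
finTable FA FB = finVec FB (size FA)

-- Positional determinacy of parity games on countable arenas

record Arena : Set₁ where
  field
    V        : Set
    code     : V → ℕ
    code-inj : ∀ {v w} → code v ≡ code w → v ≡ w
    own      : V → Bool
    E        : V → V → Set
    pr       : V → ℕ

bool-cases : ∀ p (b : Bool) → b ≡ p ⊎ b ≡ not p
bool-cases true  true  = inj₁ refl
bool-cases true  false = inj₂ refl
bool-cases false true  = inj₂ refl
bool-cases false false = inj₁ refl

not-self : ∀ {b} → b ≢ not b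
not-self {true} ()
not-self {false} ()


orient : (A : Bool → Set) → ∀ p → A true ⊎ A false → A p ⊎ A (not p)
orient A true  x        = x
orient A false (inj₁ x) = inj₂ x
orient A false (inj₂ x) = inj₁ x

unorient : (A : Bool → Set) → ∀ p → A p ⊎ A (not p) → A true ⊎ A false
unorient A true  x        = x
unorient A false (inj₁ x) = inj₂ x
unorient A false (inj₂ x) = inj₁ x

module Games (em : Classical) (G : Arena) where
  open Arena G

  Region : Set
  Region = V → Bool

  infix 4 _∋_
  _∋_ : Region → V → Set
  X ∋ v = X v ≡ true

  chi : (V → Set) → Region
  chi P v = does (em {P v})

  chi-in : ∀ P v → P v → chi P ∋ v
  chi-in P v p = dec-true (em {P v}) p

  chi-out : ∀ P v → chi P ∋ v → P v
  chi-out P v e with em {P v}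
  ... | yes p = p
  chi-out P v () | no _

  sing : V → Region
  sing v = chi (λ z → z ≡ v)

  sing-out : ∀ v z → sing v ∋ z → z ≡ v
  sing-out v = chi-out (λ z → z ≡ v)

  sing-in : ∀ v → sing v ∋ v
  sing-in v = chi-in (λ z → z ≡ v) v refl

  ∌→false : ∀ {X : Region} {v} → ¬ X ∋ v → X v ≡ false
  ∌→false {X} {v} n with X v
  ... | true  = ⊥-elim (n refl)
  ... | false = refl

  Move : Bool → Region → (V → V) → V → V → Set
  Move P U σ v w = E v w × U ∋ w × (own v ≡ P → w ≡ σ v)

  -- Player P keeps the play inside X until it reaches T; a play that never reaches T satisfies O.
  record Win (P : Bool) (U T : Region) (O : (ℕ → V) → Set) (X : Region) (σ : V → V) : Set where
    field
      sub  : ∀ v → X ∋ v → U ∋ v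
      mine : ∀ v → X ∋ v → ¬ T ∋ v → own v ≡ P → E v (σ v) × X ∋ σ v
      opp  : ∀ v → X ∋ v → ¬ T ∋ v → own v ≡ not P → ∀ w → E v w → U ∋ w → X ∋ w
      play : ∀ π → (∀ n → X ∋ π n × ¬ T ∋ π n × Move P U σ (π n) (π (suc n))) → O π

    next : ∀ {v w} → X ∋ v → ¬ T ∋ v → Move P U σ v w → X ∋ w
    next {v} {w} xv tv (e , u , s) with bool-cases P (own v)
    ... | inj₁ o rewrite s o = proj₂ (mine v xv tv o)
    ... | inj₂ o = opp v xv tv o w e u

  TailClosed : ((ℕ → V) → Set) → Set
  TailClosed O = ∀ k π → O (λ m → π (k + m)) → O π

  module Union {P U T O} (tc : TailClosed O) (Xs : ℕ → Region) (σs : ℕ → V → V)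
               (wins : ∀ n → Win P U T O (Xs n) (σs n)) where
    Covered : V → Set
    Covered v = ∃ λ n → Xs n ∋ v

    X : Region
    X = chi Covered

    first : ∀ v → ∃ λ i → X ∋ v → Xs i ∋ v × (∀ m → m < i → ¬ Xs m ∋ v)
    first v with em {∃ λ n → Xs n ∋ v}
    ... | yes p = let (i , q , mn) = least em p in i , λ _ → q , mn
    ... | no np = 0 , λ ()

    idx : V → ℕ
    idx v = proj₁ (first v)

    σ : V → V
    σ v = σs (idx v) v

    idx-le : ∀ v n → Xs n ∋ v → idx v ≤ n
    idx-le v n x = ≮⇒≥ λ lt → proj₂ (proj₂ (first v) (chi-in Covered v (n , x))) n lt x

    idx-in : ∀ v → X ∋ v → Xs (idx v) ∋ v
    idx-in v x = proj₁ (proj₂ (first v) x)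

    -- Each vertex uses the strategy of the first region containing it. That index never rises along
    -- a play, so it is eventually constant, and the tail is a play of one fixed strategy.
    win : Win P U T O X σ
    win = record
      { sub = λ v x → Win.sub (wins (idx v)) v (idx-in v x)
      ; mine = λ v x t o → let (e , y) = Win.mine (wins (idx v)) v (idx-in v x) t o in e , chi-in Covered _ (idx v , y)
      ; opp = λ v x t o w e u → chi-in Covered w (idx v , Win.opp (wins (idx v)) v (idx-in v x) t o w e u)
      ; play = λ π h →
          let (k , st) = nonincreasing-stabilises em (λ n → idx (π n)) (λ n →
                let (x , t , mv) = h n in idx-le (π (suc n)) _ (Win.next (wins (idx (π n))) (idx-in _ x) t mv))
              i = idx (π k)
          in tc k π (Win.play (wins i) (λ m → π (k + m)) λ m →
               let (x , t , (e , u , s)) = h (k + m)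
               in subst (λ j → Xs j ∋ π (k + m)) (st m) (idx-in _ x) , t ,
                  subst (λ z → Move P U (σs i) (π (k + m)) (π z)) (sym (+-suc k m))
                    (e , u , λ o → trans (s o) (cong (λ j → σs j (π (k + m))) (st m)))) }

  record Max (P : Bool) (U T : Region) (O : (ℕ → V) → Set) : Set where
    field
      X   : Region
      σ   : V → V
      win : Win P U T O X σ
      max : ∀ Y τ → Win P U T O Y τ → ∀ v → Y ∋ v → X ∋ v

  Won : Bool → Region → Region → ((ℕ → V) → Set) → V → Set
  Won P U T O v = Σ Region λ X → Σ (V → V) λ σ → Win P U T O X σ × X ∋ v

  -- Countability enters here: one winning pair is picked for each code of a won vertex, and the
  -- union of this sequence covers every won vertex.
  maximal : ∀ {P U T O} → TailClosed O → Max P U T O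
  maximal {P} {U} {T} {O} tc = record
    { X = Union.X tc Xs σs wins ; σ = Union.σ tc Xs σs wins ; win = Union.win tc Xs σs wins
    ; max = λ Y τ w v y → chi-in (Union.Covered tc Xs σs wins) v (code v , covers v (Y , τ , w , y)) }
    where
    pick : ∀ n → Dec (∃ λ v → code v ≡ n × Won P U T O v)
    pick n = em
    Xs : ℕ → Region
    Xs n with pick n
    ... | yes (_ , _ , X , _) = X
    ... | no _ = λ _ → false
    σs : ℕ → V → V
    σs n with pick n
    ... | yes (_ , _ , _ , σ , _) = σ
    ... | no _ = id
    wins : ∀ n → Win P U T O (Xs n) (σs n)
    wins n with pick n
    ... | yes (_ , _ , _ , _ , w , _) = w
    ... | no _ = record { sub = λ _ () ; mine = λ _ () ; opp = λ _ () ; play = λ π h → case proj₁ (h 0) of λ () }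
    covers : ∀ v → Won P U T O v → Xs (code v) ∋ v
    covers v w with pick (code v)
    ... | yes (v' , c , _ , _ , _ , x) rewrite code-inj c = x
    ... | no n = ⊥-elim (n (v , refl , w))

  infixr 5 _∪_
  _∪_ : Region → Region → Region
  (X ∪ Y) v = X v ∨ Y v

  ∪ˡ : ∀ {X Y v} → X ∋ v → (X ∪ Y) ∋ v
  ∪ˡ {X} {Y} {v} e rewrite e = refl

  ∪ʳ : ∀ {X Y v} → Y ∋ v → (X ∪ Y) ∋ v
  ∪ʳ {X} {Y} {v} e with X v
  ... | true = refl
  ... | false = e

  ∪-elim : ∀ {X Y v} → (X ∪ Y) ∋ v → X ∋ v ⊎ Y ∋ v
  ∪-elim {X} {Y} {v} e with X v
  ... | true = inj₁ refl
  ... | false = inj₂ e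

  module Extend {P U T O} (tc : TailClosed O) (M : Max P U T O) where
    open Max M

    -- A play that arrives in `X` can be continued by the strategy for `X`, so `X ∪ Y` is won and
    -- absorbed by maximality. The attractor steps below and `notWonQ` are instances.
    extend : ∀ Y τ → Win P U (T ∪ X) O Y τ → ∀ v → Y ∋ v → X ∋ v
    extend Y τ w v y = max (X ∪ Y) ρ record { sub = sub' ; mine = mine' ; opp = opp' ; play = play' } v (∪ʳ {X} {Y} y)
      where
      ρ : V → V
      ρ v = if X v then σ v else τ v
      ρX : ∀ v → X ∋ v → ρ v ≡ σ v
      ρX v e rewrite e = refl
      ρY : ∀ v → ¬ X ∋ v → ρ v ≡ τ v
      ρY v n rewrite ∌→false {X} n = refl
      stop : ∀ {v} → ¬ T ∋ v → ¬ X ∋ v → ¬ (T ∪ X) ∋ v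
      stop nt nx e with ∪-elim {T} {X} e
      ... | inj₁ a = nt a
      ... | inj₂ b = nx b
      side : ∀ v → (X ∪ Y) ∋ v → X ∋ v ⊎ (¬ X ∋ v × Y ∋ v)
      side v e with X v
      ... | true = inj₁ refl
      ... | false = inj₂ ((λ ()) , e)
      sub' : ∀ v → (X ∪ Y) ∋ v → U ∋ v
      sub' v e with side v e
      ... | inj₁ x = Win.sub win v x
      ... | inj₂ (_ , y) = Win.sub w v y
      mine' : ∀ v → (X ∪ Y) ∋ v → ¬ T ∋ v → own v ≡ P → E v (ρ v) × (X ∪ Y) ∋ ρ v
      mine' v e t o with side v e
      ... | inj₁ x rewrite ρX v x = let (a , b) = Win.mine win v x t o in a , ∪ˡ {X} {Y} b
      ... | inj₂ (nx , y) rewrite ρY v nx = let (a , b) = Win.mine w v y (stop t nx) o in a , ∪ʳ {X} {Y} b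
      opp' : ∀ v → (X ∪ Y) ∋ v → ¬ T ∋ v → own v ≡ not P → ∀ w → E v w → U ∋ w → (X ∪ Y) ∋ w
      opp' v e t o z ez uz with side v e
      ... | inj₁ x = ∪ˡ {X} {Y} (Win.opp win v x t o z ez uz)
      ... | inj₂ (nx , y) = ∪ʳ {X} {Y} (Win.opp w v y (stop t nx) o z ez uz)
      play' : ∀ π → (∀ n → (X ∪ Y) ∋ π n × ¬ T ∋ π n × Move P U ρ (π n) (π (suc n))) → O π
      play' π h with em {∃ λ n → X ∋ π n}
      ... | no nx = Win.play w π λ n → let (e , t , (a , u , s)) = h n ; x = λ x → nx (n , x) in
              inY n e , stop t x , (a , u , λ o → trans (s o) (ρY _ x))
        where
        inY : ∀ n → (X ∪ Y) ∋ π n → Y ∋ π n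
        inY n e with side _ e
        ... | inj₁ x = ⊥-elim (nx (n , x))
        ... | inj₂ (_ , y) = y
      ... | yes (k , x0) = tc k π (Win.play win (λ m → π (k + m)) λ m →
              let (e , t , mv) = h (k + m) in stay m , t ,
              subst (λ z → Move P U σ (π (k + m)) (π z)) (sym (+-suc k m)) (conv (stay m) mv))
        where
        conv : ∀ {v z} → X ∋ v → Move P U ρ v z → Move P U σ v z
        conv x (a , u , s) = a , u , λ o → trans (s o) (ρX _ x)
        stay : ∀ m → X ∋ π (k + m)
        stay zero = subst (λ z → X ∋ π z) (sym (+-identityʳ k)) x0
        stay (suc m) = let (e , t , mv) = h (k + m) in
          subst (λ z → X ∋ π z) (sym (+-suc k m)) (Win.next win (stay m) t (conv (stay m) mv))

    private
      around : V → Region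
      around v = sing v ∪ X

      only : ∀ {v z} → around v ∋ z → ¬ (T ∪ X) ∋ z → z ≡ v
      only {v} {z} e n with ∪-elim {sing v} {X} e
      ... | inj₁ c = sing-out v z c
      ... | inj₂ x = ⊥-elim (n (∪ʳ {T} {X} x))

      inX : ∀ {v z} → X ∋ z → around v ∋ z
      inX {v} = ∪ʳ {sing v} {X}

      subAround : ∀ {v} → U ∋ v → ∀ z → around v ∋ z → U ∋ z
      subAround {v} u z e with ∪-elim {sing v} {X} e
      ... | inj₁ c rewrite sing-out v z c = u
      ... | inj₂ x = Win.sub win z x

    step-mine : ∀ {v w} → own v ≡ P → U ∋ v → E v w → X ∋ w → X ∋ v
    step-mine {v} {w} o u e x = extend (around v) (λ _ → w) record
      { sub = subAround u
      ; mine = λ z a t _ → subst (λ z → E z w) (sym (only a t)) e , inX x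
      ; opp = λ z a t o' → ⊥-elim (not-self (trans (sym o) (trans (cong own (sym (only a t))) o')))
      ; play = λ π h → let (a , t , (_ , _ , s)) = h 0 ; (_ , t' , _) = h 1 in
          ⊥-elim (t' (∪ʳ {T} {X} (subst (X ∋_) (sym (s (trans (cong own (only a t)) o))) x))) }
      v (∪ˡ {sing v} {X} (sing-in v))

    step-opp : ∀ {v} → own v ≡ not P → U ∋ v → (∀ w → E v w → U ∋ w → X ∋ w) → X ∋ v
    step-opp {v} o u all = extend (around v) id record
      { sub = subAround u
      ; mine = λ z a t o' → ⊥-elim (not-self (trans (sym o') (trans (cong own (only a t)) o)))
      ; opp = λ z a t _ y e uy → inX (all y (subst (λ z → E z y) (only a t) e) uy)
      ; play = λ π h → let (a , t , (e , uy , _)) = h 0 ; (_ , t' , _) = h 1 in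
          ⊥-elim (t' (∪ʳ {T} {X} (all _ (subst (λ z → E z (π 1)) (only a t) e) uy))) }
      v (∪ˡ {sing v} {X} (sing-in v))

  ∅ : Region
  ∅ _ = false

  Objective : Bool → (ℕ → V) → Set
  Objective P π = Parity P (λ n → pr (π n))

  objective-tail : ∀ P → TailClosed (Objective P)
  objective-tail P k π = parity-unshift k

  never-tail : TailClosed (λ _ → ⊥)
  never-tail _ _ x = x

  Total : Region → Set
  Total U = ∀ v → U ∋ v → ∃ λ w → E v w × U ∋ w

  infixl 6 _∖_
  _∖_ : Region → Region → Region
  (X ∖ Y) v = X v ∧ not (Y v)

  ∖-intro : ∀ {X Y v} → X ∋ v → ¬ Y ∋ v → (X ∖ Y) ∋ v
  ∖-intro {X} {Y} {v} x n rewrite x | ∌→false {Y} n = refl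

  ∖-elim : ∀ {X Y v} → (X ∖ Y) ∋ v → X ∋ v × ¬ Y ∋ v
  ∖-elim {X} {Y} {v} e with X v | Y v
  ∖-elim {X} {Y} {v} () | true | true
  ... | true | false = refl , λ ()
  ∖-elim {X} {Y} {v} () | false | _

  -- Induction in the style of Zielonka. The opponent `Q` of the least priority `k` gets his maximal
  -- region `B.X`; outside it, the part from which `P` cannot force a visit to `k` has only larger
  -- priorities, so it is decided, and a win of `Q` there would enlarge `B.X`. Hence `P` wins all of
  -- `U1`.
  module Stage (U : Region) (tot : Total U) (k : ℕ) (lower : ∀ v → U ∋ v → k ≤ pr v)
    (ih : ∀ U' → Total U' → (∀ v → U' ∋ v → U ∋ v) → (∀ v → U' ∋ v → k < pr v) →
          ∀ v → U' ∋ v → Won true U' ∅ (Objective true) v ⊎ Won false U' ∅ (Objective false) v) where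

    P Q : Bool
    P = even k
    Q = not P

    notQ : not Q ≡ P
    notQ with even k
    ... | true = refl
    ... | false = refl

    MB : Max Q U ∅ (Objective Q)
    MB = maximal (objective-tail Q)
    module B = Max MB
    module BE = Extend (objective-tail Q) MB

    U1 : Region
    U1 = U ∖ B.X

    trapQ : ∀ {v w} → U1 ∋ v → own v ≡ Q → E v w → U ∋ w → U1 ∋ w
    trapQ u o e uw = ∖-intro {U} {B.X} uw λ x →
      proj₂ (∖-elim {U} {B.X} u) (BE.step-mine o (proj₁ (∖-elim {U} {B.X} u)) e x)

    total1 : Total U1
    total1 v u with bool-cases Q (own v)
    ... | inj₁ o = let (w , e , uw) = tot v (proj₁ (∖-elim {U} {B.X} u)) in w , e , trapQ u o e uw
    ... | inj₂ o = dne em λ n → proj₂ (∖-elim {U} {B.X} u)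
          (BE.step-opp o (proj₁ (∖-elim {U} {B.X} u)) λ w e uw → dne em λ nx → n (w , e , ∖-intro {U} {B.X} uw nx))

    Tgt : Region
    Tgt = chi λ v → pr v ≡ k

    -- With an unsatisfiable objective, winning means reaching `Tgt`: this is the attractor of `P`.
    MA : Max P U1 Tgt (λ _ → ⊥)
    MA = maximal never-tail
    module A = Max MA
    module AE = Extend never-tail MA

    target⊆A : ∀ v → U1 ∋ v → pr v ≡ k → A.X ∋ v
    target⊆A v u e = A.max (sing v) id record
      { sub = λ z c → subst (U1 ∋_) (sym (sing-out v z c)) u
      ; mine = λ z c nt _ → ⊥-elim (nt (chi-in (λ v → pr v ≡ k) _ (trans (cong pr (sing-out v z c)) e)))
      ; opp = λ z c nt _ → ⊥-elim (nt (chi-in (λ v → pr v ≡ k) _ (trans (cong pr (sing-out v z c)) e)))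
      ; play = λ π h → let (c , nt , _) = h 0 in ⊥-elim (nt (chi-in (λ v → pr v ≡ k) _ (trans (cong pr (sing-out v _ c)) e))) }
      v (sing-in v)

    U2 : Region
    U2 = U1 ∖ A.X

    closed2 : ∀ {v w} → U2 ∋ v → own v ≡ P → E v w → U1 ∋ w → U2 ∋ w
    closed2 u o e uw = ∖-intro {U1} {A.X} uw λ x →
      proj₂ (∖-elim {U1} {A.X} u) (AE.step-mine o (proj₁ (∖-elim {U1} {A.X} u)) e x)

    total2 : Total U2
    total2 v u with bool-cases P (own v)
    ... | inj₁ o = let (w , e , uw) = total1 v (proj₁ (∖-elim {U1} {A.X} u)) in w , e , closed2 u o e uw
    ... | inj₂ o = dne em λ n → proj₂ (∖-elim {U1} {A.X} u)
          (AE.step-opp o (proj₁ (∖-elim {U1} {A.X} u)) λ w e uw → dne em λ nx → n (w , e , ∖-intro {U1} {A.X} uw nx))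

    U2⊆U : ∀ v → U2 ∋ v → U ∋ v
    U2⊆U v u = proj₁ (∖-elim {U} {B.X} (proj₁ (∖-elim {U1} {A.X} u)))

    decided2 : ∀ v → U2 ∋ v → Won P U2 ∅ (Objective P) v ⊎ Won Q U2 ∅ (Objective Q) v
    decided2 v u = orient (λ P → Won P U2 ∅ (Objective P) v) P
      (ih U2 total2 U2⊆U (λ v u → ≤∧≢⇒< (lower v (U2⊆U v u)) λ e →
          proj₂ (∖-elim {U1} {A.X} u) (target⊆A v (proj₁ (∖-elim {U1} {A.X} u)) (sym e))) v u)

    -- `P` can leave `U2` only into `B.X`, so a region won by `Q` inside `U2` is won in `U` with
    -- target `B.X`.
    notWonQ : ∀ v → U2 ∋ v → ¬ Won Q U2 ∅ (Objective Q) v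
    notWonQ v u (X , σ , w , x) = proj₂ (∖-elim {U} {B.X} (proj₁ (∖-elim {U1} {A.X} u)))
      (BE.extend (X ∪ B.X) σ record { sub = sub' ; mine = mine' ; opp = opp' ; play = play' } v (∪ˡ {X} {B.X} x))
      where
      inX : ∀ {z} → (X ∪ B.X) ∋ z → ¬ (∅ ∪ B.X) ∋ z → X ∋ z
      inX {z} e n with ∪-elim {X} {B.X} e
      ... | inj₁ a = a
      ... | inj₂ b = ⊥-elim (n b)
      sub' : ∀ z → (X ∪ B.X) ∋ z → U ∋ z
      sub' z e with ∪-elim {X} {B.X} e
      ... | inj₁ a = U2⊆U z (Win.sub w z a)
      ... | inj₂ b = Win.sub B.win z b
      mine' : ∀ z → (X ∪ B.X) ∋ z → ¬ (∅ ∪ B.X) ∋ z → own z ≡ Q → E z (σ z) × (X ∪ B.X) ∋ σ z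
      mine' z e n o = let (a , b) = Win.mine w z (inX e n) (λ ()) o in a , ∪ˡ {X} {B.X} b
      opp' : ∀ z → (X ∪ B.X) ∋ z → ¬ (∅ ∪ B.X) ∋ z → own z ≡ not Q → ∀ y → E z y → U ∋ y → (X ∪ B.X) ∋ y
      opp' z e n o y ey uy with em {B.X ∋ y}
      ... | yes b = ∪ʳ {X} {B.X} b
      ... | no nb = ∪ˡ {X} {B.X} (Win.opp w z (inX e n) (λ ()) o y ey
              (closed2 (Win.sub w z (inX e n)) (trans o notQ) ey (∖-intro {U} {B.X} uy nb)))
      play' : ∀ π → (∀ n → (X ∪ B.X) ∋ π n × ¬ (∅ ∪ B.X) ∋ π n × Move Q U σ (π n) (π (suc n))) → Objective Q π
      play' π h = Win.play w π λ n →
        let (e , t , (a , _ , s)) = h n ; (e' , t' , _) = h (suc n)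
        in inX e t , (λ ()) , (a , Win.sub w _ (inX e' t') , s)

    M2 : Max P U2 ∅ (Objective P)
    M2 = maximal (objective-tail P)
    module C = Max M2

    U2⊆C : ∀ v → U2 ∋ v → C.X ∋ v
    U2⊆C v u with decided2 v u
    ... | inj₁ (X , σ , w , x) = C.max X σ w v x
    ... | inj₂ q = ⊥-elim (notWonQ v u q)

    any1 : V → V
    any1 v with em {U1 ∋ v}
    ... | yes u = proj₁ (total1 v u)
    ... | no _ = v

    any1-ok : ∀ v → U1 ∋ v → E v (any1 v) × U1 ∋ any1 v
    any1-ok v u with em {U1 ∋ v}
    ... | yes u' = proj₂ (total1 v u')
    ... | no n = ⊥-elim (n u)

    σ1 : V → V
    σ1 v = if A.X v then (if Tgt v then any1 v else A.σ v) else C.σ v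

    σ1A : ∀ v → A.X ∋ v → ¬ Tgt ∋ v → σ1 v ≡ A.σ v
    σ1A v a n rewrite a | ∌→false {Tgt} n = refl

    σ1C : ∀ v → ¬ A.X ∋ v → σ1 v ≡ C.σ v
    σ1C v n rewrite ∌→false {A.X} n = refl

    -- Either `k` recurs and, being least, decides the play; or visits to it stop, the play cannot
    -- be in the attractor any more, and its tail is a play of `C.σ` in `U2`.
    win1 : Win P U ∅ (Objective P) U1 σ1
    win1 = record { sub = λ v u → proj₁ (∖-elim {U} {B.X} u) ; mine = λ v u _ → mine' v u
                  ; opp = λ v u _ o w e uw → trapQ u o e uw ; play = play' }
      where
      mine' : ∀ v → U1 ∋ v → own v ≡ P → E v (σ1 v) × U1 ∋ σ1 v
      mine' v u o with em {A.X ∋ v} | em {Tgt ∋ v}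
      ... | yes a | yes t rewrite a | t = any1-ok v u
      ... | yes a | no t rewrite σ1A v a t = let (e , x) = Win.mine A.win v a t o in e , Win.sub A.win _ x
      ... | no a | _ rewrite σ1C v a = let (e , x) = Win.mine C.win v (U2⊆C v (∖-intro {U1} {A.X} u a)) (λ ()) o
                                       in e , proj₁ (∖-elim {U1} {A.X} (Win.sub C.win _ x))
      play' : ∀ π → (∀ n → U1 ∋ π n × ¬ ∅ ∋ π n × Move P U σ1 (π n) (π (suc n))) → Objective P π
      play' π h with em {Inf (λ n → pr (π n) ≡ k)}
      ... | yes i = parity-min em k i λ q lt iq → let (m , _ , e) = iq 0 in
              <-irrefl refl (<-≤-trans lt (≤-trans (lower _ (proj₁ (∖-elim {U} {B.X} (proj₁ (h m))))) (≤-reflexive e)))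
      ... | no ni with ¬inf→ev em ni
      ...   | n0 , nk = parity-unshift n0 (Win.play C.win (λ m → π (n0 + m)) λ m →
                let (u , _ , (e , _ , s)) = h (n0 + m) in
                U2⊆C _ (in2 (n0 + m) (m≤m+n n0 m)) , (λ ()) ,
                subst (λ z → Move P U2 C.σ (π (n0 + m)) (π z)) (sym (+-suc n0 m))
                  (e , in2 (suc (n0 + m)) (m≤n⇒m≤1+n (m≤m+n n0 m)) ,
                   λ o → trans (s o) (σ1C _ (proj₂ (∖-elim {U1} {A.X} (in2 (n0 + m) (m≤m+n n0 m)))))))
        where
        noT : ∀ m → n0 ≤ m → ¬ Tgt ∋ π m
        noT m le t = nk m le (chi-out (λ v → pr v ≡ k) _ t)
        notA : ∀ m → n0 ≤ m → ¬ A.X ∋ π m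
        notA m le a = Win.play A.win (λ j → π (m + j)) λ j → inA j , noT _ (≤-trans le (m≤m+n m j)) ,
            subst (λ z → Move P U1 A.σ (π (m + j)) (π z)) (sym (+-suc m j)) (mv j (inA j))
          where
          mv : ∀ j → A.X ∋ π (m + j) → Move P U1 A.σ (π (m + j)) (π (suc (m + j)))
          mv j a = let (_ , _ , (e , _ , s)) = h (m + j) in
            e , proj₁ (h (suc (m + j))) , λ o → trans (s o) (σ1A _ a (noT _ (≤-trans le (m≤m+n m j))))
          inA : ∀ j → A.X ∋ π (m + j)
          inA zero = subst (λ z → A.X ∋ π z) (sym (+-identityʳ m)) a
          inA (suc j) = subst (λ z → A.X ∋ π z) (sym (+-suc m j))
            (Win.next A.win (inA j) (noT _ (≤-trans le (m≤m+n m j))) (mv j (inA j)))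
        in2 : ∀ m → n0 ≤ m → U2 ∋ π m
        in2 m le = ∖-intro {U1} {A.X} (proj₁ (h m)) (notA m le)

    result : ∀ v → U ∋ v → Won true U ∅ (Objective true) v ⊎ Won false U ∅ (Objective false) v
    result v u with em {B.X ∋ v}
    ... | yes b = unorient (λ P → Won P U ∅ (Objective P) v) P (inj₂ (B.X , B.σ , B.win , b))
    ... | no nb = unorient (λ P → Won P U ∅ (Objective P) v) P (inj₁ (U1 , σ1 , win1 , ∖-intro {U} {B.X} u nb))

  determined-from : ∀ n k U → Total U → (∀ v → U ∋ v → k ≤ pr v × pr v < k + n) →
    ∀ v → U ∋ v → Won true U ∅ (Objective true) v ⊎ Won false U ∅ (Objective false) v
  determined-from zero k U tot bd v u = let (a , b) = bd v u in
    ⊥-elim (<-irrefl refl (<-≤-trans b (≤-trans (≤-reflexive (+-identityʳ k)) a)))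
  determined-from (suc n) k U tot bd = Stage.result U tot k (λ v u → proj₁ (bd v u))
    λ U' tot' sub gt → determined-from n (suc k) U' tot' λ v u →
      gt v u , <-≤-trans (proj₂ (bd v (sub v u))) (≤-reflexive (+-suc k n))

  everything : Region
  everything _ = true

  determined : (d : ℕ) → (∀ v → pr v < d) → (∀ v → ∃ (E v)) →
    Σ (Max true everything ∅ (Objective true)) λ M₁ → Σ (Max false everything ∅ (Objective false)) λ M₀ →
    ∀ v → Max.X M₁ ∋ v ⊎ Max.X M₀ ∋ v
  determined d bd tot = M₁ , M₀ , λ v → case determined-from d 0 everything
      (λ v _ → let (w , e) = tot v in w , e , refl) (λ v _ → z≤n , bd v) v refl of λ where
        (inj₁ (X , σ , w , x)) → inj₁ (Max.max M₁ X σ w v x)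
        (inj₂ (X , σ , w , x)) → inj₂ (Max.max M₀ X σ w v x)
    where
    M₁ = maximal (objective-tail true)
    M₀ = maximal (objective-tail false)

-- Determinisation over a finite monoid

at : ∀ {A : Set} → List A → ℕ → Maybe A
at []       _       = nothing
at (x ∷ xs) zero    = just x
at (x ∷ xs) (suc j) = at xs j

removeAt : ∀ {A : Set} → ℕ → List A → List A
removeAt _       []       = []
removeAt zero    (x ∷ xs) = xs
removeAt (suc m) (x ∷ xs) = x ∷ removeAt m xs

just-inj : ∀ {A : Set} {x y : A} → just x ≡ just y → x ≡ y
just-inj refl = refl

at-length : ∀ {A : Set} (xs : List A) j {x} → at xs j ≡ just x → j < length xs
at-length (x ∷ xs) zero e = s≤s z≤n
at-length (x ∷ xs) (suc j) e = s≤s (at-length xs j e)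

at-defined : ∀ {A : Set} (xs : List A) j → j < length xs → ∃ λ x → at xs j ≡ just x
at-defined (x ∷ xs) zero lt = x , refl
at-defined (x ∷ xs) (suc j) (s≤s lt) = at-defined xs j lt

at-map : ∀ {A B : Set} (f : A → B) xs j {x} → at xs j ≡ just x → at (map f xs) j ≡ just (f x)
at-map f (x ∷ xs) zero refl = refl
at-map f (x ∷ xs) (suc j) e = at-map f xs j e

at-++ˡ : ∀ {A : Set} (xs : List A) {ys} j {x} → at xs j ≡ just x → at (xs ++ ys) j ≡ just x
at-++ˡ (x ∷ xs) zero e = e
at-++ˡ (x ∷ xs) (suc j) e = at-++ˡ xs j e

at-snoc : ∀ {A : Set} (xs : List A) {y} j {x} → at (xs ++ [ y ]) j ≡ just x → at xs j ≡ just x ⊎ x ≡ y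
at-snoc [] zero e = inj₂ (sym (just-inj e))
at-snoc (x ∷ xs) zero e = inj₁ e
at-snoc (x ∷ xs) (suc j) e = at-snoc xs j e

at-removeAt-< : ∀ {A : Set} m (xs : List A) j → j < m → at (removeAt m xs) j ≡ at xs j
at-removeAt-< m [] j lt = refl
at-removeAt-< (suc m) (x ∷ xs) zero lt = refl
at-removeAt-< (suc m) (x ∷ xs) (suc j) (s≤s lt) = at-removeAt-< m xs j lt

at-removeAt-≥ : ∀ {A : Set} m (xs : List A) j → m ≤ j → at (removeAt m xs) j ≡ at xs (suc j)
at-removeAt-≥ m [] j le = refl
at-removeAt-≥ zero (x ∷ xs) j le = refl
at-removeAt-≥ (suc m) (x ∷ xs) (suc j) (s≤s le) = at-removeAt-≥ m xs j le

length-removeAt : ∀ {A : Set} m (xs : List A) → m < length xs → suc (length (removeAt m xs)) ≡ length xs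
length-removeAt zero (x ∷ xs) lt = refl
length-removeAt (suc m) (x ∷ xs) (s≤s lt) = cong suc (length-removeAt m xs lt)

length-snoc : ∀ {A : Set} (xs : List A) y → length (xs ++ [ y ]) ≡ suc (length xs)
length-snoc [] y = refl
length-snoc (x ∷ xs) y = cong suc (length-snoc xs y)

record FiniteMonoid : Set₁ where
  infixl 7 _·_
  field
    S     : Set
    fin   : Finite S
    ε     : S
    _·_   : S → S → S
    assoc : ∀ x y z → x · y · z ≡ x · (y · z)
    idˡ   : ∀ x → ε · x ≡ x
    idʳ   : ∀ x → x · ε ≡ x

module Segments (M : FiniteMonoid) (w : ℕ → FiniteMonoid.S M) where
  open FiniteMonoid M

  seg : ℕ → ℕ → S
  seg i zero    = ε
  seg i (suc k) = w i · seg (suc i) k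

  val : ℕ → ℕ → S
  val i j = seg i (j ∸ i)

  seg-+ : ∀ i k l → seg i (k + l) ≡ seg i k · seg (i + k) l
  seg-+ i zero l = sym (trans (idˡ _) (cong (λ z → seg z l) (+-identityʳ i)))
  seg-+ i (suc k) l = trans (cong (w i ·_) (trans (seg-+ (suc i) k l) (cong (λ z → seg (suc i) k · seg z l) (sym (+-suc i k)))))
                            (sym (assoc _ _ _))

  val-split : ∀ i j k → i ≤ j → j ≤ k → val i k ≡ val i j · val j k
  val-split i j k le le' = trans (cong (seg i) (sym e)) (trans (seg-+ i (j ∸ i) (k ∸ j))
      (cong (λ z → val i j · seg z (k ∸ j)) (m+[n∸m]≡n le)))
    where
    e : (j ∸ i) + (k ∸ j) ≡ k ∸ i
    e = trans (+-comm (j ∸ i) (k ∸ j)) (sym (trans (cong (_∸ i) (sym (m∸n+n≡m le'))) (+-∸-assoc (k ∸ j) le)))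

  val-one : ∀ n → val n (suc n) ≡ w n
  val-one n = trans (cong (seg n) (m+n∸n≡m 1 n)) (idʳ (w n))

  -- w = s e e e ⋯
  record Factors (s e : S) : Set where
    field
      cut   : ℕ → ℕ
      incr  : ∀ k → cut k < cut (suc k)
      head  : val 0 (cut 0) ≡ s
      block : ∀ k → val (cut k) (cut (suc k)) ≡ e
      idem  : e · e ≡ e

-- The automaton keeps the values between consecutive remembered positions of the input.  Two positions
-- with equal values up to now have equal values for ever, so the younger of them may be forgotten; when
-- position j is forgotten in favour of i, the value e between i and j is a candidate for a factorisation
-- s e e e ⋯ of the input.  The least index forgotten infinitely often provides a correct one.
module Determinise (M : FiniteMonoid) (accept : FiniteMonoid.S M → FiniteMonoid.S M → Bool) where
  open FiniteMonoid M

  N : ℕ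
  N = size fin

  _≟S_ : DecidableEquality S
  _≟S_ = Finite._≟_ fin

  find : S → List S → Maybe ℕ
  find x [] = nothing
  find x (y ∷ ys) with x ≟S y | find x ys
  ... | yes _ | _ = just 0
  ... | no _  | just l = just (suc l)
  ... | no _  | nothing = nothing

  scan : List S → List S → Maybe (ℕ × ℕ)
  scan seen [] = nothing
  scan seen (x ∷ xs) with find x seen
  ... | just l = just (l , length seen)
  ... | nothing = scan (seen ++ [ x ]) xs

  duplicate : List S → Maybe (ℕ × ℕ)
  duplicate = scan []

  prod : List S → S
  prod []       = ε
  prod (g ∷ gs) = g · prod gs

  suffixes : List S → List S
  suffixes []       = []
  suffixes (g ∷ gs) = prod (g ∷ gs) ∷ suffixes gs

  -- Forgetting the position of index `m` fuses the gaps of index `m - 1` and `m`.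
  mergeAt : ℕ → List S → List S
  mergeAt zero          gs           = gs
  mergeAt (suc m)       []           = []
  mergeAt (suc zero)    (g ∷ [])     = g ∷ []
  mergeAt (suc zero)    (g ∷ h ∷ gs) = g · h ∷ gs
  mergeAt (suc (suc m)) (g ∷ gs)     = g ∷ mergeAt (suc m) gs

  between : ℕ → ℕ → List S → S
  between zero    zero    gs       = ε
  between l       m       []       = ε
  between zero    (suc m) (g ∷ gs) = g · between zero m gs
  between (suc l) zero    (g ∷ gs) = ε
  between (suc l) (suc m) (g ∷ gs) = between l m gs

  Event : Set
  Event = Maybe (ℕ × ℕ)

  contract : Event → List S → List S
  contract nothing        gs = gs
  contract (just (l , m)) gs = mergeAt m gs

  -- Odd and above the priority of every event, as event indices are at most `N`; it never decides a
  -- run in which events recur.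
  quiet : ℕ
  quiet = suc (2 * (suc N))

  double : Bool → ℕ → ℕ
  double true  m = 2 * m
  double false m = suc (2 * m)

  -- Smaller indices dominate, and for equal indices an accepting verdict dominates a rejecting one.
  -- The verdict is on the candidate whose head ends at position `l` and whose loop runs from `l` to
  -- `m`.
  priority : Event → List S → ℕ
  priority nothing        gs = quiet
  priority (just (l , m)) gs = double (accept (between 0 l gs) (between l m gs)) m ⊓ quiet

  State : Set
  State = Vec (Maybe S) N × Fin (suc quiet)

  finState : Finite State
  finState = fin× (finVec (finMaybe fin) N) (finFin _)

  encode : ∀ n → List S → Vec (Maybe S) n
  encode zero    gs       = []ᵥ
  encode (suc n) []       = nothing ∷ᵥ encode n []
  encode (suc n) (g ∷ gs) = just g ∷ᵥ encode n gs

  decode : ∀ {n} → Vec (Maybe S) n → List S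
  decode []ᵥ            = []
  decode (nothing ∷ᵥ v) = []
  decode (just g ∷ᵥ v)  = g ∷ decode v

  decode-encode : ∀ n gs → length gs ≤ n → decode (encode n gs) ≡ gs
  decode-encode zero    []       le = refl
  decode-encode (suc n) []       le = refl
  decode-encode (suc n) (g ∷ gs) (s≤s le) = cong (g ∷_) (decode-encode n gs le)

  fstep : List S → List S
  fstep gs = contract (duplicate (suffixes gs)) gs

  fprio : List S → ℕ
  fprio gs = priority (duplicate (suffixes gs)) gs

  capped : ℕ → Fin (suc quiet)
  capped p = fromℕ< {p ⊓ quiet} (s≤s (m⊓n≤n p quiet))

  start : State
  start = encode N [] , capped quiet

  step : State → S → State
  step (v , _) a = let gs = decode v ++ [ a ] in encode N (fstep gs) , capped (fprio gs)

  prio : State → ℕ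
  prio (_ , p) = toℕ p

  run : (ℕ → S) → ℕ → State
  run w zero    = start
  run w (suc n) = step (run w n) (w n)

  find-just : ∀ x ys {l} → find x ys ≡ just l → at ys l ≡ just x
  find-just x (y ∷ ys) e with x ≟S y | find x ys in eq
  find-just x (y ∷ ys) refl | yes refl | _ = refl
  find-just x (y ∷ ys) refl | no _ | just l = find-just x ys eq

  find-nothing : ∀ x ys → find x ys ≡ nothing → ∀ j → at ys j ≢ just x
  find-nothing x (y ∷ ys) e j a with x ≟S y | find x ys in eq
  find-nothing x (y ∷ ys) e zero a | no n | nothing = n (sym (just-inj a))
  find-nothing x (y ∷ ys) e (suc j) a | no n | nothing = find-nothing x ys eq j a

  at-mid : ∀ (seen : List S) x xs → at (seen ++ x ∷ xs) (length seen) ≡ just x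
  at-mid [] x xs = refl
  at-mid (y ∷ seen) x xs = at-mid seen x xs

  snoc-++ : ∀ (seen : List S) x xs → (seen ++ [ x ]) ++ xs ≡ seen ++ x ∷ xs
  snoc-++ [] x xs = refl
  snoc-++ (y ∷ seen) x xs = cong (y ∷_) (snoc-++ seen x xs)

  scan-just : ∀ seen xs {l m} → scan seen xs ≡ just (l , m) →
    l < m × ∃ λ x → at (seen ++ xs) l ≡ just x × at (seen ++ xs) m ≡ just x
  scan-just seen (x ∷ xs) e with find x seen in eq
  scan-just seen (x ∷ xs) refl | just l =
    at-length seen l (find-just x seen eq) , x , at-++ˡ seen l (find-just x seen eq) , at-mid seen x xs
  ... | nothing rewrite sym (snoc-++ seen x xs) = scan-just (seen ++ [ x ]) xs e

  Distinct : List S → Set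
  Distinct xs = ∀ j j' {x} → at xs j ≡ just x → at xs j' ≡ just x → j ≡ j'

  at-snoc' : ∀ (xs : List S) {y} j {x} → at (xs ++ [ y ]) j ≡ just x →
    at xs j ≡ just x ⊎ (x ≡ y × j ≡ length xs)
  at-snoc' [] zero e = inj₂ (sym (just-inj e) , refl)
  at-snoc' (x ∷ xs) zero e = inj₁ e
  at-snoc' (x ∷ xs) (suc j) e with at-snoc' xs j e
  ... | inj₁ a = inj₁ a
  ... | inj₂ (a , b) = inj₂ (a , cong suc b)

  scan-nothing : ∀ seen xs → scan seen xs ≡ nothing → Distinct seen → Distinct (seen ++ xs)
  scan-nothing seen [] e d j j' a a' = d j j' (unsnoc {seen} j a) (unsnoc {seen} j' a')
    where
    unsnoc : ∀ {seen : List S} j {x} → at (seen ++ []) j ≡ just x → at seen j ≡ just x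
    unsnoc {_ ∷ _} zero e = e
    unsnoc {_ ∷ seen} (suc j) e = unsnoc {seen} j e
  scan-nothing seen (x ∷ xs) e d with find x seen in eq
  ... | nothing rewrite sym (snoc-++ seen x xs) = scan-nothing (seen ++ [ x ]) xs e λ j j' a a' →
        case at-snoc' seen j a , at-snoc' seen j' a' of λ where
          (inj₁ b , inj₁ b') → d j j' b b'
          (inj₁ b , inj₂ (refl , _)) → ⊥-elim (find-nothing x seen eq j b)
          (inj₂ (refl , _) , inj₁ b') → ⊥-elim (find-nothing x seen eq j' b')
          (inj₂ (_ , p) , inj₂ (_ , p')) → trans p (sym p')

  distinct-length : ∀ xs → Distinct xs → length xs ≤ N
  distinct-length xs d with length xs ≤? N
  ... | yes le = le
  ... | no gt with pigeonhole (≰⇒> gt) (λ i → to fin (proj₁ (at-defined xs (toℕ i) (toℕ<n i))))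
  ...   | i , j , i<j , eq = ⊥-elim (<-irrefl
          (d (toℕ i) (toℕ j) (proj₂ (at-defined xs (toℕ i) (toℕ<n i)))
             (trans (proj₂ (at-defined xs (toℕ j) (toℕ<n j))) (cong just (sym (to-inj fin eq))))) i<j)

  -- The proof follows the actual positions; the automaton stores only the gaps between them.
  module Correct (w : ℕ → S) where
    open Segments M w

    Sorted : ℕ → List ℕ → Set
    Sorted n []           = ⊤
    Sorted n (p ∷ [])     = p < n
    Sorted n (p ∷ q ∷ ps) = p < q × Sorted n (q ∷ ps)

    gaps : ℕ → List ℕ → List S
    gaps n []           = []
    gaps n (p ∷ [])     = val p n ∷ []
    gaps n (p ∷ q ∷ ps) = val p q ∷ gaps n (q ∷ ps)

    sorted-head : ∀ n p ps → Sorted n (p ∷ ps) → p < n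
    sorted-head n p [] s = s
    sorted-head n p (q ∷ ps) (lt , s) = <-trans lt (sorted-head n q ps s)

    sorted-tail : ∀ n p ps → Sorted n (p ∷ ps) → Sorted n ps
    sorted-tail n p [] s = tt
    sorted-tail n p (q ∷ ps) (_ , s) = s

    sorted-snoc : ∀ n ps → Sorted n ps → Sorted (suc n) (ps ++ [ n ])
    sorted-snoc n [] s = ≤-refl
    sorted-snoc n (p ∷ []) s = s , ≤-refl
    sorted-snoc n (p ∷ q ∷ ps) (lt , s) = lt , sorted-snoc n (q ∷ ps) s

    sorted-at : ∀ n p ps → Sorted n (p ∷ ps) → ∀ j {q} → at ps j ≡ just q → p < q
    sorted-at n p (q ∷ ps) (lt , s) zero refl = lt
    sorted-at n p (q ∷ ps) (lt , s) (suc j) e = <-trans lt (sorted-at n q ps s j e)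

    sorted-lt : ∀ n ps → Sorted n ps → ∀ j j' {p q} → j < j' → at ps j ≡ just p → at ps j' ≡ just q → p < q
    sorted-lt n (p ∷ ps) s zero (suc j') lt refl b = sorted-at n p ps s j' b
    sorted-lt n (p ∷ ps) s (suc j) (suc j') (s≤s lt) a b = sorted-lt n ps (sorted-tail n p ps s) j j' lt a b

    sorted-bound : ∀ n ps → Sorted n ps → ∀ j {p} → at ps j ≡ just p → p < n
    sorted-bound n (p ∷ ps) s zero refl = sorted-head n p ps s
    sorted-bound n (p ∷ ps) s (suc j) e = sorted-bound n ps (sorted-tail n p ps s) j e

    sorted-remove : ∀ n m ps → Sorted n ps → Sorted n (removeAt m ps)
    sorted-remove n m [] s = tt
    sorted-remove n zero (p ∷ ps) s = sorted-tail n p ps s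
    sorted-remove n (suc m) (p ∷ []) s = s
    sorted-remove n (suc zero) (p ∷ q ∷ []) s = sorted-head n p (q ∷ []) s
    sorted-remove n (suc zero) (p ∷ q ∷ r ∷ ps) (lt , lt' , s) = <-trans lt lt' , s
    sorted-remove n (suc (suc m)) (p ∷ q ∷ ps) (lt , s) = lt , sorted-remove n (suc m) (q ∷ ps) s

    gaps-snoc : ∀ n ps → gaps n ps ++ [ w n ] ≡ gaps (suc n) (ps ++ [ n ])
    gaps-snoc n [] = cong (_∷ []) (sym (val-one n))
    gaps-snoc n (p ∷ []) = cong (λ z → val p n ∷ z ∷ []) (sym (val-one n))
    gaps-snoc n (p ∷ q ∷ ps) = cong (val p q ∷_) (gaps-snoc n (q ∷ ps))

    prod-gaps : ∀ n p ps → Sorted n (p ∷ ps) → prod (gaps n (p ∷ ps)) ≡ val p n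
    prod-gaps n p [] s = idʳ _
    prod-gaps n p (q ∷ ps) (lt , s) = trans (cong (val p q ·_) (prod-gaps n q ps s))
      (sym (val-split p q n (<⇒≤ lt) (<⇒≤ (sorted-head n q ps s))))

    suffixes-gaps : ∀ n ps → Sorted n ps → suffixes (gaps n ps) ≡ map (λ p → val p n) ps
    suffixes-gaps n [] s = refl
    suffixes-gaps n (p ∷ []) s = cong (_∷ []) (idʳ _)
    suffixes-gaps n (p ∷ q ∷ ps) (lt , s) = cong₂ _∷_ (prod-gaps n p (q ∷ ps) (lt , s)) (suffixes-gaps n (q ∷ ps) s)

    merge-gaps : ∀ n m ps → Sorted n ps → mergeAt (suc m) (gaps n ps) ≡ gaps n (removeAt (suc m) ps)
    merge-gaps n m [] s = refl
    merge-gaps n zero (p ∷ []) s = refl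
    merge-gaps n (suc m) (p ∷ []) s = refl
    merge-gaps n zero (p ∷ q ∷ []) (lt , lt') = cong (_∷ []) (sym (val-split p q n (<⇒≤ lt) (<⇒≤ lt')))
    merge-gaps n zero (p ∷ q ∷ r ∷ ps) (lt , lt' , s) = cong (_∷ gaps n (r ∷ ps)) (sym (val-split p q r (<⇒≤ lt) (<⇒≤ lt')))
    merge-gaps n (suc zero) (p ∷ q ∷ ps) (lt , s) = cong (val p q ∷_) (merge-gaps n zero (q ∷ ps) s)
    merge-gaps n (suc (suc m)) (p ∷ q ∷ ps) (lt , s) = cong (val p q ∷_) (merge-gaps n (suc m) (q ∷ ps) s)

    val-refl : ∀ i → val i i ≡ ε
    val-refl i = cong (seg i) (n∸n≡0 i)

    between-from : ∀ n p ps → Sorted n (p ∷ ps) → ∀ m {q} → at (p ∷ ps) m ≡ just q →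
      between 0 m (gaps n (p ∷ ps)) ≡ val p q
    between-from n p ps s zero refl = sym (val-refl p)
    between-from n p (r ∷ ps) (lt , s) (suc zero) refl = idʳ _
    between-from n p (r ∷ ps) (lt , s) (suc (suc m)) {t} e = trans (cong (val p r ·_) (between-from n r ps s (suc m) e))
      (sym (val-split p r t (<⇒≤ lt) (<⇒≤ (sorted-at n r ps s m e))))

    between-gaps : ∀ n ps → Sorted n ps → ∀ l m {p q} → l < m → at ps l ≡ just p → at ps m ≡ just q →
      between l m (gaps n ps) ≡ val p q
    between-gaps n (p ∷ ps) s zero m lt refl b = between-from n p ps s m b
    between-gaps n (p ∷ q ∷ ps) s (suc l) (suc m) (s≤s lt) a b =
      between-gaps n (q ∷ ps) (sorted-tail n p (q ∷ ps) s) l m lt a b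

    length-gaps : ∀ n ps → length (gaps n ps) ≡ length ps
    length-gaps n [] = refl
    length-gaps n (p ∷ []) = refl
    length-gaps n (p ∷ q ∷ ps) = cong suc (length-gaps n (q ∷ ps))

    forget : Event → List ℕ → List ℕ
    forget nothing        ps = ps
    forget (just (l , m)) ps = removeAt m ps

    positions extended : ℕ → List ℕ
    event : ℕ → Event
    extended n = positions n ++ [ n ]
    event n = duplicate (map (λ p → val p (suc n)) (extended n))
    positions zero = []
    positions (suc n) = forget (event n) (extended n)

    sorted : ∀ n → Sorted n (positions n)
    sorted-ext : ∀ n → Sorted (suc n) (extended n)
    sorted zero = tt
    sorted (suc n) with event n
    ... | nothing = sorted-ext n
    ... | just (l , m) = sorted-remove (suc n) m _ (sorted-ext n)
    sorted-ext n = sorted-snoc n (positions n) (sorted n)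

    record Fires (n l m : ℕ) : Set where
      field
        i j   : ℕ
        l<m   : l < m
        at-l  : at (extended n) l ≡ just i
        at-m  : at (extended n) m ≡ just j
        same  : val i (suc n) ≡ val j (suc n)

    abstract
     fires : ∀ n {l m} → event n ≡ just (l , m) → Fires n l m
     fires n {l} {m} e with scan-just [] (map (λ p → val p (suc n)) (extended n)) e
     ... | l<m , x , a , b with at-defined (extended n) l (subst (l <_) (length-map (λ p → val p (suc n)) (extended n)) (at-length (map (λ p → val p (suc n)) (extended n)) l a))
                             | at-defined (extended n) m (subst (m <_) (length-map (λ p → val p (suc n)) (extended n)) (at-length (map (λ p → val p (suc n)) (extended n)) m b))
     ...   | i , ai | j , aj = record { i = i ; j = j ; l<m = l<m ; at-l = ai ; at-m = aj
       ; same = just-inj (trans (sym (at-map (λ p → val p (suc n)) (extended n) l ai)) (trans a (trans (sym b) (at-map (λ p → val p (suc n)) (extended n) m aj)))) }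

    -- Without a duplicate, the values up to now are distinct elements of the monoid; with one, a
    -- position is dropped right after one was added.
    length-positions : ∀ n → length (positions n) ≤ N
    length-positions zero = z≤n
    length-positions (suc n) with event n in eq
    ... | nothing = subst (_≤ N) (length-map (λ p → val p (suc n)) (extended n))
                      (distinct-length (map (λ p → val p (suc n)) (extended n)) (scan-nothing [] (map (λ p → val p (suc n)) (extended n)) eq λ _ _ ()))
    ... | just (l , m) = ≤-trans (≤-reflexive (cong (_∸ 1)
            (trans (length-removeAt m (extended n) (at-length (extended n) m (Fires.at-m (fires n eq)))) (length-snoc (positions n) n))))
            (length-positions n)

    run-decode : ∀ n → decode (proj₁ (run w n)) ≡ gaps n (positions n)
    step-gaps : ∀ n → decode (proj₁ (run w n)) ++ [ w n ] ≡ gaps (suc n) (extended n)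
    step-event : ∀ n → duplicate (suffixes (gaps (suc n) (extended n))) ≡ event n
    step-gaps n = trans (cong (_++ [ w n ]) (run-decode n)) (gaps-snoc n (positions n))
    step-event n = cong duplicate (suffixes-gaps (suc n) (extended n) (sorted-ext n))
    run-decode zero = decode-encode N [] z≤n
    run-decode (suc n) = trans (cong (λ gs → decode (encode N (fstep gs))) (step-gaps n))
      (trans (cong (λ ev → decode (encode N (contract ev (gaps (suc n) (extended n))))) (step-event n))
      (trans (cong (λ gs → decode (encode N gs)) (contracted (event n) refl))
        (decode-encode N _ (subst (_≤ N) (sym (length-gaps (suc n) (positions (suc n)))) (length-positions (suc n))))))
      where
      contracted : ∀ ev → event n ≡ ev → contract ev (gaps (suc n) (extended n)) ≡ gaps (suc n) (forget ev (extended n))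
      contracted nothing e = refl
      contracted (just (l , zero)) e with Fires.l<m (fires n e)
      ... | ()
      contracted (just (l , suc m)) e = merge-gaps (suc n) m (extended n) (sorted-ext n)

    prio-suc : ∀ n → prio (run w (suc n)) ≡ priority (event n) (gaps (suc n) (extended n)) ⊓ quiet
    prio-suc n = trans (toℕ-fromℕ< _) (cong (_⊓ quiet) (trans (cong fprio (step-gaps n))
      (cong (λ ev → priority ev (gaps (suc n) (extended n))) (step-event n))))

    index-small : ∀ n {l m} → event n ≡ just (l , m) → m ≤ N
    index-small n {l} {m} e = ≤-pred (≤-trans (at-length (extended n) m (Fires.at-m (fires n e)))
        (≤-trans (≤-reflexive (length-snoc (positions n) n)) (s≤s (length-positions n))))

    verdict : ∀ n {l m} → event n ≡ just (l , m) → Bool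
    verdict n e = let open Fires (fires n e) in accept (val 0 i) (val i j)

    double-bound : ∀ b m → m ≤ N → double b m ≤ quiet
    double-bound true m le = ≤-trans (*-monoʳ-≤ 2 (m≤n⇒m≤1+n le)) (n≤1+n _)
    double-bound false m le = s≤s (*-monoʳ-≤ 2 (m≤n⇒m≤1+n le))

    -- A position is forgotten only in favour of an older one, so position 0 survives. Hence
    -- `between 0 l` is the value of the whole input before the position of index `l`.
    first-zero : ∀ n {p} → at (extended n) 0 ≡ just p → p ≡ 0
    first-zero zero e = sym (just-inj e)
    first-zero (suc n) e with at-snoc (positions (suc n)) 0 e
    first-zero (suc n) e | inj₁ a with event n in eq
    ... | nothing = first-zero n a
    ... | just (l , m) = first-zero n (trans (sym (at-removeAt-< m (extended n) 0
                           (≤-<-trans z≤n (Fires.l<m (fires n eq))))) a)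
    first-zero (suc n) e | inj₂ refl with positions (suc n) in eq'
    ... | _ ∷ ps = ⊥-elim (<-irrefl refl (sorted-bound (suc n) (positions (suc n)) (sorted (suc n)) 0
            (trans (cong (λ z → at z 0) eq') e)))
    ... | [] with event n in eq
    ...   | nothing = ⊥-elim (snoc-nonempty (positions n) eq')
      where
      snoc-nonempty : ∀ (xs : List ℕ) {y} → xs ++ [ y ] ≢ []
      snoc-nonempty [] ()
      snoc-nonempty (_ ∷ _) ()
    ...   | just (l , m) = case trans (sym (cong (λ z → at z 0) eq')) (trans (at-removeAt-< m (extended n) 0
                           (≤-<-trans z≤n (Fires.l<m (fires n eq)))) (proj₂ (at-defined (extended n) 0
                             (subst (0 <_) (sym (length-snoc (positions n) n)) (s≤s z≤n))))) of λ ()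

    prio-event : ∀ n {l m} (e : event n ≡ just (l , m)) → prio (run w (suc n)) ≡ double (verdict n e) m
    prio-event n {l} {m} e = trans (prio-suc n) (trans (cong (λ ev → priority ev gs ⊓ quiet) e)
        (trans (cong (λ z → double z m ⊓ quiet ⊓ quiet) (cong₂ accept b1 b2))
          (trans (cong (_⊓ quiet) (m≤n⇒m⊓n≡m bd)) (m≤n⇒m⊓n≡m bd))))
      where
      open Fires (fires n e)
      gs = gaps (suc n) (extended n)
      bd = double-bound (verdict n e) m (index-small n e)
      b2 : between l m gs ≡ val i j
      b2 = between-gaps (suc n) (extended n) (sorted-ext n) l m l<m at-l at-m
      b1 : between 0 l gs ≡ val 0 i
      b1 = prefix l at-l
        where
        prefix : ∀ l → at (extended n) l ≡ just i → between 0 l gs ≡ val 0 i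
        prefix zero a rewrite first-zero n a = sym (val-refl 0)
        prefix (suc l) a with at-defined (extended n) 0 (≤-<-trans z≤n (at-length (extended n) _ a))
        ... | p , a0 with first-zero n a0
        ...   | refl = between-gaps (suc n) (extended n) (sorted-ext n) 0 (suc l) (s≤s z≤n) a0 a

    prio-quiet : ∀ n → event n ≡ nothing → prio (run w (suc n)) ≡ quiet
    prio-quiet n e = trans (prio-suc n) (trans (cong (λ ev → priority ev (gaps (suc n) (extended n)) ⊓ quiet) e) (⊓-idem quiet))

    module Limit (em : Classical) (Good : Set)
      (spec : ∀ {s e} → Factors s e → (accept s e ≡ true → Good) × (accept s e ≡ false → ¬ Good)) where

      Fired : ℕ → ℕ → Set
      Fired m n = ∃ λ l → event n ≡ just (l , m)

      abstract
       -- Otherwise the list of positions would grow at every step and exceed `N`.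
       often : Inf (λ n → ∃ λ l → ∃ λ m → event n ≡ just (l , m))
       often = dne em λ ni → impossible (¬inf→ev em ni)
         where
         grow : ∀ k → (∀ m → k ≤ m → ¬ ∃ λ l → ∃ λ m' → event m ≡ just (l , m')) →
           ∀ d → length (positions (d + k)) ≡ length (positions k) + d
         grow k q zero = sym (+-identityʳ _)
         grow k q (suc d) with event (d + k) in eq
         ... | nothing = trans (length-snoc (positions (d + k)) (d + k)) (trans (cong suc (grow k q d)) (sym (+-suc _ d)))
         ... | just (l , m) = ⊥-elim (q (d + k) (m≤n+m k d) (l , m , eq))
         impossible : Ev (λ n → ¬ ∃ λ l → ∃ λ m → event n ≡ just (l , m)) → ⊥
         impossible (k , q) = <-irrefl refl (≤-trans (s≤s (m≤n+m N (length (positions k))))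
           (≤-trans (≤-reflexive (sym (trans (grow k q (suc N)) (+-suc _ N)))) (length-positions (suc N + k))))

       infIndex : ∃ λ (i : Fin (suc N)) → Inf (Fired (toℕ i))
       infIndex = inf-Fin em (inf-map (λ n (l , m , e) →
         fromℕ< (s≤s (index-small n e)) , l , trans e (cong (λ z → just (l , z)) (sym (toℕ-fromℕ< _)))) often)

       leastIndex : ∃ λ m → Inf (Fired m) × (∀ m' → m' < m → ¬ Inf (Fired m'))
       leastIndex = least em {λ m → Inf (Fired m)} (toℕ (proj₁ infIndex) , proj₂ infIndex)

       above : ∀ b → (∀ m' → m' < b → ¬ Inf (Fired m')) → Ev (λ n → ∀ {l m} → event n ≡ just (l , m) → b ≤ m)
       above zero f = 0 , λ _ _ _ → z≤n
       above (suc b) f = combine' (above b (λ m' lt → f m' (m<n⇒m<1+n lt))) (¬inf→ev em (f b ≤-refl))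
         where
         combine' : Ev (λ n → ∀ {l m} → event n ≡ just (l , m) → b ≤ m) → Ev (λ n → ¬ Fired b n) →
           Ev (λ n → ∀ {l m} → event n ≡ just (l , m) → suc b ≤ m)
         combine' (k , g) (k' , h) = k + k' , λ n le {l} {m} e → ≤∧≢⇒< (g n (≤-trans (m≤m+n k k') le) e)
             λ { refl → h n (≤-trans (m≤n+m k' k) le) (l , e) }

      module Tail (m★ : ℕ) (hits : Inf (Fired m★)) (K : ℕ)
        (after : ∀ n {l m} → K ≤ n → event n ≡ just (l , m) → m★ ≤ m) where

        stable : ∀ n d l {p} → K ≤ n → l < m★ → at (extended n) l ≡ just p → at (extended (d + n)) l ≡ just p
        stable n zero l le lt a = a
        stable n (suc d) l le lt a = at-++ˡ (positions (suc (d + n))) l kept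
          where
          kept : at (positions (suc (d + n))) l ≡ just _
          kept with event (d + n) in eq
          ... | nothing = stable n d l le lt a
          ... | just (_ , m) = trans (at-removeAt-< m (extended (d + n)) l
                   (<-≤-trans lt (after (d + n) (≤-trans le (m≤n+m n d)) eq))) (stable n d l le lt a)

        -- When index `m★` fires and forgets `J`, everything from that index on is younger than `J`
        -- and stays so. Hence the positions forgotten at `m★` strictly increase.
        Beyond : ℕ → ℕ → Set
        Beyond J n = ∀ j {p} → m★ ≤ j → at (positions n) j ≡ just p → J < p

        beyond-ext : ∀ {J n} → Beyond J n → J < n → ∀ j {p} → m★ ≤ j → at (extended n) j ≡ just p → J < p
        beyond-ext {J} {n} b lt j le a with at-snoc (positions n) j a
        ... | inj₁ a' = b j le a'
        ... | inj₂ refl = lt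

        beyond-step : ∀ {J n} → K ≤ n → Beyond J n → J < n → Beyond J (suc n)
        beyond-step {J} {n} le b lt j le' a with event n in eq
        ... | nothing = beyond-ext {J} {n} b lt j le' a
        ... | just (l , m) with <-cmp j m
        ...   | tri< j<m _ _ = beyond-ext {J} {n} b lt j le' (trans (sym (at-removeAt-< m (extended n) j j<m)) a)
        ...   | tri≈ _ refl _ = beyond-ext {J} {n} b lt (suc j) (m≤n⇒m≤1+n le') (trans (sym (at-removeAt-≥ m (extended n) j ≤-refl)) a)
        ...   | tri> _ _ m<j = beyond-ext {J} {n} b lt (suc j) (m≤n⇒m≤1+n le')
                                  (trans (sym (at-removeAt-≥ m (extended n) j (<⇒≤ m<j))) a)

        beyond-fired : ∀ n {l} (e : event n ≡ just (l , m★)) → Beyond (Fires.j (fires n e)) (suc n)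
        beyond-fired n {l} e j {p} le a = sorted-lt (suc n) (extended n) (sorted-ext n) m★ (suc j) (s≤s le) (Fires.at-m (fires n e))
          (trans (sym (at-removeAt-≥ m★ (extended n) j le)) (trans (cong (λ ev → at (forget ev (extended n)) j) (sym e)) a))

        j-bound : ∀ n {l m} (e : event n ≡ just (l , m)) → Fires.j (fires n e) < suc n
        j-bound n e = sorted-bound (suc n) (extended n) (sorted-ext n) _ (Fires.at-m (fires n e))

        beyond-later : ∀ n {l} → K ≤ n → (e : event n ≡ just (l , m★)) → ∀ d → Beyond (Fires.j (fires n e)) (d + suc n)
        beyond-later n le e zero = beyond-fired n e
        beyond-later n le e (suc d) = beyond-step (≤-trans le (≤-trans (n≤1+n n) (m≤n+m (suc n) d))) (beyond-later n le e d)
          (≤-trans (j-bound n e) (m≤n+m (suc n) d))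

        later-fires : ∀ n {l} → K ≤ n → (e : event n ≡ just (l , m★)) → ∀ n' {l'} → n < n' →
          (e' : event n' ≡ just (l' , m★)) → Fires.j (fires n e) < Fires.j (fires n' e')
        later-fires n le e n' lt e' with m≤n⇒∃[o]o+m≡n lt
          where
          m≤n⇒∃[o]o+m≡n : ∀ {m n} → m ≤ n → ∃ λ o → o + m ≡ n
          m≤n⇒∃[o]o+m≡n {m} {n} le = n ∸ m , m∸n+n≡m le
        ... | d , refl = beyond-ext (beyond-later n le e d) (≤-trans (j-bound n e) (m≤n+m (suc n) d)) m★ ≤-refl (Fires.at-m (fires _ e'))

        -- The position of index `l` is frozen at `I`. Once a position is forgotten in favour of
        -- `I`, the two have the same value up to every later point, so the value `e` from `I` to
        -- each forgotten position is also the value between consecutive ones.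
        module Recurring (l : ℕ) (e : S)
          (rec : Inf (λ n → Σ (event n ≡ just (l , m★)) λ ev → val (Fires.i (fires n ev)) (Fires.j (fires n ev)) ≡ e)) where

          Hit : ℕ → Set
          Hit n = K ≤ n × Σ (event n ≡ just (l , m★)) λ ev → val (Fires.i (fires n ev)) (Fires.j (fires n ev)) ≡ e

          J : ∀ n → Hit n → ℕ
          J n (_ , ev , _) = Fires.j (fires n ev)

          hit-after : ∀ k → ∃ λ n → k ≤ n × Hit n
          hit-after k = let (n , le , h) = rec (k + K) in n , ≤-trans (m≤m+n k K) le , ≤-trans (m≤n+m K k) le , h

          abstract
           far : ∀ b → ∃ λ n → Σ (Hit n) λ h → b ≤ J n h
           far zero = let (n , _ , h) = hit-after 0 in n , h , z≤n
           far (suc b) with far b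
           ... | n , h@(le , ev , _) , bn with hit-after (suc n)
           ...   | n' , lt , h'@(_ , ev' , _) = n' , h' , ≤-<-trans bn (later-fires n le ev n' lt ev')

          n0 : ℕ
          n0 = proj₁ (far 0)
          h0 : Hit n0
          h0 = proj₁ (proj₂ (far 0))
          I : ℕ
          I = Fires.i (fires n0 (proj₁ (proj₂ h0)))

          l<m★ : l < m★
          l<m★ = Fires.l<m (fires n0 (proj₁ (proj₂ h0)))

          stable-i : ∀ n (h : Hit n) → Fires.i (fires n (proj₁ (proj₂ h))) ≡ I
          stable-i n h@(le , ev , _) with ≤-total n n0
          ... | inj₁ le' = just-inj (trans (sym (stable n (n0 ∸ n) l le l<m★ (Fires.at-l (fires n ev))))
                 (trans (cong (λ z → at (extended z) l) (m∸n+n≡m le')) (Fires.at-l (fires n0 (proj₁ (proj₂ h0))))))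
          ... | inj₂ le' = just-inj (trans (sym (Fires.at-l (fires n ev))) (trans (cong (λ z → at (extended z) l) (sym (m∸n+n≡m le')))
                 (stable n0 (n ∸ n0) l (proj₁ h0) l<m★ (Fires.at-l (fires n0 (proj₁ (proj₂ h0)))))))

          times : ℕ → ∃ Hit
          times zero = n0 , h0
          times (suc k) = let (n , h , _) = far (suc (proj₁ (times k))) in n , h

          pos : ℕ → ℕ
          pos k = let (n , h) = times k in J n h

          -- The next forgotten position must lie after the moment at which the previous one was
          -- forgotten: only from then on do its value and that of `I` agree.
          pos-after : ∀ k → suc (proj₁ (times k)) ≤ pos (suc k)
          pos-after k = proj₂ (proj₂ (far (suc (proj₁ (times k)))))

          pos-before : ∀ k → pos k < suc (proj₁ (times k))
          pos-before k = let (n , (_ , ev , _)) = times k in j-bound n ev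

          I<pos : ∀ k → I < pos k
          I<pos k = before (times k)
            where
            before : (x : ∃ Hit) → I < J (proj₁ x) (proj₂ x)
            before (n , h@(_ , ev , _)) = subst (_< Fires.j (fires n ev)) (stable-i n h)
              (sorted-lt (suc n) (extended n) (sorted-ext n) l m★ (Fires.l<m (fires n ev)) (Fires.at-l (fires n ev)) (Fires.at-m (fires n ev)))

          from-I : ∀ k → val I (pos k) ≡ e
          from-I k = let (n , h@(_ , ev , eq)) = times k in trans (cong (λ z → val z (pos k)) (sym (stable-i n h))) eq

          from-pos : ∀ k b → suc (proj₁ (times k)) ≤ b → val (pos k) b ≡ val I b
          from-pos k b le = let (n , h@(_ , ev , eq)) = times k in
            trans (val-split (pos k) (suc n) b (<⇒≤ (pos-before k)) le)
              (trans (cong (_· val (suc n) b) (trans (sym (Fires.same (fires n ev))) (cong (λ z → val z (suc n)) (stable-i n h))))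
                (sym (val-split I (suc n) b (<⇒≤ (<-trans (I<pos k) (pos-before k))) le)))

          pos-incr : ∀ k → pos k < pos (suc k)
          pos-incr k = <-≤-trans (pos-before k) (pos-after k)

          from-prev : ∀ k → val (pos k) (pos (suc k)) ≡ e
          from-prev k = trans (from-pos k _ (pos-after k)) (from-I (suc k))

          cuts : ℕ → ℕ
          cuts zero = I
          cuts (suc k) = pos k

          factors : Factors (val 0 I) e
          factors = record { cut = cuts ; incr = λ { zero → I<pos 0 ; (suc k) → pos-incr k } ; head = refl
            ; block = λ { zero → from-I 0 ; (suc k) → from-prev k }
            ; idem = trans (cong₂ _·_ (sym (from-I 0)) (sym (from-prev 0)))
                       (trans (sym (val-split I (pos 0) (pos 1) (<⇒≤ (I<pos 0)) (<⇒≤ (pos-incr 0)))) (from-I 1)) }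

        -- There are finitely many pairs `(l , e)`, so one of them recurs with verdict `b`, and `b`
        -- is then the verdict on a genuine factorisation.
        recurring-verdict : ∀ b → Inf (λ n → ∃ λ l → Σ (event n ≡ just (l , m★)) λ ev → verdict n ev ≡ b) →
          (b ≡ true → Good) × (b ≡ false → ¬ Good)
        recurring-verdict b inf = conclude (inf-Fin em {size F} {Class} (inf-map (λ n (l , ev , v) → classify n l ev v) inf))
          where
          F : Finite (Fin m★ × S)
          F = fin× (finFin m★) fin
          Event-of : Fin m★ × S → ℕ → Set
          Event-of (l , e) n = Σ (event n ≡ just (toℕ l , m★)) λ ev → val (Fires.i (fires n ev)) (Fires.j (fires n ev)) ≡ e × verdict n ev ≡ b
          Class : Fin (size F) → ℕ → Set
          Class c = Event-of (from F c)
          classify : ∀ n l (ev : event n ≡ just (l , m★)) → verdict n ev ≡ b → ∃ λ c → Class c n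
          classify n l ev v = to F (fromℕ< (Fires.l<m (fires n ev)) , x) ,
              subst (λ c → Event-of c n) (sym (from-to F (fromℕ< (Fires.l<m (fires n ev)) , x)))
                (subst (λ l → Σ (event n ≡ just (l , m★)) λ ev →
                        val (Fires.i (fires n ev)) (Fires.j (fires n ev)) ≡ x × verdict n ev ≡ b)
                  (sym (toℕ-fromℕ< (Fires.l<m (fires n ev)))) (ev , refl , v))
            where
            x = val (Fires.i (fires n ev)) (Fires.j (fires n ev))
          module _ (c : Fin (size F)) (rec : Inf (Class c)) where
            l : ℕ
            l = toℕ (proj₁ (from F c))
            e : S
            e = proj₂ (from F c)
            module R = Recurring l e (inf-map (λ n (ev , eq , v) → ev , eq) rec)
            b≡ : accept (val 0 R.I) e ≡ b
            b≡ with inf-ev rec (K , λ _ le → le) 0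
            ... | n , _ , (ev , eq , v) , le = trans (sym (cong₂ accept (cong (val 0) (R.stable-i n (le , ev , eq))) eq)) v
            verdicts : (b ≡ true → Good) × (b ≡ false → ¬ Good)
            verdicts = (λ t → proj₁ (spec R.factors) (trans b≡ t)) , (λ f → proj₂ (spec R.factors) (trans b≡ f))
          conclude : ∃ (λ c → Inf (Class c)) → (b ≡ true → Good) × (b ≡ false → ¬ Good)
          conclude (c , rec) = verdicts c rec

        value-priority : ∀ b → Inf (λ n → ∃ λ l → Σ (event n ≡ just (l , m★)) λ ev → verdict n ev ≡ b) →
                         Inf (λ n → prio (run w n) ≡ double b m★)
        value-priority b inf = inf-unshift 1 (inf-map (λ { n (l , ev , refl) → prio-event n ev }) inf)

        double≥ : ∀ b m → 2 * m ≤ double b m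
        double≥ true m = ≤-refl
        double≥ false m = n≤1+n _

        even-2* : ∀ m → even (2 * m) ≡ true
        even-2* zero = refl
        even-2* (suc m) rewrite +-suc m (m + 0) | even-2* m = refl

        m★≤N : m★ ≤ N
        m★≤N with hits 0
        ... | n , _ , l , e = index-small n e

        eventually≥ : Ev (λ n → 2 * m★ ≤ prio (run w n))
        eventually≥ = ev-unshift 1 (K , λ n le → bound n le)
          where
          by : ∀ n → K ≤ n → ∀ ev → event n ≡ ev → 2 * m★ ≤ prio (run w (suc n))
          by n le nothing eq = ≤-trans (double-bound true m★ m★≤N) (≤-reflexive (sym (prio-quiet n eq)))
          by n le (just (l , m)) eq = ≤-trans (≤-trans (*-monoʳ-≤ 2 (after n le eq)) (double≥ (verdict n eq) m))
            (≤-reflexive (sym (prio-event n eq)))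
          bound : ∀ n → K ≤ n → 2 * m★ ≤ prio (run w (suc n))
          bound n le = by n le (event n) refl

        parity-correct : (Good → Parity true (prio ∘ run w)) × (¬ Good → Parity false (prio ∘ run w))
        parity-correct = good , bad
          where
          V : Bool → ℕ → Set
          V b n = ∃ λ l → Σ (event n ≡ just (l , m★)) λ ev → verdict n ev ≡ b
          split : Inf (λ n → V true n ⊎ V false n)
          split = inf-map (λ n (l , ev) → by n l ev (verdict n ev) refl) hits
            where
            by : ∀ n l ev b → verdict n ev ≡ b → V true n ⊎ V false n
            by n l ev true v = inj₁ (l , ev , v)
            by n l ev false v = inj₂ (l , ev , v)
          good : Good → Parity true (prio ∘ run w)
          good g = [ (λ t → 2 * m★ , even-2* m★ , value-priority true t , eventually≥)
                   , (λ f → ⊥-elim (proj₂ (recurring-verdict false f) refl g)) ]′ (inf-⊎ em split)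
          -- Once accepting verdicts at `m★` have stopped, only larger indices remain as
          -- competitors, and these weigh at least `2 * m★ + 2`.
          odd≥ : Ev (λ n → ¬ V true n) → Ev (λ n → suc (2 * m★) ≤ prio (run w n))
          odd≥ (k , noTrue) = ev-unshift 1 (K + k , λ n le → by n (≤-trans (m≤m+n K k) le) (≤-trans (m≤n+m k K) le) (event n) refl)
            where
              Odd : ℕ → Set
              Odd n = suc (2 * m★) ≤ prio (run w (suc n))
              by-verdict : ∀ n {l} → k ≤ n → (ev : event n ≡ just (l , m★)) → ∀ v → verdict n ev ≡ v → Odd n
              by-verdict n le' ev true v = ⊥-elim (noTrue n le' (_ , ev , v))
              by-verdict n le' ev false v = ≤-reflexive (sym (trans (prio-event n ev) (cong (λ b → double b m★) v)))
              by : ∀ n → K ≤ n → k ≤ n → ∀ ev → event n ≡ ev → Odd n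
              by n le le' nothing eq = ≤-trans (double-bound false m★ m★≤N) (≤-reflexive (sym (prio-quiet n eq)))
              by n le le' (just (l , m)) eq with m≤n⇒m<n∨m≡n (after n le eq)
              ... | inj₁ lt = ≤-trans (≤-trans (≤-trans (n≤1+n _) (≤-trans (≤-reflexive (cong suc (sym (+-suc m★ (m★ + 0)))))
                      (*-monoʳ-≤ 2 lt))) (double≥ (verdict n eq) m)) (≤-reflexive (sym (prio-event n eq)))
              ... | inj₂ refl = by-verdict n le' eq (verdict n eq) refl
          bad : ¬ Good → Parity false (prio ∘ run w)
          bad ng = [ (λ t → ⊥-elim (ng (proj₁ (recurring-verdict true t) refl)))
                   , (λ f → suc (2 * m★) , cong not (even-2* m★) , value-priority false f ,
                        odd≥ (¬inf→ev em λ t → ng (proj₁ (recurring-verdict true t) refl))) ]′ (inf-⊎ em split)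

      parity-correct : (Good → Parity true (prio ∘ run w)) × (¬ Good → Parity false (prio ∘ run w))
      parity-correct = conclude leastIndex
        where
        conclude : (∃ λ m → Inf (Fired m) × (∀ m' → m' < m → ¬ Inf (Fired m'))) →
          (Good → Parity true (prio ∘ run w)) × (¬ Good → Parity false (prio ∘ run w))
        conclude (m , inf , mn) = let (K , af) = above m mn in Tail.parity-correct m inf K (λ n le → af n le)

-- Paths and traces through sequences of finite graphs.

bool-iff : ∀ {a b : Bool} → (a ≡ true → b ≡ true) → (b ≡ true → a ≡ true) → a ≡ b
bool-iff {true}  {true}  f g = refl
bool-iff {false} {false} f g = refl
bool-iff {true}  {false} f g = sym (f refl)
bool-iff {false} {true}  f g = g refl

dec→ : ∀ {P : Set} (d : Dec P) → does d ≡ true → P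
dec→ (yes p) _ = p

→dec : ∀ {P : Set} (d : Dec P) → P → does d ≡ true
→dec d p = dec-true d p

vec-ext : ∀ {A : Set} {n} (v w : Vec A n) → (∀ i → lookup v i ≡ lookup w i) → v ≡ w
vec-ext []ᵥ []ᵥ f = refl
vec-ext (x ∷ᵥ v) (y ∷ᵥ w) f = cong₂ _∷ᵥ_ (f zero) (vec-ext v w (λ i → f (suc i)))

minF : ∀ {n} → Fin n → Fin n → Fin n
minF zero    _       = zero
minF (suc a) zero    = zero
minF (suc a) (suc b) = suc (minF a b)

toℕ-minF : ∀ {n} (a b : Fin n) → toℕ (minF a b) ≡ toℕ a ⊓ toℕ b
toℕ-minF zero    b       = refl
toℕ-minF (suc a) zero    = refl
toℕ-minF (suc a) (suc b) = cong suc (toℕ-minF a b)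

minF-assoc : ∀ {n} (a b c : Fin n) → minF (minF a b) c ≡ minF a (minF b c)
minF-assoc zero b c = refl
minF-assoc (suc a) zero c = refl
minF-assoc (suc a) (suc b) zero = refl
minF-assoc (suc a) (suc b) (suc c) = cong suc (minF-assoc a b c)

topF : ∀ {n} → Fin (suc n)
topF {n} = fromℕ n

minF-topˡ : ∀ {n} (a : Fin (suc n)) → minF topF a ≡ a
minF-topˡ {zero} zero = refl
minF-topˡ {suc n} zero = refl
minF-topˡ {suc n} (suc a) = cong suc (minF-topˡ a)

minF-topʳ : ∀ {n} (a : Fin (suc n)) → minF a topF ≡ a
minF-topʳ {zero} zero = refl
minF-topʳ {suc n} zero = refl
minF-topʳ {suc n} (suc a) = cong suc (minF-topʳ a)

-- The matrix of a finite sequence of graphs on Fin n records between which vertices there is a path through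
-- the sequence and with which minimal priority.
module Traces {n D : ℕ} (c : Fin n → Fin (suc D)) (init : Fin n → Bool) where

  Graph : Set
  Graph = Fin n → Fin n → Bool

  Matrix : Set
  Matrix = Vec (Vec (Vec Bool (suc D)) n) n

  mem : Matrix → Fin n → Fin n → Fin (suc D) → Bool
  mem s q r p = lookup (lookup (lookup s q) r) p

  build : (Fin n → Fin n → Fin (suc D) → Bool) → Matrix
  build f = tabulate λ q → tabulate λ r → tabulate (f q r)

  mem-build : ∀ f q r p → mem (build f) q r p ≡ f q r p
  mem-build f q r p = trans (cong (λ v → lookup (lookup v r) p) (lookup∘tabulate _ q))
    (trans (cong (λ v → lookup v p) (lookup∘tabulate _ r)) (lookup∘tabulate (f q r) p))

  matrix-ext : ∀ s t → (∀ q r p → mem s q r p ≡ mem t q r p) → s ≡ t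
  matrix-ext s t f = vec-ext s t λ q → vec-ext _ _ λ r → vec-ext _ _ (f q r)

  Through : Matrix → Matrix → Fin n → Fin n → Fin (suc D) → Set
  Through s t q q' p = ∃ λ r → ∃ λ p₁ → ∃ λ p₂ → mem s q r p₁ ≡ true × mem t r q' p₂ ≡ true × minF p₁ p₂ ≡ p

  through? : ∀ s t q q' p → Dec (Through s t q q' p)
  through? s t q q' p = any? λ r → any? λ p₁ → any? λ p₂ →
    (mem s q r p₁ ≟B true) ×-dec (mem t r q' p₂ ≟B true) ×-dec (minF p₁ p₂ ≟F p)

  infixl 7 _⊗_
  abstract
    _⊗_ : Matrix → Matrix → Matrix
    s ⊗ t = build λ q q' p → does (through? s t q q' p)

    unit : Matrix
    unit = build λ q r p → does ((q ≟F r) ×-dec (p ≟F topF))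

    step : Graph → Matrix
    step E = build λ q r p → does ((E q r ≟B true) ×-dec (p ≟F c q))

    ⊗-elim : ∀ s t q r p → mem (s ⊗ t) q r p ≡ true → Through s t q r p
    ⊗-elim s t q r p e = dec→ (through? s t q r p) (trans (sym (mem-build (λ q q' p → does (through? s t q q' p)) q r p)) e)

    ⊗-intro : ∀ s t q r p → Through s t q r p → mem (s ⊗ t) q r p ≡ true
    ⊗-intro s t q r p x = trans (mem-build (λ q q' p → does (through? s t q q' p)) q r p) (→dec (through? s t q r p) x)

    unit-elim : ∀ q r p → mem unit q r p ≡ true → q ≡ r × p ≡ topF
    unit-elim q r p e = dec→ ((q ≟F r) ×-dec (p ≟F topF))
      (trans (sym (mem-build (λ q r p → does ((q ≟F r) ×-dec (p ≟F topF))) q r p)) e)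

    unit-intro : ∀ q → mem unit q q topF ≡ true
    unit-intro q = trans (mem-build (λ q r p → does ((q ≟F r) ×-dec (p ≟F topF))) q q topF)
      (→dec ((q ≟F q) ×-dec (topF {D} ≟F topF {D})) (refl , refl))

    step-elim : ∀ E q r p → mem (step E) q r p ≡ true → E q r ≡ true × p ≡ c q
    step-elim E q r p e = dec→ ((E q r ≟B true) ×-dec (p ≟F c q))
      (trans (sym (mem-build (λ q r p → does ((E q r ≟B true) ×-dec (p ≟F c q))) q r p)) e)

    step-intro : ∀ E q r → E q r ≡ true → mem (step E) q r (c q) ≡ true
    step-intro E q r e = trans (mem-build (λ q r p → does ((E q r ≟B true) ×-dec (p ≟F c q))) q r (c q))
      (→dec ((E q r ≟B true) ×-dec (c q ≟F c q)) (e , refl))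

  ⊗-assoc : ∀ x y z → x ⊗ y ⊗ z ≡ x ⊗ (y ⊗ z)
  ⊗-assoc x y z = matrix-ext (x ⊗ y ⊗ z) (x ⊗ (y ⊗ z)) λ q r p →
    bool-iff (λ e → right q r p (⊗-elim (x ⊗ y) z q r p e)) (λ e → left q r p (⊗-elim x (y ⊗ z) q r p e))
    where
    right : ∀ q r p → Through (x ⊗ y) z q r p → mem (x ⊗ (y ⊗ z)) q r p ≡ true
    right q r _ (r₁ , p₁ , p₂ , e , e' , refl) with ⊗-elim x y q r₁ p₁ e
    ... | r' , p₃ , p₄ , a , b , refl = ⊗-intro x (y ⊗ z) q r _
      (r' , p₃ , minF p₄ p₂ , a , ⊗-intro y z r' r _ (r₁ , p₄ , p₂ , b , e' , refl) , sym (minF-assoc p₃ p₄ p₂))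
    left : ∀ q r p → Through x (y ⊗ z) q r p → mem (x ⊗ y ⊗ z) q r p ≡ true
    left q r _ (r₁ , p₁ , p₂ , e , e' , refl) with ⊗-elim y z r₁ r p₂ e'
    ... | r' , p₃ , p₄ , a , b , refl = ⊗-intro (x ⊗ y) z q r _
      (r' , minF p₁ p₃ , p₄ , ⊗-intro x y q r' _ (r₁ , p₁ , p₃ , e , a , refl) , b , minF-assoc p₁ p₃ p₄)

  unit-⊗ : ∀ x → unit ⊗ x ≡ x
  unit-⊗ x = matrix-ext (unit ⊗ x) x λ q r p → bool-iff (λ e → un q r p (⊗-elim unit x q r p e))
    (λ e → ⊗-intro unit x q r p (q , topF , p , unit-intro q , e , minF-topˡ p))
    where
    un : ∀ q r p → Through unit x q r p → mem x q r p ≡ true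
    un q r _ (r₁ , p₁ , p₂ , e , e' , refl) with unit-elim q r₁ p₁ e
    ... | refl , refl = trans (cong (mem x q r) (minF-topˡ p₂)) e'

  ⊗-unit : ∀ x → x ⊗ unit ≡ x
  ⊗-unit x = matrix-ext (x ⊗ unit) x λ q r p → bool-iff (λ e → un q r p (⊗-elim x unit q r p e))
    (λ e → ⊗-intro x unit q r p (r , p , topF , e , unit-intro r , minF-topʳ p))
    where
    un : ∀ q r p → Through x unit q r p → mem x q r p ≡ true
    un q r _ (r₁ , p₁ , p₂ , e , e' , refl) with unit-elim r₁ r p₂ e'
    ... | refl , refl = trans (cong (mem x q r) (minF-topʳ p₁)) e

  monoid : FiniteMonoid
  monoid = record { S = Matrix ; fin = finVec (finVec (finVec finBool (suc D)) n) n ; ε = unit ; _·_ = _⊗_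
                  ; assoc = ⊗-assoc ; idˡ = unit-⊗ ; idʳ = ⊗-unit }

  -- A block `e` is appended to `s` because the recurring vertex is met at some later cut, before
  -- which any positive number of blocks multiplies out to `s ⊗ e`.
  Lasso : Bool → Matrix → Matrix → Set
  Lasso b s e = ∃ λ q₀ → ∃ λ q → ∃ λ p' → ∃ λ p →
    init q₀ ≡ true × mem (s ⊗ e) q₀ q p' ≡ true × mem e q q p ≡ true × even (toℕ p) ≡ b

  abstract
   lasso? : ∀ b s e → Dec (Lasso b s e)
   lasso? b s e = any? λ q₀ → any? λ q → any? λ p' → any? λ p →
    (init q₀ ≟B true) ×-dec (mem (s ⊗ e) q₀ q p' ≟B true) ×-dec (mem e q q p ≟B true) ×-dec (even (toℕ p) ≟B b)

  record Trace (E : ℕ → Graph) (b : Bool) : Set where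
    field
      τ      : ℕ → Fin n
      begins : init (τ 0) ≡ true
      edges  : ∀ t → E t (τ t) (τ (suc t)) ≡ true
      parity : Parity b (λ t → toℕ (c (τ t)))

  module Word (E : ℕ → Graph) where
    open Segments monoid (λ t → step (E t))

    data Path : ℕ → ℕ → Fin n → Fin n → Fin (suc D) → Set where
      nil  : ∀ {i q} → Path i 0 q q topF
      cons : ∀ {i l q r q' p} → E i q r ≡ true → Path (suc i) l r q' p → Path i (suc l) q q' (minF (c q) p)

    seg→path : ∀ i l {q r p} → mem (seg i l) q r p ≡ true → Path i l q r p
    seg→path i zero {q} {r} {p} e with unit-elim q r p e
    ... | refl , refl = nil
    seg→path i (suc l) {q} {q'} {p} e with ⊗-elim (step (E i)) (seg (suc i) l) q q' p e
    ... | r , p₁ , p₂ , a , b , refl with step-elim (E i) q r p₁ a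
    ...   | a' , refl = cons a' (seg→path (suc i) l b)

    path→seg : ∀ i l {q r p} → Path i l q r p → mem (seg i l) q r p ≡ true
    path→seg i zero nil = unit-intro _
    path→seg i (suc l) (cons e ps) = ⊗-intro (step (E i)) (seg (suc i) l) _ _ _ (_ , _ , _ , step-intro (E i) _ _ e , path→seg (suc i) l ps , refl)

    -- The two bounds determine `p` in the use below: it is at most every priority met and at least
    -- any lower bound of the whole tail, so it equals a recurring minimum that is attained on the
    -- way.
    follow : ∀ (τ : ℕ → Fin n) → (∀ t → E t (τ t) (τ (suc t)) ≡ true) → ∀ i l → ∃ λ p → Path i l (τ i) (τ (l + i)) p ×
      (∀ j → i ≤ j → j < l + i → toℕ p ≤ toℕ (c (τ j))) ×
      (∀ (x : Fin (suc D)) → (∀ j → i ≤ j → toℕ x ≤ toℕ (c (τ j))) → toℕ x ≤ toℕ p)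
    follow τ es i zero = topF , nil , (λ j a b → ⊥-elim (<-irrefl refl (<-≤-trans b a))) , λ x _ → ≤top x
      where
      ≤top : ∀ {m} (x : Fin (suc m)) → toℕ x ≤ toℕ (topF {m})
      ≤top zero = z≤n
      ≤top {suc m} (suc x) = s≤s (≤top x)
    follow τ es i (suc l) with follow τ es (suc i) l
    ... | p , ps , lo , hi = minF (c (τ i)) p , subst (λ z → Path i (suc l) (τ i) (τ z) (minF (c (τ i)) p)) (+-suc l i) (cons (es i) ps) ,
      (λ j a b → case m≤n⇒m<n∨m≡n a of λ where
         (inj₁ lt) → ≤-trans (≤-reflexive (toℕ-minF (c (τ i)) p)) (≤-trans (m⊓n≤n _ _) (lo j lt (subst (j <_) (sym (+-suc l i)) b)))
         (inj₂ refl) → ≤-trans (≤-reflexive (toℕ-minF (c (τ i)) p)) (m⊓n≤m _ _)) ,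
      λ x f → ≤-trans (⊓-glb (f i ≤-refl) (hi x λ j le → f j (<⇒≤ le))) (≤-reflexive (sym (toℕ-minF (c (τ i)) p)))

    module _ {s e} (F : Factors s e) where
      open Factors F

      cut-mono : ∀ k d → cut k ≤ cut (d + k)
      cut-mono k zero = ≤-refl
      cut-mono k (suc d) = ≤-trans (cut-mono k d) (<⇒≤ (incr (d + k)))

      power : ∀ k d → val (cut k) (cut (suc d + k)) ≡ e
      power k zero = block k
      power k (suc d) = trans (val-split (cut k) (cut (suc d + k)) _ (cut-mono k (suc d)) (<⇒≤ (incr (suc d + k))))
        (trans (cong₂ _⊗_ (power k d) (block (suc d + k))) idem)

      initial : ∀ d → val 0 (cut (suc d)) ≡ s ⊗ e
      initial d = trans (val-split 0 (cut 0) _ z≤n (subst (λ z → cut 0 ≤ cut z) (+-identityʳ (suc d)) (cut-mono 0 (suc d))))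
        (cong₂ _⊗_ head (subst (λ z → val (cut 0) (cut z) ≡ e) (+-identityʳ (suc d)) (power 0 d)))

      cut-≥ : ∀ k → k ≤ cut k
      cut-≥ zero = z≤n
      cut-≥ (suc k) = ≤-<-trans (cut-≥ k) (incr k)

      module Build {q₀ q p' p} (i₀ : init q₀ ≡ true) (m₀ : mem (s ⊗ e) q₀ q p' ≡ true) (mₑ : mem e q q p ≡ true) where

        g : ℕ → ℕ
        g k = cut (suc k)

        loop : ∀ k → Path (g k) (suc (g (suc k) ∸ suc (g k))) q q p
        loop k = subst (λ z → Path (g k) z q q p) (+-∸-assoc 1 (incr (suc k)))
          (seg→path (g k) (g (suc k) ∸ g k) (trans (cong (λ z → mem z q q p) (block (suc k))) mₑ))

        -- A place inside the current loop. The remaining path is non-empty, so there is always an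
        -- edge to take.
        record Conf (t : ℕ) : Set where
          constructor conf
          field
            {vertex} : Fin n
            {pr}   : Fin (suc D)
            len k  : ℕ
            path   : Path t (suc len) vertex q pr
            ends   : t + suc len ≡ g k
            low    : toℕ p ≤ toℕ pr

        fresh : ∀ k t → t ≡ g k → Conf t
        fresh k t refl = conf _ (suc k) (loop k) (m+[n∸m]≡n' (incr (suc k))) ≤-refl
          where
          m+[n∸m]≡n' : ∀ {a b} → suc a ≤ b → a + suc (b ∸ suc a) ≡ b
          m+[n∸m]≡n' {a} {b} le = trans (+-suc a _) (m+[n∸m]≡n le)

        rest-low : ∀ (a b : Fin (suc D)) → toℕ p ≤ toℕ (minF a b) → toℕ p ≤ toℕ b
        rest-low a b le = ≤-trans le (≤-trans (≤-reflexive (toℕ-minF a b)) (m⊓n≤n _ _))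

        advance : ∀ {t} → Conf t → Conf (suc t)
        advance {t} (conf zero k (cons {p = r} e nil) en lo) = fresh k (suc t) (trans (+-comm 1 t) en)
        advance {t} (conf (suc l) k (cons {q = r} {p = z} e ps) en lo) = conf l k ps (trans (sym (+-suc t (suc l))) en) (rest-low (c r) z lo)

        advance-edge : ∀ {t} (x : Conf t) → E t (Conf.vertex x) (Conf.vertex (advance x)) ≡ true
        advance-edge {t} (conf zero k (cons e nil) en lo) = trans (cong (λ z → E t _ z) (fresh-vertex k (suc t) (trans (+-comm 1 t) en))) e
          where
          fresh-vertex : ∀ k t eq → Conf.vertex (fresh k t eq) ≡ q
          fresh-vertex k t refl = refl
        advance-edge (conf (suc l) k (cons e ps) en lo) = e

        confs : ∀ d → Conf (d + g 0)
        confs zero = fresh 0 (g 0) refl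
        confs (suc d) = advance (confs d)

        σ : ℕ → Fin n
        σ d = Conf.vertex (confs d)

        conf-low : ∀ {t} (x : Conf t) → toℕ p ≤ toℕ (c (Conf.vertex x))
        conf-low (conf _ _ (cons {q = r} {p = z} _ _) _ lo) = ≤-trans lo (≤-trans (≤-reflexive (toℕ-minF (c r) z)) (m⊓n≤m _ _))

        iterate : ∀ {t} → Conf t → ∀ d → Conf (d + t)
        iterate x zero = x
        iterate x (suc d) = advance (iterate x d)

        -- Phrased with a predicate because the two configurations live in types indexed by
        -- different sums.
        iterate-suc : ∀ {t} (x : Conf t) d {P : ∀ {t'} → Conf t' → Set} → P (iterate (advance x) d) → P (iterate x (suc d))
        iterate-suc x zero y = y
        iterate-suc x (suc d) {P} y = iterate-suc x d {λ z → P (advance z)} y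

        Exact : ∀ {t} → Conf t → Set
        Exact x = Conf.pr x ≡ p

        to-fresh : ∀ l {t} (x : Conf t) → Conf.len x ≡ l → ∃ λ d → Exact (iterate x (suc d))
        to-fresh zero (conf zero k (cons e nil) en lo) refl = 0 , fresh-exact k _ (trans (+-comm 1 _) en)
          where
          fresh-exact : ∀ k t eq → Exact (fresh k t eq)
          fresh-exact k t refl = refl
        to-fresh (suc l) x@(conf _ k (cons e ps) en lo) refl with to-fresh l (advance x) refl
        ... | d , y = suc d , iterate-suc x (suc d) {Exact} y

        Hits : ∀ {t} → Conf t → Set
        Hits x = c (Conf.vertex x) ≡ p

        exact-hits : ∀ l {t} (x : Conf t) → Conf.len x ≡ l → Exact x → ∃ λ d → Hits (iterate x d)
        exact-hits zero (conf zero k (cons {q = r} e nil) en lo) refl ex = 0 , trans (sym (minF-topʳ (c r))) ex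
        exact-hits (suc l) x@(conf _ k (cons {q = r} {p = z} e ps) en lo) refl ex with ≤-total (toℕ (c r)) (toℕ z)
        ... | inj₁ le = 0 , toℕ-injective (trans (sym (m≤n⇒m⊓n≡m le)) (trans (sym (toℕ-minF (c r) z)) (cong toℕ ex)))
        ... | inj₂ ge with exact-hits l (advance x) refl
                (toℕ-injective (trans (sym (m≥n⇒m⊓n≡n ge)) (trans (sym (toℕ-minF (c r) z)) (cong toℕ ex))))
        ...   | d , y = suc d , iterate-suc x d {Hits} y

        confs-iterate : ∀ d m {P : ∀ {t'} → Conf t' → Set} → P (iterate (confs d) m) → P (confs (m + d))
        confs-iterate d zero y = y
        confs-iterate d (suc m) {P} y = confs-iterate d m {λ z → P (advance z)} y

        σ-parity : Parity (even (toℕ p)) (λ d → toℕ (c (σ d)))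
        σ-parity = toℕ p , refl , often , 0 , λ d _ → conf-low (confs d)
          where
          often : Inf (λ d → toℕ (c (σ d)) ≡ toℕ p)
          often d with to-fresh _ (confs d) refl
          ... | m , ex with exact-hits _ (confs (suc m + d)) refl (confs-iterate d (suc m) {Exact} ex)
          ...   | m' , h = m' + (suc m + d) , ≤-trans (m≤n+m d (suc m)) (m≤n+m _ m') , cong toℕ (confs-iterate (suc m + d) m' {Hits} h)

        prepend : ∀ {i l r p''} → Path i l r q p'' → i + l ≡ g 0 → ∃ λ (ρ : ℕ → Fin n) → ρ 0 ≡ r ×
          (∀ d → E (d + i) (ρ d) (ρ (suc d)) ≡ true) × Parity (even (toℕ p)) (λ d → toℕ (c (ρ d)))
        prepend {i} nil en with trans (sym (+-identityʳ i)) en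
        ... | refl = σ , refl , (λ d → advance-edge (confs d)) , σ-parity
        prepend {i} {suc l} {r} (cons e ps) en with prepend ps (trans (sym (+-suc i l)) en)
        ... | ρ , refl , es , par = ρ' , refl , es' , parity-unshift 1 par
          where
          ρ' : ℕ → Fin n
          ρ' zero = r
          ρ' (suc d) = ρ d
          es' : ∀ d → E (d + i) (ρ' d) (ρ' (suc d)) ≡ true
          es' zero = e
          es' (suc d) = subst (λ z → E z (ρ d) (ρ (suc d)) ≡ true) (+-suc d i) (es d)

        trace : Trace E (even (toℕ p))
        trace with prepend (seg→path 0 (g 0) (trans (cong (λ z → mem z q₀ q p') (initial 0)) m₀)) refl
        ... | ρ , refl , es , par = record { τ = ρ ; begins = i₀
              ; edges = λ d → subst (λ z → E z (ρ d) (ρ (suc d)) ≡ true) (+-identityʳ d) (es d) ; parity = par }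

      lasso→trace : ∀ {b} → Lasso b s e → Trace E b
      lasso→trace (q₀ , q , p' , p , i , m₀ , mₑ , refl) = Build.trace i m₀ mₑ

      -- Some vertex `q` recurs at the cuts. Two such cuts are taken beyond the point where
      -- priorities stay at least `x`, with an occurrence of `x` between them; the path between them
      -- has minimum `x`, and its matrix is `e` by idempotence.
      trace→lasso : Classical → ∀ {b} → Trace E b → Lasso b s e
      trace→lasso em T = go (inf-Fin em {n} {λ q k → τ (cut k) ≡ q} (λ k → k , ≤-refl , τ (cut k) , refl)) parity
        where
        open Trace T
        go : (∃ λ q → Inf (λ k → τ (cut k) ≡ q)) → Parity _ (λ t → toℕ (c (τ t))) → Lasso _ s e
        go (q , often) (x , ev , inf , (N , lo)) with often (suc N)
        ... | suc k , s≤s le , at-k with inf (cut (suc k))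
        ...   | m , lem , hit with often (suc m + suc k)
        ...     | k' , lek' , at-k' with follow τ edges 0 (cut (suc k)) | follow τ edges (cut (suc k)) (cut k' ∸ cut (suc k))
        ...       | p₀ , path₀ , _ | p , path , below , above = τ 0 , q , p₀ , p , begins ,
            trans (sym (cong₂ (λ z r → mem z (τ 0) r p₀) (initial k) (trans (cong τ (+-identityʳ _)) at-k))) (path→seg 0 _ path₀) ,
            trans (sym (cong (λ z → mem z q q p) pow)) (path→seg _ _ (subst₂ (λ a b → Path _ _ a b p) at-k
              (trans (cong τ (m∸n+n≡m (<⇒≤ lt))) at-k') path)) ,
            trans (cong even p≡x) ev
            where
            lt : cut (suc k) < cut k'
            lt = ≤-<-trans lem (<-≤-trans (m≤m+n (suc m) (suc k)) (≤-trans lek' (cut-≥ k')))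
            ltk : suc k < k'
            ltk = ≤-trans (s≤s (m≤n+m (suc k) m)) lek'
            pow : val (cut (suc k)) (cut k') ≡ e
            pow = trans (cong (λ z → val (cut (suc k)) (cut z)) (sym (trans (sym (+-suc (k' ∸ suc (suc k)) (suc k))) (m∸n+n≡m ltk)))) (power (suc k) (k' ∸ suc (suc k)))
            x<D : x < suc D
            x<D = subst (_< suc D) hit (toℕ<n (c (τ m)))
            p≡x : toℕ p ≡ x
            p≡x = ≤-antisym (≤-trans (below m lem (<-≤-trans (≤-trans (m≤m+n (suc m) (suc k)) (≤-trans lek' (cut-≥ k')))
                      (≤-reflexive (sym (m∸n+n≡m (<⇒≤ lt)))))) (≤-reflexive hit))
                    (≤-trans (≤-reflexive (sym (toℕ-fromℕ< x<D))) (above (fromℕ< x<D) λ j le' → ≤-trans (≤-reflexive (toℕ-fromℕ< x<D))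
                      (lo j (≤-trans le (≤-trans (n≤1+n k) (≤-trans (cut-≥ (suc k)) le'))))))

-- Injective codes, and games played in rounds.

prefix : ℕ → List Dir → List Dir
prefix zero    u = L ∷ u
prefix (suc i) u = R ∷ prefix i u

∷-inj : ∀ {A : Set} {x y : A} {xs ys} → x ∷ xs ≡ y ∷ ys → x ≡ y × xs ≡ ys
∷-inj refl = refl , refl

prefix-inj : ∀ i j {u v} → prefix i u ≡ prefix j v → i ≡ j × u ≡ v
prefix-inj zero    zero    e = refl , proj₂ (∷-inj e)
prefix-inj zero    (suc j) ()
prefix-inj (suc i) zero    ()
prefix-inj (suc i) (suc j) e = let (a , b) = prefix-inj i j (proj₂ (∷-inj e)) in cong suc a , b

number : List Dir → ℕ
number []      = 0
number (L ∷ u) = suc (number u + number u)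
number (R ∷ u) = suc (suc (number u + number u))

double-inj : ∀ a b → a + a ≡ b + b → a ≡ b
double-inj zero zero e = refl
double-inj (suc a) (suc b) e =
  cong suc (double-inj a b (cong (_∸ 2) (trans (sym (cong suc (+-suc a a))) (trans e (cong suc (+-suc b b))))))

double≢ : ∀ a b → a + a ≢ suc (b + b)
double≢ zero b ()
double≢ (suc a) zero e with trans (sym (+-suc a a)) (cong (_∸ 1) e)
... | ()
double≢ (suc a) (suc b) e = double≢ a b (cong (_∸ 2) (trans (sym (cong suc (+-suc a a))) (trans e (cong (λ z → suc (suc z)) (+-suc b b)))))

number-inj : ∀ u v → number u ≡ number v → u ≡ v
number-inj []      []      e = refl
number-inj []      (L ∷ v) ()
number-inj []      (R ∷ v) ()
number-inj (L ∷ u) []      ()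
number-inj (R ∷ u) []      ()
number-inj (L ∷ u) (L ∷ v) e = cong (L ∷_) (number-inj u v (double-inj _ _ (cong (_∸ 1) e)))
number-inj (R ∷ u) (R ∷ v) e = cong (R ∷_) (number-inj u v (double-inj _ _ (cong (_∸ 2) e)))
number-inj (L ∷ u) (R ∷ v) e = ⊥-elim (double≢ (number u) (number v) (cong (_∸ 1) e))
number-inj (R ∷ u) (L ∷ v) e = ⊥-elim (double≢ (number v) (number u) (sym (cong (_∸ 1) e)))

-- A round is a move of the player wanting even parity and an answer of the other; `move` and
-- `answer` exclude dead ends.
record Rounds : Set₁ where
  field
    A M C   : Set
    legal   : A → M → Set
    next    : A → M → C → A
    pr      : A → ℕ
    codeA   : A → List Dir
    codeA-inj : ∀ {a b} → codeA a ≡ codeA b → a ≡ b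
    codeM   : M → ℕ
    codeM-inj : ∀ {m m'} → codeM m ≡ codeM m' → m ≡ m'
    move    : ∀ a → ∃ (legal a)
    answer  : C

stutter : ∀ {A : Set} → (ℕ → A) → ℕ → A
stutter f zero          = f 0
stutter f (suc zero)    = f 0
stutter f (suc (suc n)) = stutter (f ∘ suc) n

stutter-double : ∀ {A : Set} (f : ℕ → A) k → stutter f (k + k) ≡ f k
stutter-double f zero = refl
stutter-double f (suc k) rewrite +-suc k k = stutter-double (f ∘ suc) k

half : ∀ m → ∃ λ k → m ≤ suc (k + k) × k + k ≤ m × (∀ {A : Set} (f : ℕ → A) → stutter f m ≡ f k)
half zero = 0 , z≤n , z≤n , λ f → refl
half (suc zero) = 0 , s≤s z≤n , z≤n , λ f → refl
half (suc (suc m)) with half m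
... | k , a , b , e = suc k , subst (λ z → suc (suc m) ≤ suc (suc z)) (sym (+-suc k k)) (s≤s (s≤s a))
                    , subst (λ z → suc z ≤ suc (suc m)) (sym (+-suc k k)) (s≤s (s≤s b)) , λ f → e (f ∘ suc)

-- In the arena each round occupies two positions of equal priority, one for each player.
parity-unstutter : ∀ {b} (c : ℕ → ℕ) → Parity b (stutter c) → Parity b c
parity-unstutter c (p , e , inf , k , lo) = p , e , often , k , λ m le →
    subst (p ≤_) (stutter-double c m) (lo (m + m) (≤-trans le (m≤m+n m m)))
  where
  often : Inf (λ m → c m ≡ p)
  often n with inf (suc (suc (n + n)))
  ... | m , le , eq with half m
  ...   | k , a , b , h = k , ≮⇒≥ (λ lt → <-irrefl refl (≤-trans (s≤s (+-mono-≤ (<⇒≤ lt) (<⇒≤ lt))) (≤-pred (≤-trans le a)))) , trans (sym (h c)) eq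

record Solution (G : Rounds) : Set where
  open Rounds G
  field
    W       : A → Bool
    σ       : A → M
    τ       : A → M → C
    σ-legal : ∀ a → W a ≡ true → legal a (σ a)
    σ-stay  : ∀ a c → W a ≡ true → W (next a (σ a) c) ≡ true
    σ-wins  : ∀ (as : ℕ → A) (cs : ℕ → C) → W (as 0) ≡ true →
              (∀ n → as (suc n) ≡ next (as n) (σ (as n)) (cs n)) → Parity true (pr ∘ as)
    τ-stay  : ∀ a m → W a ≡ false → legal a m → W (next a m (τ a m)) ≡ false
    τ-wins  : ∀ (as : ℕ → A) (ms : ℕ → M) → W (as 0) ≡ false → (∀ n → legal (as n) (ms n)) →
              (∀ n → as (suc n) ≡ next (as n) (ms n) (τ (as n) (ms n))) → Parity false (pr ∘ as)

module SolveRounds (em : Classical) (G : Rounds) (d : ℕ) (bound : ∀ a → Rounds.pr G a < d) where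
  open Rounds G

  Pos : Set
  Pos = A ⊎ (A × M)

  codePos : Pos → List Dir
  codePos (inj₁ a) = L ∷ codeA a
  codePos (inj₂ (a , m)) = R ∷ prefix (codeM m) (codeA a)

  codePos-inj : ∀ {v w} → codePos v ≡ codePos w → v ≡ w
  codePos-inj {inj₁ a} {inj₁ b} e = cong inj₁ (codeA-inj (proj₂ (∷-inj e)))
  codePos-inj {inj₁ a} {inj₂ b} ()
  codePos-inj {inj₂ a} {inj₁ b} ()
  codePos-inj {inj₂ (a , m)} {inj₂ (b , m')} e with prefix-inj (codeM m) (codeM m') (proj₂ (∷-inj e))
  ... | e₁ , e₂ = cong inj₂ (cong₂ _,_ (codeA-inj e₂) (codeM-inj e₁))

  Edge : Pos → Pos → Set
  Edge (inj₁ a) (inj₁ b) = ⊥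
  Edge (inj₁ a) (inj₂ (b , m)) = b ≡ a × legal a m
  Edge (inj₂ (a , m)) (inj₁ b) = ∃ λ c → b ≡ next a m c
  Edge (inj₂ _) (inj₂ _) = ⊥

  arena : Arena
  arena = record { V = Pos ; code = number ∘ codePos ; code-inj = λ e → codePos-inj (number-inj _ _ e)
                 ; own = λ { (inj₁ _) → true ; (inj₂ _) → false } ; E = Edge
                 ; pr = λ { (inj₁ a) → pr a ; (inj₂ (a , _)) → pr a } }

  open Games em arena

  total : ∀ v → ∃ (Edge v)
  total (inj₁ a) = let (m , l) = move a in inj₂ (a , m) , refl , l
  total (inj₂ (a , m)) = inj₁ (next a m answer) , answer , refl

  abstract
    solved : Σ (Max true everything ∅ (Objective true)) λ M₁ → Σ (Max false everything ∅ (Objective false)) λ M₀ →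
             ∀ v → Max.X M₁ ∋ v ⊎ Max.X M₀ ∋ v
    solved = determined d (λ { (inj₁ a) → bound a ; (inj₂ (a , _)) → bound a }) total

  module M₁ = Max (proj₁ solved)
  module M₀ = Max (proj₁ (proj₂ solved))
  module W₁ = Win M₁.win
  module W₀ = Win M₀.win

  either : ∀ v → M₁.X ∋ v ⊎ M₀.X ∋ v
  either = proj₂ (proj₂ solved)

  moveOf : ∀ a w → Edge (inj₁ a) w → ∃ λ m → legal a m × w ≡ inj₂ (a , m)
  moveOf a (inj₂ (.a , m)) (refl , l) = m , l , refl

  answerOf : ∀ a m w → Edge (inj₂ (a , m)) w → ∃ λ c → w ≡ inj₁ (next a m c)
  answerOf a m (inj₁ b) (c , refl) = c , refl

  chosen : ∀ a → ∃ λ m → M₁.X ∋ inj₁ a → legal a m × M₁.σ (inj₁ a) ≡ inj₂ (a , m)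
  chosen a with M₁.X (inj₁ a) in eq
  ... | true = let (m , l , e) = moveOf a _ (proj₁ (W₁.mine (inj₁ a) eq (λ ()) refl)) in m , λ _ → l , e
  ... | false = proj₁ (move a) , λ ()

  replied : ∀ a m → ∃ λ c → M₀.X ∋ inj₂ (a , m) → M₀.σ (inj₂ (a , m)) ≡ inj₁ (next a m c)
  replied a m with M₀.X (inj₂ (a , m)) in eq
  ... | true = let (c , e) = answerOf a m _ (proj₁ (W₀.mine (inj₂ (a , m)) eq (λ ()) refl)) in c , λ _ → e
  ... | false = answer , λ ()

  lost : ∀ a → M₁.X (inj₁ a) ≡ false → M₀.X ∋ inj₁ a
  lost a f with either (inj₁ a)
  ... | inj₁ t = ⊥-elim (true≢false (trans (sym t) f))
  ... | inj₂ x = x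

  -- Playing both strategies against each other gives one play won by both players.
  disjoint : ∀ a → M₀.X ∋ inj₁ a → M₁.X (inj₁ a) ≡ false

  interleave : (ℕ → A) → (ℕ → M) → ℕ → Pos
  interleave as ms zero          = inj₁ (as 0)
  interleave as ms (suc zero)    = inj₂ (as 0 , ms 0)
  interleave as ms (suc (suc n)) = interleave (as ∘ suc) (ms ∘ suc) n

  interleave-pr : ∀ as ms n → Arena.pr arena (interleave as ms n) ≡ stutter (pr ∘ as) n
  interleave-pr as ms zero = refl
  interleave-pr as ms (suc zero) = refl
  interleave-pr as ms (suc (suc n)) = interleave-pr (as ∘ suc) (ms ∘ suc) n

  play₁ : ∀ (as : ℕ → A) (ms : ℕ → M) (cs : ℕ → C) → M₁.X ∋ inj₁ (as 0) →
    (∀ n → M₁.X ∋ inj₁ (as n) → M₁.σ (inj₁ (as n)) ≡ inj₂ (as n , ms n)) →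
    (∀ n → as (suc n) ≡ next (as n) (ms n) (cs n)) →
    ∀ n → M₁.X ∋ interleave as ms n × ¬ ∅ ∋ interleave as ms n ×
          Move true everything M₁.σ (interleave as ms n) (interleave as ms (suc n))
  play₁ as ms cs x h nx zero = x , (λ ()) , subst (Edge (inj₁ (as 0))) (h 0 x) (proj₁ (W₁.mine _ x (λ ()) refl)) , refl , λ _ → sym (h 0 x)
  play₁ as ms cs x h nx (suc zero) = subst (M₁.X ∋_) (h 0 x) (proj₂ (W₁.mine _ x (λ ()) refl)) , (λ ()) , (cs 0 , nx 0) , refl , λ ()
  play₁ as ms cs x h nx (suc (suc n)) = play₁ (as ∘ suc) (ms ∘ suc) (cs ∘ suc)
    (W₁.opp (inj₂ (as 0 , ms 0)) (subst (M₁.X ∋_) (h 0 x) (proj₂ (W₁.mine _ x (λ ()) refl))) (λ ()) refl _ (cs 0 , nx 0) refl)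
    (h ∘ suc) (nx ∘ suc) n

  play₀ : ∀ (as : ℕ → A) (ms : ℕ → M) (cs : ℕ → C) → M₀.X ∋ inj₁ (as 0) → (∀ n → legal (as n) (ms n)) →
    (∀ n → M₀.X ∋ inj₂ (as n , ms n) → M₀.σ (inj₂ (as n , ms n)) ≡ inj₁ (as (suc n))) →
    (∀ n → as (suc n) ≡ next (as n) (ms n) (cs n)) →
    ∀ n → M₀.X ∋ interleave as ms n × ¬ ∅ ∋ interleave as ms n ×
          Move false everything M₀.σ (interleave as ms n) (interleave as ms (suc n))
  play₀ as ms cs x l h nx zero = x , (λ ()) , (refl , l 0) , refl , λ ()
  play₀ as ms cs x l h nx (suc zero) = y , (λ ()) , (cs 0 , nx 0) , refl , λ _ → sym (h 0 y)
    where
    y = W₀.opp _ x (λ ()) refl _ (refl , l 0) refl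
  play₀ as ms cs x l h nx (suc (suc n)) = play₀ (as ∘ suc) (ms ∘ suc) (cs ∘ suc)
    (subst (M₀.X ∋_) (h 0 y) (proj₂ (W₀.mine _ y (λ ()) refl))) (l ∘ suc) (h ∘ suc) (nx ∘ suc) n
    where
    y = W₀.opp _ x (λ ()) refl _ (refl , l 0) refl

  iter : (A → A) → A → ℕ → A
  iter f a zero    = a
  iter f a (suc n) = f (iter f a n)

  wins₁ : ∀ (as : ℕ → A) (cs : ℕ → C) → M₁.X ∋ inj₁ (as 0) →
    (∀ n → as (suc n) ≡ next (as n) (proj₁ (chosen (as n))) (cs n)) → Parity true (pr ∘ as)
  wins₁ as cs x nx = parity-unstutter (pr ∘ as) (parity-cong (interleave-pr as ms)
      (W₁.play (interleave as ms) (play₁ as ms cs x (λ n xn → proj₂ (proj₂ (chosen (as n)) xn)) nx)))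
    where
    ms = λ n → proj₁ (chosen (as n))

  wins₀ : ∀ (as : ℕ → A) (ms : ℕ → M) → M₀.X ∋ inj₁ (as 0) → (∀ n → legal (as n) (ms n)) →
    (∀ n → as (suc n) ≡ next (as n) (ms n) (proj₁ (replied (as n) (ms n)))) → Parity false (pr ∘ as)
  wins₀ as ms x l nx = parity-unstutter (pr ∘ as) (parity-cong (interleave-pr as ms)
      (W₀.play (interleave as ms) (play₀ as ms (λ n → proj₁ (replied (as n) (ms n))) x l
        (λ n xn → trans (proj₂ (replied (as n) (ms n)) xn) (cong inj₁ (sym (nx n)))) nx)))

  stay₁ : ∀ a c → M₁.X ∋ inj₁ a → M₁.X ∋ inj₁ (next a (proj₁ (chosen a)) c)
  stay₁ a c x = W₁.opp _ (subst (M₁.X ∋_) (proj₂ (proj₂ (chosen a) x)) (proj₂ (W₁.mine _ x (λ ()) refl))) (λ ()) refl _ (c , refl) refl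

  stay₀ : ∀ a m → legal a m → M₀.X ∋ inj₁ a → M₀.X ∋ inj₁ (next a m (proj₁ (replied a m)))
  stay₀ a m l x = subst (M₀.X ∋_) (proj₂ (replied a m) y) (proj₂ (W₀.mine _ y (λ ()) refl))
    where
    y : M₀.X ∋ inj₂ (a , m)
    y = W₀.opp _ x (λ ()) refl _ (refl , l) refl

  disjoint a x₀ with M₁.X (inj₁ a) in eq
  ... | false = refl
  ... | true = ⊥-elim (true≢false (parity-unique
          (wins₁ as _ eq λ n → refl)
          (wins₀ as (λ n → proj₁ (chosen (as n))) x₀ (λ n → proj₁ (proj₂ (chosen (as n)) (in₁ n))) λ n → refl)))
    where
    as : ℕ → A
    as = iter (λ a → next a (proj₁ (chosen a)) (proj₁ (replied a (proj₁ (chosen a))))) a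
    in₁ : ∀ n → M₁.X ∋ inj₁ (as n)
    in₁ zero = eq
    in₁ (suc n) = stay₁ (as n) _ (in₁ n)

  solution : Solution G
  solution = record
    { W = λ a → M₁.X (inj₁ a) ; σ = λ a → proj₁ (chosen a) ; τ = λ a m → proj₁ (replied a m)
    ; σ-legal = λ a x → proj₁ (proj₂ (chosen a) x) ; σ-stay = stay₁ ; σ-wins = wins₁
    ; τ-stay = λ a m f l → disjoint _ (stay₀ a m l (lost a f))
    ; τ-wins = λ as ms f → wins₀ as ms (lost (as 0) f) }

-- Tree automata and Rabin's theorem

-- Absence of a trace is obtained by negating the lasso test before determinising. Determinism
-- allows the check to run along all branches of a tree at once.
module NoTrace {n D : ℕ} (c : Fin n → Fin (suc D)) (init : Fin n → Bool) (b : Bool) where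
  open Traces c init

  accept : Matrix → Matrix → Bool
  accept s e = not (does (lasso? b s e))

  module Det = Determinise monoid accept

  stepDet : Det.State → Graph → Det.State
  stepDet x E = Det.step x (step E)

  module _ (em : Classical) (E : ℕ → Graph) (xs : ℕ → Det.State) (x₀ : xs 0 ≡ Det.start)
           (xₛ : ∀ n → xs (suc n) ≡ stepDet (xs n) (E n)) where

    private
      is-run : ∀ n → Det.run (λ n → step (E n)) n ≡ xs n
      is-run zero = sym x₀
      is-run (suc n) = trans (cong (λ x → stepDet x (E n)) (is-run n)) (sym (xₛ n))

      spec : ∀ {s e} → Segments.Factors monoid (λ n → step (E n)) s e →
        (accept s e ≡ true → ¬ Trace E b) × (accept s e ≡ false → ¬ ¬ Trace E b)
      spec {s} {e} F = (λ a T → not-true a (→dec (lasso? b s e) (Word.trace→lasso E F em T))) ,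
                       (λ a nT → nT (Word.lasso→trace E F (dec→ (lasso? b s e) (not-false a))))

      correct = Det.Correct.Limit.parity-correct (λ n → step (E n)) em (¬ Trace E b) spec

    no-trace→even : ¬ Trace E b → Parity true (Det.prio ∘ xs)
    no-trace→even nT = parity-cong (λ n → cong Det.prio (is-run n)) (proj₁ correct nT)

    trace→odd : Trace E b → Parity false (Det.prio ∘ xs)
    trace→odd T = parity-cong (λ n → cong Det.prio (is-run n)) (proj₂ correct (λ nT → nT T))

-- Addresses of nodes are stored in reverse: d ∷ u is the d-child of u.
Tree : Set → Set
Tree A = List Dir → A

branch : (ℕ → Dir) → ℕ → List Dir
branch π zero    = []
branch π (suc n) = π n ∷ branch π n

-- Nondeterminism is expressed by labels guessed at the nodes.
record Automaton (A : Set) : Set₁ where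
  field
    {X Λ} : Set
    finX  : Finite X
    finΛ  : Finite Λ
    λ₀    : Λ
    x₀    : X
    step  : X → A → Λ → Dir → X
    {D}   : ℕ
    prio  : X → Fin (suc D)

  run : Tree A → Tree Λ → Tree X
  run t ℓ []      = x₀
  run t ℓ (d ∷ u) = step (run t ℓ u) (t u) (ℓ u) d

  Accepting : Tree A → Tree Λ → Set
  Accepting t ℓ = ∀ π → Parity true (λ n → toℕ (prio (run t ℓ (branch π n))))

  Accepts : Tree A → Set
  Accepts t = ∃ (Accepting t)

  run-cong : ∀ {t t'} {ℓ ℓ'} → (∀ u → t u ≡ t' u) → (∀ u → ℓ u ≡ ℓ' u) → ∀ u → run t ℓ u ≡ run t' ℓ' u
  run-cong te le [] = refl
  run-cong te le (d ∷ u) rewrite run-cong te le u | te u | le u = refl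

  accepting-cong : ∀ {t t'} {ℓ ℓ'} → (∀ u → t u ≡ t' u) → (∀ u → ℓ u ≡ ℓ' u) → Accepting t ℓ → Accepting t' ℓ'
  accepting-cong te le a π = parity-cong (λ n → cong (toℕ ∘ prio) (run-cong te le (branch π n))) (a π)

  accepts-cong : ∀ {t t'} → (∀ u → t u ≡ t' u) → Accepts t → Accepts t'
  accepts-cong te (ℓ , a) = ℓ , accepting-cong te (λ _ → refl) a

-- The complement guesses a positional strategy of the player who chooses the directions.
module Complement {A : Set} (𝒜 : Automaton A) where
  open Automaton 𝒜

  n : ℕ
  n = size finX

  FXΛ : Finite (X × Λ)
  FXΛ = fin× finX finΛ

  c : Fin n → Fin (suc D)
  c i = prio (from finX i)

  init : Fin n → Bool
  init i = does (i ≟F to finX x₀)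

  open Traces c init using (Graph; Trace)
  module NT = NoTrace c init true
  module Det = NT.Det

  -- A trace of these edges along a branch is a play consistent with the guessed strategy that
  -- follows this branch.
  Follows : A → Table FXΛ Dir → Dir → Fin n → Fin n → Λ → Set
  Follows a s d i j ℓ = app FXΛ s (from finX i , ℓ) ≡ d × j ≡ to finX (step (from finX i) a ℓ d)

  follows? : ∀ a s d i j ℓ → Dec (Follows a s d i j ℓ)
  follows? a s d i j ℓ = Finite._≟_ finDir _ d ×-dec (j ≟F _)

  graph : A → Table FXΛ Dir → Dir → Graph
  graph a s d i j = does (anyF finΛ (follows? a s d i j))

  automaton : Automaton A
  automaton = record { finX = Det.finState ; finΛ = finTable FXΛ finDir ; λ₀ = lam FXΛ (λ _ → L) ; x₀ = Det.start
                     ; step = λ x a s d → NT.stepDet x (graph a s d) ; prio = proj₂ }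

  module Co = Automaton automaton

  module _ (em : Classical) (t : Tree A) where

    -- The guessed strategy played against an accepting labelling produces a branch whose run is a
    -- forbidden trace.
    disjoint : Co.Accepts t → ¬ Accepts t
    disjoint (s , co) (ℓ , good) = true≢false (parity-unique (co π)
        (NT.trace→odd em E (λ n → Co.run t s (branch π n)) refl (λ n → refl) trace))
      where
      node : ℕ → List Dir
      dir : ℕ → Dir
      dir n = app FXΛ (s (node n)) (run t ℓ (node n) , ℓ (node n))
      node zero = []
      node (suc n) = dir n ∷ node n
      π : ℕ → Dir
      π = dir
      node-branch : ∀ n → node n ≡ branch π n
      node-branch zero = refl
      node-branch (suc n) = cong (dir n ∷_) (node-branch n)
      E : ℕ → Graph
      E n = graph (t (branch π n)) (s (branch π n)) (π n)
      trace : Trace E true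
      trace = record { τ = λ n → to finX (run t ℓ (branch π n)) ; begins = →dec (to finX x₀ ≟F to finX x₀) refl
        ; edges = λ n → →dec (anyF finΛ (follows? (t (branch π n)) (s (branch π n)) (π n) _ _)) (ℓ (branch π n) , follows n (branch π n) (node-branch n))
        ; parity = parity-cong (λ n → cong (toℕ ∘ prio) (sym (from-to finX _))) (good π) }
        where
        follows : ∀ n u → node n ≡ u → Follows (t u) (s u) (π n) (to finX (run t ℓ u))
                    (to finX (step (run t ℓ u) (t u) (ℓ u) (π n))) (ℓ u)
        follows n u refl = cong (λ x → app FXΛ (s u) (x , ℓ u)) (from-to finX _) ,
                           cong (λ x → to finX (step x (t u) (ℓ u) (π n))) (sym (from-to finX _))

    rounds : Rounds
    rounds = record { A = List Dir × X ; M = Λ ; C = Dir ; legal = λ _ _ → ⊤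
      ; next = λ (u , x) ℓ d → d ∷ u , step x (t u) ℓ d ; pr = λ (_ , x) → toℕ (prio x)
      ; codeA = λ (u , x) → prefix (toℕ (to finX x)) u
      ; codeA-inj = λ {(u , x)} {(v , y)} e → let (a , b) = prefix-inj _ _ e in
          cong₂ _,_ b (to-inj finX (toℕ-injective a))
      ; codeM = toℕ ∘ to finΛ ; codeM-inj = λ e → to-inj finΛ (toℕ-injective e) ; move = λ _ → λ₀ , tt ; answer = L }

    open Solution (SolveRounds.solution em rounds (suc D) (λ (_ , x) → toℕ<n (prio x)))

    pos : Tree (List Dir × X)
    pos []      = [] , x₀
    pos (d ∷ u) = Rounds.next rounds (pos u) (σ (pos u)) d

    pos-node : ∀ u → proj₁ (pos u) ≡ u
    pos-node [] = refl
    pos-node (d ∷ u) = cong (d ∷_) (pos-node u)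

    pos-run : ∀ u → proj₂ (pos u) ≡ run t (σ ∘ pos) u
    pos-run [] = refl
    pos-run (d ∷ u) = cong₂ (λ v x → step x (t v) (σ (pos u)) d) (pos-node u) (pos-run u)

    won→accepts : W ([] , x₀) ≡ true → Accepts t
    won→accepts w = σ ∘ pos , λ π → parity-cong (λ n → cong (toℕ ∘ prio) (pos-run (branch π n)))
      (σ-wins (λ n → pos (branch π n)) π w λ n → refl)

    -- A positional strategy may depend on the node, but at each node it is a finite table, which is
    -- exactly a label of the complement.
    lost→co : W ([] , x₀) ≡ false → Co.Accepts t
    lost→co w = s , λ π → NT.no-trace→even em _ (λ n → Co.run t s (branch π n)) refl (λ n → refl) (none π)
      where
      s : Tree (Table FXΛ Dir)
      s u = lam FXΛ (λ (x , ℓ) → τ (u , x) ℓ)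
      none : ∀ π → ¬ Trace (λ n → graph (t (branch π n)) (s (branch π n)) (π n)) true
      none π T = true≢false (parity-unique parity (τ-wins as ms
          (trans (cong (λ i → W ([] , i)) (trans (cong (from finX) (dec→ (ρ 0 ≟F to finX x₀) begins)) (from-to finX x₀))) w)
          (λ _ → tt) next≡))
        where
        open Trace T renaming (τ to ρ)
        as : ℕ → List Dir × X
        as n = branch π n , from finX (ρ n)
        step' : ∀ n → ∃ (Follows (t (branch π n)) (s (branch π n)) (π n) (ρ n) (ρ (suc n)))
        step' n = dec→ (anyF finΛ (follows? (t (branch π n)) (s (branch π n)) (π n) (ρ n) (ρ (suc n)))) (edges n)
        ms : ℕ → Λ
        ms n = proj₁ (step' n)
        next≡ : ∀ n → as (suc n) ≡ Rounds.next rounds (as n) (ms n) (τ (as n) (ms n))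
        next≡ n with step' n
        ... | ℓ , e , e' = cong₂ (λ d x → d ∷ branch π n , x) (sym d≡)
              (trans (cong (from finX) e') (trans (from-to finX _) (cong (step (from finX (ρ n)) (t (branch π n)) ℓ) (sym d≡))))
          where
          d≡ : τ (as n) ℓ ≡ π n
          d≡ = trans (sym (app-lam FXΛ (λ (x , ℓ) → τ (branch π n , x) ℓ) _)) e

    exhaustive : ¬ Accepts t → Co.Accepts t
    exhaustive na with W ([] , x₀) in eq
    ... | true = ⊥-elim (na (won→accepts eq))
    ... | false = lost→co eq

∧-split : ∀ {a b} → a ∧ b ≡ true → a ≡ true × b ≡ true
∧-split {true} {true} e = refl , refl

modus : ∀ {a b} → not a ∨ b ≡ true → a ≡ true → b ≡ true
modus e refl = e

infix 3 _⇔_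
_⇔_ : Set → Set → Set
P ⇔ Q = (P → Q) × (Q → P)

record Recognises {A : Set} (𝒜 : Automaton A) (P : Tree A → Set) : Set₁ where
  constructor recognises
  field correct : Classical → ∀ t → P t ⇔ Automaton.Accepts 𝒜 t

Recognisable : {A : Set} → (Tree A → Set) → Set₁
Recognisable {A} P = Σ (Automaton A) λ 𝒜 → Recognises 𝒜 P

rec-map : ∀ {A} {P Q : Tree A → Set} → (Classical → ∀ t → Q t ⇔ P t) → Recognisable P → Recognisable Q
rec-map f (𝒜 , recognises r) = 𝒜 , recognises λ em t → proj₁ (r em t) ∘ proj₁ (f em t) , proj₂ (f em t) ∘ proj₂ (r em t)

rec-¬ : ∀ {A} {P : Tree A → Set} → Recognisable P → Recognisable (λ t → ¬ P t)
rec-¬ (𝒜 , recognises r) = Complement.automaton 𝒜 , recognises λ em t →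
  (λ np → Complement.exhaustive 𝒜 em t (np ∘ proj₂ (r em t))) , (λ co p → Complement.disjoint 𝒜 em t co (proj₁ (r em t) p))

embed : ∀ {a b} → a ≤ b → Fin (suc a) → Fin (suc b)
embed le i = fromℕ< {toℕ i} (s≤s (≤-trans (≤-pred (toℕ<n i)) le))

toℕ-embed : ∀ {a b} (le : a ≤ b) i → toℕ (embed le i) ≡ toℕ i
toℕ-embed le i = toℕ-fromℕ< _

module Union {A : Set} (𝒜 ℬ : Automaton A) where
  module 𝒜 = Automaton 𝒜
  module ℬ = Automaton ℬ

  Label : Set
  Label = Bool × 𝒜.Λ × ℬ.Λ

  step : Maybe (𝒜.X ⊎ ℬ.X) → A → Label → Dir → Maybe (𝒜.X ⊎ ℬ.X)
  step nothing         a (true  , l , m) d = just (inj₁ (𝒜.step 𝒜.x₀ a l d))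
  step nothing         a (false , l , m) d = just (inj₂ (ℬ.step ℬ.x₀ a m d))
  step (just (inj₁ x)) a (_ , l , m) d = just (inj₁ (𝒜.step x a l d))
  step (just (inj₂ y)) a (_ , l , m) d = just (inj₂ (ℬ.step y a m d))

  automaton : Automaton A
  automaton = record
    { finX = finMaybe (fin⊎ 𝒜.finX ℬ.finX) ; finΛ = fin× finBool (fin× 𝒜.finΛ ℬ.finΛ) ; λ₀ = true , 𝒜.λ₀ , ℬ.λ₀
    ; x₀ = nothing ; step = step ; D = 𝒜.D + ℬ.D
    ; prio = λ { nothing → zero ; (just (inj₁ x)) → embed (m≤m+n 𝒜.D ℬ.D) (𝒜.prio x)
               ; (just (inj₂ y)) → embed (m≤n+m ℬ.D 𝒜.D) (ℬ.prio y) } }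

  module U = Automaton automaton

  runˡ : ∀ t ℓ → proj₁ (ℓ []) ≡ true → ∀ d u → U.run t ℓ (d ∷ u) ≡ just (inj₁ (𝒜.run t (proj₁ ∘ proj₂ ∘ ℓ) (d ∷ u)))
  runˡ t ℓ e d [] with ℓ []
  runˡ t ℓ refl d [] | true , _ = refl
  runˡ t ℓ e d (d' ∷ u) rewrite runˡ t ℓ e d' u = refl

  runʳ : ∀ t ℓ → proj₁ (ℓ []) ≡ false → ∀ d u → U.run t ℓ (d ∷ u) ≡ just (inj₂ (ℬ.run t (proj₂ ∘ proj₂ ∘ ℓ) (d ∷ u)))
  runʳ t ℓ e d [] with ℓ []
  runʳ t ℓ refl d [] | false , _ = refl
  runʳ t ℓ e d (d' ∷ u) rewrite runʳ t ℓ e d' u = refl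

  prioˡ : ∀ t ℓ → proj₁ (ℓ []) ≡ true → ∀ d u →
    toℕ (U.prio (U.run t ℓ (d ∷ u))) ≡ toℕ (𝒜.prio (𝒜.run t (proj₁ ∘ proj₂ ∘ ℓ) (d ∷ u)))
  prioˡ t ℓ e d u = trans (cong (toℕ ∘ U.prio) (runˡ t ℓ e d u)) (toℕ-embed (m≤m+n 𝒜.D ℬ.D) _)

  prioʳ : ∀ t ℓ → proj₁ (ℓ []) ≡ false → ∀ d u →
    toℕ (U.prio (U.run t ℓ (d ∷ u))) ≡ toℕ (ℬ.prio (ℬ.run t (proj₂ ∘ proj₂ ∘ ℓ) (d ∷ u)))
  prioʳ t ℓ e d u = trans (cong (toℕ ∘ U.prio) (runʳ t ℓ e d u)) (toℕ-embed (m≤n+m ℬ.D 𝒜.D) _)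

  correct : ∀ t → (𝒜.Accepts t ⊎ ℬ.Accepts t) ⇔ U.Accepts t
  correct t = to' , from'
    where
    to' : 𝒜.Accepts t ⊎ ℬ.Accepts t → U.Accepts t
    to' (inj₁ (ℓ , a)) = (λ u → true , ℓ u , ℬ.λ₀) , λ π → parity-unshift 1
      (parity-cong (λ n → sym (prioˡ t (λ u → true , ℓ u , ℬ.λ₀) refl (π n) (branch π n))) (parity-shift 1 (a π)))
    to' (inj₂ (ℓ , a)) = (λ u → false , 𝒜.λ₀ , ℓ u) , λ π → parity-unshift 1
      (parity-cong (λ n → sym (prioʳ t (λ u → false , 𝒜.λ₀ , ℓ u) refl (π n) (branch π n))) (parity-shift 1 (a π)))
    from' : U.Accepts t → 𝒜.Accepts t ⊎ ℬ.Accepts t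
    from' (ℓ , a) = by (proj₁ (ℓ [])) refl
      where
      by : ∀ b → proj₁ (ℓ []) ≡ b → 𝒜.Accepts t ⊎ ℬ.Accepts t
      by true e = inj₁ (proj₁ ∘ proj₂ ∘ ℓ , λ π → parity-unshift 1
        (parity-cong (λ n → prioˡ t ℓ e (π n) (branch π n)) (parity-shift 1 (a π))))
      by false e = inj₂ (proj₂ ∘ proj₂ ∘ ℓ , λ π → parity-unshift 1
        (parity-cong (λ n → prioʳ t ℓ e (π n) (branch π n)) (parity-shift 1 (a π))))

rec-∨ : ∀ {A} {P Q : Tree A → Set} → Recognisable P → Recognisable Q → Recognisable (λ t → P t ⊎ Q t)
rec-∨ (𝒜 , recognises r) (ℬ , recognises s) = Union.automaton 𝒜 ℬ , recognises λ em t →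
  (λ { (inj₁ p) → proj₁ (Union.correct 𝒜 ℬ t) (inj₁ (proj₁ (r em t) p))
     ; (inj₂ q) → proj₁ (Union.correct 𝒜 ℬ t) (inj₂ (proj₁ (s em t) q)) }) ,
  λ a → case proj₂ (Union.correct 𝒜 ℬ t) a of λ where
     (inj₁ x) → inj₁ (proj₂ (r em t) x)
     (inj₂ y) → inj₂ (proj₂ (s em t) y)

rec-∧ : ∀ {A} {P Q : Tree A → Set} → Recognisable P → Recognisable Q → Recognisable (λ t → P t × Q t)
rec-∧ r s = rec-map (λ em t → (λ { (p , q) (inj₁ np) → np p ; (p , q) (inj₂ nq) → nq q }) ,
    λ n → dne em (n ∘ inj₁) , dne em (n ∘ inj₂)) (rec-¬ (rec-∨ (rec-¬ r) (rec-¬ s)))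

rec-pull : ∀ {A B} (f : A → B) {P : Tree B → Set} → Recognisable P → Recognisable (λ t → P (f ∘ t))
rec-pull {A} f (𝒜 , recognises r) = pulled , recognises λ em t →
    (λ p → let (ℓ , a) = proj₁ (r em (f ∘ t)) p in
           ℓ , λ π → parity-cong (λ n → cong (toℕ ∘ prio) (sym (same t ℓ (branch π n)))) (a π)) ,
    λ (ℓ , a) → proj₂ (r em (f ∘ t)) (ℓ , λ π → parity-cong (λ n → cong (toℕ ∘ prio) (same t ℓ (branch π n))) (a π))
  where
  open Automaton 𝒜
  pulled : Automaton A
  pulled = record { finX = finX ; finΛ = finΛ ; λ₀ = λ₀ ; x₀ = x₀ ; step = λ x a → step x (f a) ; prio = prio }
  same : ∀ t ℓ u → Automaton.run pulled t ℓ u ≡ run (f ∘ t) ℓ u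
  same t ℓ [] = refl
  same t ℓ (d ∷ u) = cong (λ x → step x (f (t u)) (ℓ u) d) (same t ℓ u)

module Project {A : Set} (𝒜 : Automaton (Bool × A)) where
  open Automaton 𝒜

  projected : Automaton A
  projected = record { finX = finX ; finΛ = fin× finBool finΛ ; λ₀ = true , λ₀ ; x₀ = x₀
                     ; step = λ x a (b , l) → step x (b , a) l ; prio = prio }

  module Pr = Automaton projected

  same : ∀ t ℓ u → Pr.run t ℓ u ≡ run (λ u → proj₁ (ℓ u) , t u) (proj₂ ∘ ℓ) u
  same t ℓ [] = refl
  same t ℓ (d ∷ u) = cong (λ x → step x (proj₁ (ℓ u) , t u) (proj₂ (ℓ u)) d) (same t ℓ u)

  accepting⇒ : ∀ {t ℓ} → Pr.Accepting t ℓ → Accepting (λ u → proj₁ (ℓ u) , t u) (proj₂ ∘ ℓ)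
  accepting⇒ {t} {ℓ} a π = parity-cong (λ n → cong (toℕ ∘ prio) (same t ℓ (branch π n))) (a π)

  accepting⇐ : ∀ {t ℓ} → Accepting (λ u → proj₁ (ℓ u) , t u) (proj₂ ∘ ℓ) → Pr.Accepting t ℓ
  accepting⇐ {t} {ℓ} a π = parity-cong (λ n → cong (toℕ ∘ prio) (sym (same t ℓ (branch π n)))) (a π)

rec-∃ : ∀ {A} {P : Tree (Bool × A) → Set} → Recognisable P → Recognisable (λ t → ∃ λ (Z : Tree Bool) → P (λ u → Z u , t u))
rec-∃ (𝒜 , recognises r) = Project.projected 𝒜 , recognises λ em t →
  (λ (Z , p) → let (ℓ , a) = proj₁ (r em _) p in (λ u → Z u , ℓ u) , Project.accepting⇐ 𝒜 a) ,
  λ (ℓ , a) → proj₁ ∘ ℓ , proj₂ (r em _) (proj₂ ∘ ℓ , Project.accepting⇒ 𝒜 a)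

branch-cong : ∀ {π π'} n → (∀ k → k < n → π k ≡ π' k) → branch π n ≡ branch π' n
branch-cong zero    e = refl
branch-cong (suc n) e = cong₂ _∷_ (e n ≤-refl) (branch-cong n λ k lt → e k (m<n⇒m<1+n lt))

-- Some branch through `u`; below `u` it always turns `L`.
via : List Dir → ℕ → Dir
via []      n = L
via (d ∷ u) n = if does (n ≟ℕ length u) then d else via u n

branch-via : ∀ u → branch (via u) (length u) ≡ u
branch-via [] = refl
branch-via (d ∷ u) = cong₂ _∷_ (cong (if_then d else via u (length u)) (dec-true (length u ≟ℕ length u) refl))
  (trans (branch-cong (length u) λ k lt → cong (if_then d else via u k) (dec-false (k ≟ℕ length u) (<⇒≢ lt))) (branch-via u))

module Safety {A : Set} (test : Bool → A → Bool) (pass : A → Dir → Bool) where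
  bit : Tree A → List Dir → Bool
  bit t []      = false
  bit t (d ∷ u) = pass (t u) d

  Safe : Tree A → Set
  Safe t = ∀ u → test (bit t u) (t u) ≡ true

  step : Maybe Bool → A → ⊤ → Dir → Maybe Bool
  step nothing  a _ d = nothing
  step (just b) a _ d = if test b a then just (pass a d) else nothing

  automaton : Automaton A
  automaton = record { finX = finMaybe finBool ; finΛ = fin⊤ ; λ₀ = tt ; x₀ = just false ; step = step
                     ; D = 1 ; prio = λ { nothing → suc zero ; (just _) → zero } }

  open Automaton automaton using (run; Accepts; prio)

  run-safe : ∀ {t} → Safe t → ∀ ℓ u → run t ℓ u ≡ just (bit t u)
  run-safe s ℓ [] = refl
  run-safe {t} s ℓ (d ∷ u) rewrite run-safe {t} s ℓ u | s u = refl

  alive : ∀ {t ℓ} u → run t ℓ u ≢ nothing → run t ℓ u ≡ just (bit t u)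
  alive [] n = refl
  alive {t} {ℓ} (d ∷ u) n with run t ℓ u in eq
  ... | nothing = ⊥-elim (n refl)
  ... | just b with trans (sym eq) (alive {t} {ℓ} u (λ e → case trans (sym eq) e of λ ()))
  ...   | refl with test (bit t u) (t u)
  ...     | true = refl
  ...     | false = ⊥-elim (n refl)

  dead-stays : ∀ {t ℓ} π k → run t ℓ (branch π k) ≡ nothing → ∀ n → run t ℓ (branch π (n + k)) ≡ nothing
  dead-stays π k e zero = e
  dead-stays {t} {ℓ} π k e (suc n) rewrite dead-stays {t} {ℓ} π k e n = refl

  never-dead : ∀ {t ℓ} → Automaton.Accepting automaton t ℓ → ∀ u → run t ℓ u ≢ nothing
  never-dead {t} {ℓ} a u e = true≢false (parity-unique (a (via u)) (1 , refl , often , length u , always))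
    where
    dead : ∀ n → toℕ (prio (run t ℓ (branch (via u) (n + length u)))) ≡ 1
    dead n = cong (toℕ ∘ prio) (dead-stays {t} {ℓ} (via u) (length u) (trans (cong (run t ℓ) (branch-via u)) e) n)
    often : Inf (λ n → toℕ (prio (run t ℓ (branch (via u) n))) ≡ 1)
    often n = n + length u , m≤m+n n _ , dead n
    always : ∀ m → length u ≤ m → 1 ≤ toℕ (prio (run t ℓ (branch (via u) m)))
    always m le = subst (λ z → 1 ≤ toℕ (prio (run t ℓ (branch (via u) z)))) (m∸n+n≡m le) (≤-reflexive (sym (dead (m ∸ length u))))

  correct : ∀ t → Safe t ⇔ Accepts t
  correct t = (λ s → (λ _ → tt) , λ π → parity-cong (λ n → sym (cong (toℕ ∘ prio) (run-safe s (λ _ → tt) (branch π n))))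
                 (0 , refl , (λ n → n , ≤-refl , refl) , 0 , λ _ _ → z≤n)) ,
    λ (ℓ , a) u → tested u ℓ a (test (bit t u) (t u)) refl
    where
    tested : ∀ u ℓ → Automaton.Accepting automaton t ℓ → ∀ b → test (bit t u) (t u) ≡ b → b ≡ true
    tested u ℓ a true e = refl
    tested u ℓ a false e = ⊥-elim (never-dead a (L ∷ u)
      (trans (cong (λ x → step x (t u) (ℓ u) L) (alive {t} {ℓ} u (never-dead a u))) (cong (if_then _ else nothing) e)))

rec-safe : ∀ {A} (test : Bool → A → Bool) (pass : A → Dir → Bool) → Recognisable (Safety.Safe test pass)
rec-safe test pass = Safety.automaton test pass , recognises λ em → Safety.correct test pass

Everywhere : ∀ {A : Set} → (A → Bool) → Tree A → Set
Everywhere p t = ∀ u → p (t u) ≡ true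

rec-everywhere : ∀ {A} (p : A → Bool) → Recognisable (Everywhere p)
rec-everywhere p = rec-safe (λ _ → p) (λ _ _ → false)

Somewhere : ∀ {A : Set} → (A → Bool) → Tree A → Set
Somewhere p t = ∃ λ u → p (t u) ≡ true

rec-somewhere : ∀ {A} (p : A → Bool) → Recognisable (Somewhere p)
rec-somewhere p = rec-map (λ em t → (λ (u , e) n → not-true (n u) e) ,
    λ n → dne em λ ns → n λ u → ≢true⇒not λ e → ns (u , e)) (rec-¬ (rec-everywhere (not ∘ p)))

-- The negation is a safety property: the bit tells a `d`-child that its parent satisfies `p`, and
-- the test then forbids `q`.
rec-edge : ∀ {A} (d : Dir) (p q : A → Bool) → Recognisable (λ t → ∃ λ u → p (t u) ≡ true × q (t (d ∷ u)) ≡ true)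
rec-edge {A} d p q = rec-map (λ em t → to' t , from' em t) (rec-¬ (rec-safe test pass))
  where
  test : Bool → A → Bool
  test b a = not (b ∧ q a)
  pass : A → Dir → Bool
  pass a e = does (Finite._≟_ finDir e d) ∧ p a
  open Safety test pass
  to' : ∀ t → (∃ λ u → p (t u) ≡ true × q (t (d ∷ u)) ≡ true) → ¬ Safe t
  to' t (u , e , e') s = not-true (s (d ∷ u)) (cong₂ _∧_ (cong₂ _∧_ (dec-true (Finite._≟_ finDir d d) refl) e) e')
  from' : Classical → ∀ t → ¬ Safe t → ∃ λ u → p (t u) ≡ true × q (t (d ∷ u)) ≡ true
  from' em t ns with ¬∀→∃¬ em ns
  ... | u , bad = at-node u (∧-split {bit t u} (dne em λ n → bad (≢true⇒not n)))
    where
    at-node : ∀ u → bit t u ≡ true × q (t u) ≡ true → ∃ λ u → p (t u) ≡ true × q (t (d ∷ u)) ≡ true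
    at-node (e ∷ u) (b , qe) with ∧-split {does (Finite._≟_ finDir e d)} b
    ... | e≡d , pe with dec→ (Finite._≟_ finDir e d) e≡d
    ...   | refl = u , pe , qe

_≟N_ : DecidableEquality (List Dir)
_≟N_ = ≡-dec (Finite._≟_ finDir)

Singleton : Tree Bool → Set
Singleton Z = ∃ λ x → ∀ u → Z u ≡ does (u ≟N x)

-- A nonempty set is a singleton iff all its nonempty subsets contain it.
rec-singleton : ∀ {A} → Recognisable (λ (t : Tree (Bool × A)) → Singleton (proj₁ ∘ t))
rec-singleton {A} = rec-map (λ em t → to' t , from' em t)
  (rec-∧ (rec-somewhere proj₁) (rec-¬ (rec-∃ (rec-∧ (rec-∧ (rec-everywhere sub) (rec-somewhere proj₁)) (rec-somewhere missing)))))
  where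
  sub missing : Bool × Bool × A → Bool
  sub (y , x , _) = not y ∨ x
  missing (y , x , _) = x ∧ not y
  Bad : Tree (Bool × A) → Tree Bool → Set
  Bad t Y = (Everywhere sub (λ u → Y u , t u) × Somewhere proj₁ (λ u → Y u , t u)) × Somewhere missing (λ u → Y u , t u)
  to' : ∀ t → Singleton (proj₁ ∘ t) → Somewhere proj₁ t × ¬ ∃ (Bad t)
  to' t (x , e) = (x , trans (e x) (dec-true (x ≟N x) refl)) , λ (Y , (s , (u , yu)) , v , m) → absurd Y s u yu v m
    where
    only : ∀ u → proj₁ (t u) ≡ true → u ≡ x
    only u h = dec→ (u ≟N x) (trans (sym (e u)) h)
    absurd : ∀ Y → Everywhere sub (λ u → Y u , t u) → ∀ u → Y u ≡ true → ∀ v → proj₁ (t v) ∧ not (Y v) ≡ true → ⊥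
    absurd Y s u yu v m with ∧-split {proj₁ (t v)} m
    ... | xv , nv with only v xv | only u (modus (s u) yu)
    ...   | refl | refl = not-true nv yu
  from' : Classical → ∀ t → Somewhere proj₁ t × ¬ ∃ (Bad t) → Singleton (proj₁ ∘ t)
  from' em t ((x , hx) , nb) = x , λ u → bool-iff (λ h → dne em λ n → nb (Y , (sub' , x , yx) , u ,
      cong₂ (λ a b → a ∧ not b) h (bool-iff (λ y → ⊥-elim (n y)) λ ())))
      λ h → trans (cong (proj₁ ∘ t) (dec→ (u ≟N x) h)) hx
    where
    Y : Tree Bool
    Y u = does (u ≟N x)
    yx : Y x ≡ true
    yx = dec-true (x ≟N x) refl
    sub' : ∀ u → sub (Y u , t u) ≡ true
    sub' u with u ≟N x
    ... | no _ = refl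
    ... | yes refl = hx

-- From formulas to automata.

Letter : ℕ → ℕ → Set
Letter m k = Vec Bool m × Vec Bool k

-- First-order variables become singletons. Addresses are reversed since nodes of formulas grow at
-- the end and those of trees at the front.
encode : ∀ {m k} → Vec Node m → Vec NodeSet k → Tree (Letter m k)
encode ρ σ u = mapᵥ (λ x → does (u ≟N reverse x)) ρ , mapᵥ (λ Z → Z (reverse u)) σ

firstIs : ∀ {m k} → Fin m → Letter m k → Bool
firstIs x (fo , so) = lookup fo x

setHas : ∀ {m k} → Fin k → Letter m k → Bool
setHas Z (fo , so) = lookup so Z

firstIs-spec : ∀ {m k} (ρ : Vec Node m) (σ : Vec NodeSet k) x u → firstIs x (encode ρ σ u) ≡ true ⇔ u ≡ reverse (lookup ρ x)
firstIs-spec ρ σ x u = (λ e → dec→ (u ≟N reverse (lookup ρ x)) (trans (sym l) e)) , λ e → trans l (dec-true (u ≟N _) e)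
  where
  l : lookup (mapᵥ (λ x → does (u ≟N reverse x)) ρ) x ≡ does (u ≟N reverse (lookup ρ x))
  l = lookup-map x _ ρ

Represents : ∀ {m k} → Formula m k → (Tree (Letter m k) → Set) → Set₁
Represents φ P = Classical → ∀ ρ σ → Sat φ ρ σ ⇔ P (encode ρ σ)

record Translation {m k} (φ : Formula m k) : Set₁ where
  field
    {Lang} : Tree (Letter m k) → Set
    recog  : Recognisable Lang
    repr   : Represents φ Lang

-- A predicate on trees need not respect pointwise equality; recognisability supplies this in place
-- of function extensionality.
ext-cong : ∀ {A} {P : Tree A → Set} → Recognisable P → Classical → ∀ {t t'} → (∀ u → t u ≡ t' u) → P t → P t'
ext-cong (𝒜 , recognises r) em e p = proj₂ (r em _) (Automaton.accepts-cong 𝒜 e (proj₁ (r em _) p))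

insertFO : ∀ {m k} → Bool × Letter m k → Letter (suc m) k
insertFO (b , fo , so) = b ∷ᵥ fo , so

insertSO : ∀ {m k} → Bool × Letter m k → Letter m (suc k)
insertSO (b , fo , so) = fo , b ∷ᵥ so

succ-translation : ∀ {m k} (d : Dir) (x y : Fin m) (φ : Formula m k) →
  (∀ ρ σ → Sat φ ρ σ ⇔ lookup ρ y ≡ lookup ρ x ++ [ d ]) → Translation φ
succ-translation d x y φ h = record
  { recog = rec-edge d (firstIs x) (firstIs y)
  ; repr = λ em ρ σ →
      (λ s → reverse (lookup ρ x) , proj₂ (firstIs-spec ρ σ x _) refl , proj₂ (firstIs-spec ρ σ y _)
         (sym (trans (cong reverse (proj₁ (h ρ σ) s)) (reverse-++ (lookup ρ x) [ d ])))) ,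
      λ (u , e , e') → proj₂ (h ρ σ) (trans (sym (reverse-involutive (lookup ρ y)))
        (trans (cong reverse (trans (sym (proj₁ (firstIs-spec ρ σ y _) e')) (cong (d ∷_) (proj₁ (firstIs-spec ρ σ x _) e))))
          (trans (unfold-reverse d (reverse (lookup ρ x))) (cong (_++ [ d ]) (reverse-involutive (lookup ρ x)))))) }

translate : ∀ {m k} (φ : Formula m k) → Translation φ
translate (succL x y) = succ-translation L x y _ λ ρ σ → id , id
translate (succR x y) = succ-translation R x y _ λ ρ σ → id , id
translate (x ≐ y) = record
  { recog = rec-somewhere (λ a → firstIs x a ∧ firstIs y a)
  ; repr = λ em ρ σ →
      (λ s → reverse (lookup ρ x) , cong₂ _∧_ (proj₂ (firstIs-spec ρ σ x _) refl) (proj₂ (firstIs-spec ρ σ y _) (cong reverse s))) ,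
      λ (u , e) → let (a , b) = ∧-split {firstIs x (encode ρ σ u)} e in trans (sym (reverse-involutive _))
        (trans (cong reverse (trans (sym (proj₁ (firstIs-spec ρ σ x u) a)) (proj₁ (firstIs-spec ρ σ y u) b))) (reverse-involutive _)) }
translate (x ∈̇ Z) = record
  { recog = rec-somewhere (λ a → firstIs x a ∧ setHas Z a)
  ; repr = λ em ρ σ →
      (λ s → reverse (lookup ρ x) , cong₂ _∧_ (proj₂ (firstIs-spec ρ σ x _) refl)
        (trans (has ρ σ (reverse (lookup ρ x))) (trans (cong (lookup σ Z) (reverse-involutive (lookup ρ x))) s))) ,
      λ (u , e) → let (a , b) = ∧-split {firstIs x (encode ρ σ u)} e in
        trans (cong (lookup σ Z) (trans (sym (reverse-involutive _)) (cong reverse (sym (proj₁ (firstIs-spec ρ σ x u) a)))))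
          (trans (sym (has ρ σ u)) b) }
  where
  has : ∀ ρ σ u → setHas Z (encode ρ σ u) ≡ lookup σ Z (reverse u)
  has ρ σ u = lookup-map Z _ σ
translate (¬̇ φ) = record
  { recog = rec-¬ recog ; repr = λ em ρ σ → (λ n → n ∘ proj₂ (repr em ρ σ)) , λ n → n ∘ proj₁ (repr em ρ σ) }
  where open Translation (translate φ)
translate (φ ∧̇ ψ) = record
  { recog = rec-∧ A.recog B.recog
  ; repr = λ em ρ σ → (λ (a , b) → proj₁ (A.repr em ρ σ) a , proj₁ (B.repr em ρ σ) b) ,
                      λ (a , b) → proj₂ (A.repr em ρ σ) a , proj₂ (B.repr em ρ σ) b }
  where
  module A = Translation (translate φ)
  module B = Translation (translate ψ)
translate (∃¹ φ) = record
  { recog = rec-∃ (rec-∧ rec-singleton (rec-pull insertFO recog))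
  ; repr = λ em ρ σ →
      (λ (x , s) → (λ u → does (u ≟N reverse x)) , (reverse x , λ u → refl) , proj₁ (repr em (x ∷ᵥ ρ) σ) s) ,
      λ (Z , (x , e) , s) → reverse x , proj₂ (repr em (reverse x ∷ᵥ ρ) σ)
        (ext-cong recog em (λ u → cong (λ b → b ∷ᵥ _ , _) (trans (e u) (cong (λ z → does (u ≟N z)) (sym (reverse-involutive x))))) s) }
  where open Translation (translate φ)
translate (∃² φ) = record
  { recog = rec-∃ (rec-pull insertSO recog)
  ; repr = λ em ρ σ →
      (λ (Z , s) → (λ u → Z (reverse u)) , proj₁ (repr em ρ (Z ∷ᵥ σ)) s) ,
      λ (Z , s) → (λ v → Z (reverse v)) , proj₂ (repr em ρ _)
        (ext-cong recog em (λ u → cong (λ b → _ , b ∷ᵥ _) (cong Z (sym (reverse-involutive u)))) s) }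
  where open Translation (translate φ)

-- Finite parity games

module Walks {A : Set} (R : A → A → Set) where

  data Walk : List A → A → A → Set where
    nil  : ∀ {a} → Walk [] a a
    cons : ∀ {a b c vs} → R a b → Walk vs b c → Walk (a ∷ vs) a c

  snoc : ∀ {vs a b c} → Walk vs a b → R b c → Walk (vs ++ [ b ]) a c
  snoc nil r = cons r nil
  snoc (cons r w) r' = cons r (snoc w r')

  close : ∀ {vs a b} → Walk vs a b → R b a → ∃ λ vs' → Walk (a ∷ vs') a a
  close nil r = [] , cons r nil
  close (cons r w) r' = _ , cons r (snoc w r')

  prepend : ∀ {vs a b} → Walk vs a b → (f : ℕ → A) → f 0 ≡ b → (∀ n → R (f n) (f (suc n))) →
    ∃ λ (f' : ℕ → A) → f' 0 ≡ a × (∀ n → R (f' n) (f' (suc n))) × ∃ λ k → ∀ n → f' (k + n) ≡ f n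
  prepend nil f e s = f , e , s , 0 , λ n → refl
  prepend (cons {a} r w) f e s with prepend w f e s
  ... | f' , e' , s' , k , h = f'' , refl , s'' , suc k , h
    where
    f'' : ℕ → A
    f'' zero    = a
    f'' (suc n) = f' n
    s'' : ∀ n → R (f'' n) (f'' (suc n))
    s'' zero    = subst (R a) (sym e') r
    s'' (suc n) = s' n

  module Cycle {a : A} {vs : List A} (closed : Walk (a ∷ vs) a a) where

    record Conf : Set where
      constructor conf
      field
        {vertex} : A
        {rest} : List A
        walk   : Walk (vertex ∷ rest) vertex a

    fresh : Conf
    fresh = conf closed

    advance : Conf → Conf
    advance (conf (cons r nil)) = fresh
    advance (conf (cons r (cons r' w))) = conf (cons r' w)

    advance-edge : ∀ x → R (Conf.vertex x) (Conf.vertex (advance x))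
    advance-edge (conf (cons r nil)) = r
    advance-edge (conf (cons r (cons r' w))) = r

    iterate : Conf → ℕ → Conf
    iterate x zero    = x
    iterate x (suc n) = advance (iterate x n)

    iterate-suc : ∀ x n → iterate (advance x) n ≡ iterate x (suc n)
    iterate-suc x zero = refl
    iterate-suc x (suc n) = cong advance (iterate-suc x n)

    iterate-+ : ∀ x m n → iterate (iterate x m) n ≡ iterate x (n + m)
    iterate-+ x m zero = refl
    iterate-+ x m (suc n) = cong advance (iterate-+ x m n)

    round : ℕ → A
    round n = Conf.vertex (iterate fresh n)

    round-edge : ∀ n → R (round n) (round (suc n))
    round-edge n = advance-edge (iterate fresh n)

    to-fresh : ∀ ws x → Conf.rest x ≡ ws → ∃ λ n → iterate x (suc n) ≡ fresh
    to-fresh [] (conf (cons r nil)) refl = 0 , refl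
    to-fresh (w ∷ ws) x@(conf (cons r (cons r' w'))) refl with to-fresh ws (advance x) refl
    ... | n , e = suc n , trans (cong advance (sym (iterate-suc x n))) e

    module _ {P : A → Set} where

      reach : ∀ x → Any P (Conf.vertex x ∷ Conf.rest x) → ∃ λ n → P (Conf.vertex (iterate x n))
      reach x (here p) = 0 , p
      reach x@(conf (cons r (cons r' w))) (there p) with reach (advance x) p
      ... | n , q = suc n , subst (P ∘ Conf.vertex) (iterate-suc x n) q

      recurs : Any P (a ∷ vs) → Inf (P ∘ round)
      recurs p n with to-fresh _ (iterate fresh n) refl | reach fresh p
      ... | m , e | k , q = k + (suc m + n) , ≤-trans (m≤n+m n (suc m)) (m≤n+m _ k) ,
        subst (P ∘ Conf.vertex) (trans (cong (λ x → iterate x k) (sym (trans (sym (iterate-+ fresh n (suc m))) e))) (iterate-+ fresh (suc m + n) k)) q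

      stays : All P (a ∷ vs) → ∀ n → P (round n)
      stays all n = go n
        where
        all-conf : ∀ x → All P (Conf.vertex x ∷ Conf.rest x) → All P (Conf.vertex (advance x) ∷ Conf.rest (advance x))
        all-conf (conf (cons r nil)) _ = all
        all-conf (conf (cons r (cons r' w))) (_ ∷ᴬ ps) = ps
        allN : ∀ n → All P (Conf.vertex (iterate fresh n) ∷ Conf.rest (iterate fresh n))
        allN zero = all
        allN (suc n) = all-conf (iterate fresh n) (allN n)
        go : ∀ n → P (round n)
        go n with allN n
        ... | p ∷ᴬ _ = p

distinct-bound : ∀ {A : Set} (F : Finite A) (xs : List A) → Unique xs → length xs ≤ size F
distinct-bound F xs u with length xs ≤? size F
... | yes le = le
... | no gt with pigeonhole (≰⇒> gt) (λ i → to F (lookupᴸ xs i))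
...   | i , j , i<j , e = ⊥-elim (<-irrefl (cong toℕ (unique-lookup u i j (to-inj F e))) i<j)
  where
  unique-lookup : ∀ {A : Set} {xs : List A} → Unique xs → ∀ i j → lookupᴸ xs i ≡ lookupᴸ xs j → i ≡ j
  unique-lookup (n ∷ᵁ u) zero zero e = refl
  unique-lookup (n ∷ᵁ u) zero (suc j) e = ⊥-elim (All-lookup n j e)
    where
    All-lookup : ∀ {A : Set} {P : A → Set} {xs : List A} → All P xs → ∀ j → P (lookupᴸ xs j)
    All-lookup (p ∷ᴬ ps) zero = p
    All-lookup (p ∷ᴬ ps) (suc j) = All-lookup ps j
  unique-lookup (n ∷ᵁ u) (suc i) zero e = ⊥-elim (All-lookup n i (sym e))
    where
    All-lookup : ∀ {A : Set} {P : A → Set} {xs : List A} → All P xs → ∀ j → P (lookupᴸ xs j)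
    All-lookup (p ∷ᴬ ps) zero = p
    All-lookup (p ∷ᴬ ps) (suc j) = All-lookup ps j
  unique-lookup (n ∷ᵁ u) (suc i) (suc j) e = cong suc (unique-lookup u i j e)

-- A finite parity game is decided by playing until a position repeats; the loop so closed tells the winner,
-- because the winner may play positionally.
module Minimax {A M C : Set} (finA : Finite A) (finM : Finite M) (finC : Finite C) (m₀ : M) (c₀ : C)
               (next : A → M → C → A) (pr : A → ℕ) where

  _≟A_ : DecidableEquality A
  _≟A_ = Finite._≟_ finA

  History : Set
  History = List (A × ℕ)

  seen : A → History → Maybe ℕ
  seen a [] = nothing
  seen a ((v , p) ∷ h) with v ≟A a
  ... | yes _ = just p
  ... | no _  = seen a h

  lower : A → A × ℕ → A × ℕ
  lower a (v , p) = v , p ⊓ pr a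

  remember : A → History → History
  remember a h = (a , pr a) ∷ map (lower a) h

  -- The number stored with a visited position is the least priority met since the visit, hence that
  -- of the loop if the position returns. The value without fuel is arbitrary: a loop closes before
  -- the fuel given by `decide` is spent.
  eval : ℕ → History → A → Bool
  eval zero       h a = true
  eval (suc fuel) h a with seen a h
  ... | just p  = even p
  ... | nothing = does (anyF finM λ m → allF finC λ c → eval fuel (remember a h) (next a m c) ≟B true)

  decide : A → Bool
  decide = eval (suc (suc (size finA))) []

  rounds : Rounds
  rounds = record { A = A ; M = M ; C = C ; legal = λ _ _ → ⊤ ; next = next ; pr = pr
    ; codeA = λ a → prefix (toℕ (to finA a)) [] ; codeA-inj = λ e → to-inj finA (toℕ-injective (proj₁ (prefix-inj _ _ e)))
    ; codeM = toℕ ∘ to finM ; codeM-inj = λ e → to-inj finM (toℕ-injective e) ; move = λ _ → m₀ , tt ; answer = c₀ }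

  module Invariant (R : A → A → Set) where
    open Walks R

    Entry : A → A × ℕ → Set
    Entry a (v , p) = ∃ λ vs → Walk (v ∷ vs) v a × Any (λ w → pr w ≡ p) (v ∷ vs) × All (λ w → p ≤ pr w) (v ∷ vs)

    Inv : History → A → Set
    Inv h a = All (Entry a) h

    extend : ∀ {a b} → R a b → ∀ e → Entry a e → Entry b (lower a e)
    extend {a} {b} r (v , p) (vs , w , mn , lo) = vs ++ [ a ] , snoc w r ,
        attain (≤-total p (pr a)) , All-++ (mapᴬ (λ {w} le → ≤-trans (m⊓n≤m p (pr a)) le) lo) (m⊓n≤n p (pr a) ∷ᴬ []ᴬ)
      where
      attain : p ≤ pr a ⊎ pr a ≤ p → Any (λ w → pr w ≡ p ⊓ pr a) (v ∷ vs ++ [ a ])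
      attain (inj₁ le) = Any-++ˡ (mapᴱ (λ e → trans e (sym (m≤n⇒m⊓n≡m le))) mn)
      attain (inj₂ ge) = Any-++ʳ (v ∷ vs) (here (sym (m≥n⇒m⊓n≡n ge)))

    inv-step : ∀ {a b h} → R a b → Inv h a → Inv (remember a h) b
    inv-step {a} {b} {h} r inv = ([] , Walks.cons r nil , here refl , ≤-refl ∷ᴬ []ᴬ) ∷ᴬ go h inv
      where
      go : ∀ h → Inv h a → Inv (map (lower a) h) b
      go [] []ᴬ = []ᴬ
      go (e ∷ h) (x ∷ᴬ xs) = extend r e x ∷ᴬ go h xs

    loop : ∀ h a p → Inv h a → seen a h ≡ just p → ∃ λ (as : ℕ → A) → as 0 ≡ a × (∀ n → R (as n) (as (suc n))) × Parity (even p) (pr ∘ as)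
    loop ((v , q) ∷ h) a p (x ∷ᴬ xs) e with v ≟A a
    loop ((v , q) ∷ h) .v .q ((vs , w , mn , lo) ∷ᴬ xs) refl | yes refl =
      round , refl , round-edge , q , refl , recurs mn , 0 , λ m _ → stays lo m
      where open Cycle w
    ... | no _ = loop h a p xs e

  module _ (em : Classical) (S : Solution rounds) where
    open Solution S

    R₁ R₀ : A → A → Set
    R₁ a b = ∃ λ c → b ≡ next a (σ a) c
    R₀ a b = ∃ λ m → b ≡ next a m (τ a m)

    module I₁ = Invariant R₁
    module I₀ = Invariant R₀

    -- Repeating the loop for ever is a play consistent with the positional `σ`, so its least
    -- priority is even.
    even₁ : ∀ h a p → W a ≡ true → I₁.Inv h a → seen a h ≡ just p → even p ≡ true
    even₁ h a p w inv e with I₁.loop h a p inv e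
    ... | as , refl , steps , par = parity-unique par (σ-wins as (proj₁ ∘ steps) w (proj₂ ∘ steps))

    even₀ : ∀ h a p → W a ≡ false → I₀.Inv h a → seen a h ≡ just p → even p ≡ false
    even₀ h a p w inv e with I₀.loop h a p inv e
    ... | as , refl , steps , par = parity-unique par (τ-wins as (proj₁ ∘ steps) w (λ _ → tt) (proj₂ ∘ steps))

    eval₁ : ∀ fuel h a → W a ≡ true → I₁.Inv h a → eval fuel h a ≡ true
    eval₁ zero h a w inv = refl
    eval₁ (suc fuel) h a w inv with seen a h in e
    ... | just p = even₁ h a p w inv e
    ... | nothing = →dec (anyF finM λ m → allF finC λ c → eval fuel (remember a h) (next a m c) ≟B true)
          (σ a , λ c → eval₁ fuel (remember a h) (next a (σ a) c) (σ-stay a c w) (I₁.inv-step (c , refl) inv))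

    seen-nothing : ∀ a h → seen a h ≡ nothing → All (λ v → a ≢ v) (map proj₁ h)
    seen-nothing a [] e = []ᴬ
    seen-nothing a ((v , p) ∷ h) e with v ≟A a
    ... | no n = (λ x → n (sym x)) ∷ᴬ seen-nothing a h e

    vertices-lower : ∀ a h → map proj₁ (map (lower a) h) ≡ map proj₁ h
    vertices-lower a [] = refl
    vertices-lower a (_ ∷ h) = cong (_ ∷_) (vertices-lower a h)

    eval₀ : ∀ fuel h a → W a ≡ false → I₀.Inv h a → Unique (map proj₁ h) → suc (size finA) < fuel + length (map proj₁ h) → eval fuel h a ≡ false
    eval₀ zero h a w inv un lt = ⊥-elim (<-irrefl refl (≤-trans (≤-trans (n≤1+n _) lt) (distinct-bound finA (map proj₁ h) un)))
    eval₀ (suc fuel) h a w inv un lt with seen a h in e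
    ... | just p = even₀ h a p w inv e
    ... | nothing = dec-false (anyF finM λ m → allF finC λ c → eval fuel (remember a h) (next a m c) ≟B true)
          λ (m , all) → true≢false (trans (sym (all (τ a m))) (eval₀ fuel (remember a h) (next a m (τ a m)) (τ-stay a m w tt)
             (I₀.inv-step (m , refl) inv) (subst Unique (cong (a ∷_) (sym (vertices-lower a h))) (seen-nothing a h e ∷ᵁ un))
             (subst (suc (size finA) <_) (trans (sym (+-suc fuel _)) (cong (λ z → fuel + suc (length z)) (sym (vertices-lower a h)))) lt)))

    decide-correct : ∀ a → decide a ≡ W a
    decide-correct a = by (W a) refl
      where
      by : ∀ b → W a ≡ b → decide a ≡ W a
      by true w = trans (eval₁ (suc (suc (size finA))) [] a w []ᴬ) (sym w)
      by false w = trans (eval₀ (suc (suc (size finA))) [] a w []ᴬ []ᵁ (≤-reflexive (sym (+-identityʳ (suc (suc (size finA))))))) (sym w)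

-- Ordinal notations

≤ₒ-refl : ∀ x → x ≤ₒ x
≤ₒ-refl oz     = z≤
≤ₒ-refl (os x) = s≤s (≤ₒ-refl x)
≤ₒ-refl (ol f) = ≤-limit λ k → ≤-cocone k (≤ₒ-refl (f k))

≤ₒ-trans : ∀ {x y z} → x ≤ₒ y → y ≤ₒ z → x ≤ₒ z
≤ₒ-trans z≤             q              = z≤
≤ₒ-trans (≤-limit h)    q              = ≤-limit λ k → ≤ₒ-trans (h k) q
≤ₒ-trans (s≤s p)        (s≤s q)        = s≤s (≤ₒ-trans p q)
≤ₒ-trans (s≤s p)        (≤-cocone k q) = ≤-cocone k (≤ₒ-trans (s≤s p) q)
≤ₒ-trans (≤-cocone k p) (≤-limit h)    = ≤ₒ-trans p (h k)
≤ₒ-trans (≤-cocone j p) (≤-cocone k q) = ≤-cocone k (≤ₒ-trans (≤-cocone j p) q)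

x≤osx : ∀ x → x ≤ₒ os x
x≤osx oz     = z≤
x≤osx (os x) = s≤s (x≤osx x)
x≤osx (ol f) = ≤-limit λ k → ≤ₒ-trans (x≤osx (f k)) (s≤s (≤-cocone k (≤ₒ-refl (f k))))

<ₒ⇒≤ₒ : ∀ {x y} → x <ₒ y → x ≤ₒ y
<ₒ⇒≤ₒ {x} p = ≤ₒ-trans (x≤osx x) p

<ₒ-acc : ∀ x → Acc _<ₒ_ x
<ₒ-acc oz     = acc λ ()
<ₒ-acc (os x) = acc λ { (s≤s p) → below p (<ₒ-acc x) }
  where
  below : ∀ {y x} → y ≤ₒ x → Acc _<ₒ_ x → Acc _<ₒ_ y
  below p (acc rs) = acc λ q → rs (≤ₒ-trans q p)
<ₒ-acc (ol f) = acc λ { (≤-cocone k p) → inverse (<ₒ-acc (f k)) p }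
  where
  inverse : ∀ {x} → Acc _<ₒ_ x → ∀ {y} → y <ₒ x → Acc _<ₒ_ y
  inverse (acc rs) = rs

<ₒ-irrefl : ∀ x → ¬ x <ₒ x
<ₒ-irrefl x = go (<ₒ-acc x)
  where
  go : ∀ {x} → Acc _<ₒ_ x → ¬ x <ₒ x
  go (acc rs) p = go (rs p) p

≤ₒ-total : Classical → ∀ x y → x ≤ₒ y ⊎ y <ₒ x
≤ₒ-total em oz y = inj₁ z≤
≤ₒ-total em (os x) oz = inj₂ (s≤s z≤)
≤ₒ-total em (os x) (os y) with ≤ₒ-total em x y
... | inj₁ p = inj₁ (s≤s p)
... | inj₂ p = inj₂ (s≤s p)
≤ₒ-total em (os x) (ol f) with em {∃ λ k → os x ≤ₒ f k}
... | yes (k , p) = inj₁ (≤-cocone k p)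
... | no n = inj₂ (s≤s (≤-limit below))
  where
  below : ∀ k → f k ≤ₒ x
  below k with ≤ₒ-total em (os x) (f k)
  ... | inj₁ p = ⊥-elim (n (k , p))
  ... | inj₂ (s≤s p) = p
≤ₒ-total em (ol f) y with em {∃ λ k → y <ₒ f k}
... | yes (k , p) = inj₂ (≤-cocone k p)
... | no n = inj₁ (≤-limit below)
  where
  below : ∀ k → f k ≤ₒ y
  below k with ≤ₒ-total em (f k) y
  ... | inj₁ p = p
  ... | inj₂ p = ⊥-elim (n (k , p))

-- Finite sets exhausting the subterms of an ordinal notation; these are cofinal below every subterm.
terms : ℕ → Ord → List Ord
collect : ℕ → (ℕ → Ord) → ℕ → List Ord
terms d oz     = oz ∷ []
terms d (os x) = os x ∷ terms d x
terms d (ol f) = ol f ∷ collect d f d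
collect d f zero    = []
collect d f (suc k) = terms d (f k) ++ collect d f k

-- Presence at all large depths, so that a fixed subterm is available at every node far enough down
-- the tree.
Term : Ord → Ord → Set
Term top x = ∃ λ d → ∀ d' → d ≤ d' → x ∈ᴸ terms d' top

term-self : ∀ d x → x ∈ᴸ terms d x
term-self d oz     = here refl
term-self d (os x) = here refl
term-self d (ol f) = here refl

term-limit : ∀ f k {x} → Term (f k) x → Term (ol f) x
term-limit f k {x} (d , h) = d ⊔ suc k , λ d' le → there (go d' d' (≤-trans (m≤n⊔m d (suc k)) le) (h d' (≤-trans (m≤m⊔n d (suc k)) le)))
  where
  go : ∀ d' m → k < m → x ∈ᴸ terms d' (f k) → x ∈ᴸ collect d' f m
  go d' (suc m) (s≤s le) e with m≤n⇒m<n∨m≡n le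
  ... | inj₁ lt = Any-++ʳ (terms d' (f m)) (go d' m lt e)
  ... | inj₂ refl = Any-++ˡ e

-- Descend into a branch of the limit that already exceeds `o` until a successor is met; its
-- predecessor is the subterm.
cofinal : ∀ c {o} → o <ₒ c → ∃ λ x → Term c x × o ≤ₒ x × x <ₒ c
cofinal (os x) (s≤s p) = x , (0 , λ d _ → there (term-self d x)) , p , s≤s (≤ₒ-refl x)
cofinal (ol f) (≤-cocone k p) with cofinal (f k) p
... | x , t , le , lt = x , term-limit f k t , le , ≤-cocone k lt

term-trans : ∀ top {c x} d → c ∈ᴸ terms d top → Term c x → Term top x
term-trans oz d (here refl) t = t
term-trans (os y) d (here refl) t = t
term-trans (os y) d (there e) t with term-trans y d e t
... | k , h = k , λ d' le → there (h d' le)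
term-trans (ol f) d (here refl) t = t
term-trans (ol f) {c} {x} d (there e) t = go d e
  where
  go : ∀ m → c ∈ᴸ collect d f m → Term (ol f) x
  go (suc m) e with Any-++⁻ (terms d (f m)) e
  ... | inj₁ e' = term-limit f m (term-trans (f m) d e' t)
  ... | inj₂ e' = go m e'

-- A deterministic judge for a disjunction of trace conditions.

module TypedTraces {S : Set} (F : Finite S) {D : ℕ} (c : S → Fin (suc D)) (init : S → Bool) where
  cF : Fin (size F) → Fin (suc D)
  cF = c ∘ from F
  initF : Fin (size F) → Bool
  initF = init ∘ from F
  open Traces cF initF public using (Graph; Trace)

  coded : (S → S → Bool) → Graph
  coded E i j = E (from F i) (from F j)

  record TypedTrace (E : ℕ → S → S → Bool) (b : Bool) : Set where
    field
      ρ      : ℕ → S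
      begins : init (ρ 0) ≡ true
      edges  : ∀ t → E t (ρ t) (ρ (suc t)) ≡ true
      parity : Parity b (λ t → toℕ (c (ρ t)))

  code : ∀ {E b} → TypedTrace E b → Trace (λ t → coded (E t)) b
  code {E} T = record { τ = to F ∘ ρ ; begins = trans (cong init (from-to F (ρ 0))) begins
    ; edges = λ t → trans (cong₂ (E t) (from-to F (ρ t)) (from-to F (ρ (suc t)))) (edges t)
    ; parity = parity-cong (λ t → cong (toℕ ∘ c) (sym (from-to F (ρ t)))) parity }
    where open TypedTrace T

  uncode : ∀ {E b} → Trace (λ t → coded (E t)) b → TypedTrace E b
  uncode T = record { ρ = from F ∘ τ ; begins = begins ; edges = edges ; parity = parity }
    where open Traces.Trace T

productMonoid : FiniteMonoid → FiniteMonoid → FiniteMonoid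
productMonoid M N = record
  { S = M.S × N.S ; fin = fin× M.fin N.fin ; ε = M.ε , N.ε ; _·_ = λ (a , b) (a' , b') → a M.· a' , b N.· b'
  ; assoc = λ (a , b) (a' , b') (a'' , b'') → cong₂ _,_ (M.assoc a a' a'') (N.assoc b b' b'')
  ; idˡ = λ (a , b) → cong₂ _,_ (M.idˡ a) (N.idˡ b) ; idʳ = λ (a , b) → cong₂ _,_ (M.idʳ a) (N.idʳ b) }
  where
  module M = FiniteMonoid M
  module N = FiniteMonoid N

module ProductFactors (M N : FiniteMonoid) (w : ℕ → FiniteMonoid.S M) (v : ℕ → FiniteMonoid.S N) where
  module SP = Segments (productMonoid M N) (λ t → w t , v t)
  module SM = Segments M w
  module SN = Segments N v

  seg-pair : ∀ i k → SP.seg i k ≡ (SM.seg i k , SN.seg i k)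
  seg-pair i zero = refl
  seg-pair i (suc k) rewrite seg-pair (suc i) k = refl

  factors₁ : ∀ {s e} → SP.Factors s e → SM.Factors (proj₁ s) (proj₁ e)
  factors₁ F = record { cut = cut ; incr = incr ; head = trans (cong proj₁ (sym (seg-pair 0 (cut 0)))) (cong proj₁ head)
    ; block = λ k → trans (cong proj₁ (sym (seg-pair (cut k) (cut (suc k) ∸ cut k)))) (cong proj₁ (block k)) ; idem = cong proj₁ idem }
    where open SP.Factors F

  factors₂ : ∀ {s e} → SP.Factors s e → SN.Factors (proj₂ s) (proj₂ e)
  factors₂ F = record { cut = cut ; incr = incr ; head = trans (cong proj₂ (sym (seg-pair 0 (cut 0)))) (cong proj₂ head)
    ; block = λ k → trans (cong proj₂ (sym (seg-pair (cut k) (cut (suc k) ∸ cut k)))) (cong proj₂ (block k)) ; idem = cong proj₂ idem }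
    where open SP.Factors F

-- Over the product monoid a single factorisation carries both lasso tests, so the disjunction is
-- just a Boolean combination of their verdicts.
module TraceOrNone {S₁ S₂ : Set} (F₁ : Finite S₁) (F₂ : Finite S₂) {D₁ D₂ : ℕ}
    (c₁ : S₁ → Fin (suc D₁)) (c₂ : S₂ → Fin (suc D₂)) (init₁ : S₁ → Bool) (init₂ : S₂ → Bool) where
  module T₁ = TypedTraces F₁ c₁ init₁
  module T₂ = TypedTraces F₂ c₂ init₂
  module R₁ = Traces T₁.cF T₁.initF
  module R₂ = Traces T₂.cF T₂.initF

  M : FiniteMonoid
  M = productMonoid R₁.monoid R₂.monoid

  accept : FiniteMonoid.S M → FiniteMonoid.S M → Bool
  accept (s₁ , s₂) (e₁ , e₂) = does (R₁.lasso? true s₁ e₁) ∨ not (does (R₂.lasso? true s₂ e₂))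

  module Det = Determinise M accept

  stepDet : Det.State → (S₁ → S₁ → Bool) → (S₂ → S₂ → Bool) → Det.State
  stepDet x E₁ E₂ = Det.step x (R₁.step (T₁.coded E₁) , R₂.step (T₂.coded E₂))

  module _ (em : Classical) (E₁ : ℕ → S₁ → S₁ → Bool) (E₂ : ℕ → S₂ → S₂ → Bool) (xs : ℕ → Det.State)
           (xs₀ : xs 0 ≡ Det.start) (xsₛ : ∀ n → xs (suc n) ≡ stepDet (xs n) (E₁ n) (E₂ n)) where

    Good : Set
    Good = T₁.TypedTrace E₁ true ⊎ ¬ T₂.TypedTrace E₂ true

    private
      w₁ : ℕ → R₁.Matrix
      w₁ n = R₁.step (T₁.coded (E₁ n))
      w₂ : ℕ → R₂.Matrix
      w₂ n = R₂.step (T₂.coded (E₂ n))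

      is-run : ∀ n → Det.run (λ n → w₁ n , w₂ n) n ≡ xs n
      is-run zero = sym xs₀
      is-run (suc n) = trans (cong (λ x → Det.step x (w₁ n , w₂ n)) (is-run n)) (sym (xsₛ n))

      open ProductFactors R₁.monoid R₂.monoid w₁ w₂

      ∨-elim : ∀ {a b} → a ∨ b ≡ true → a ≡ true ⊎ b ≡ true
      ∨-elim {true} e = inj₁ refl
      ∨-elim {false} e = inj₂ e

      ∨-false : ∀ {a b} → a ∨ b ≡ false → a ≡ false × b ≡ false
      ∨-false {false} e = refl , e

      spec : ∀ {s e} → SP.Factors s e → (accept s e ≡ true → Good) × (accept s e ≡ false → ¬ Good)
      spec {s₁ , s₂} {e₁ , e₂} F = yes' , no'
        where
        yes' : accept (s₁ , s₂) (e₁ , e₂) ≡ true → Good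
        yes' a with ∨-elim {does (R₁.lasso? true s₁ e₁)} a
        ... | inj₁ l = inj₁ (T₁.uncode (R₁.Word.lasso→trace (λ n → T₁.coded (E₁ n)) (factors₁ F) (dec→ (R₁.lasso? true s₁ e₁) l)))
        ... | inj₂ n = inj₂ λ T → not-true n (→dec (R₂.lasso? true s₂ e₂) (R₂.Word.trace→lasso (λ n → T₂.coded (E₂ n)) (factors₂ F) em (T₂.code T)))
        no' : accept (s₁ , s₂) (e₁ , e₂) ≡ false → ¬ Good
        no' a (inj₁ T) = true≢false (trans (sym (→dec (R₁.lasso? true s₁ e₁) (R₁.Word.trace→lasso (λ n → T₁.coded (E₁ n)) (factors₁ F) em (T₁.code T))))
                           (proj₁ (∨-false {does (R₁.lasso? true s₁ e₁)} a)))
        no' a (inj₂ nT) = nT (T₂.uncode (R₂.Word.lasso→trace (λ n → T₂.coded (E₂ n)) (factors₂ F)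
                           (dec→ (R₂.lasso? true s₂ e₂) (not-false (proj₂ (∨-false {does (R₁.lasso? true s₁ e₁)} a))))))

      correct = Det.Correct.Limit.parity-correct (λ n → w₁ n , w₂ n) em Good spec

    good→even : Good → Parity true (Det.prio ∘ xs)
    good→even g = parity-cong (λ n → cong Det.prio (is-run n)) (proj₁ correct g)

    bad→odd : ¬ Good → Parity false (Det.prio ∘ xs)
    bad→odd n = parity-cong (λ n → cong Det.prio (is-run n)) (proj₂ correct n)

-- The dichotomy

-- The game deciding the dichotomy for 𝒜, whose input letters are (membership in X , letter of Y).
-- The first player builds Y together with an accepting run on it and claims about ranks, arranged in slots
-- carrying (imaginary) decreasing ordinals α 0 ≥ α 1 ≥ ⋯ :
--   q ∈ T i  claims that no accepting run from q has rank < α i;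
--   q ∈ A i  claims that in such a run a marked node with a claim slightly below α i can be forced.
-- The second player chooses the direction and, for every slot i, whether the claims reached by forcing a
-- mark from A i get a new slot i′ inserted below i or are merged into slot i+1.  The first player wins if
-- some chain of slots i₀ , i₁ = i₀′ , … descends for ever (which no ordinals can do), or if his run is
-- accepting and forcing never goes on for ever along an accepting run.
module ClaimGame {B : Set} (finB : Finite B) (b₀ : B) (𝒜 : Automaton (Bool × B)) where
  open Automaton 𝒜

  n : ℕ
  n = size finX

  -- As the ordinals decrease, the two claim sets grow; their sizes add up to a number from `0` to
  -- `n + n`, and one slot for each possible sum suffices.
  K : ℕ
  K = suc (n + n)

  Slot Sub Levels : Set
  Slot = Fin K
  Sub = Table finX Bool
  Levels = Vec (Sub × Sub) K

  infix 4 _∊_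
  _∊_ : X → Sub → Set
  q ∊ S = app finX S q ≡ true

  T A : Levels → Slot → Sub
  T ls i = proj₁ (lookup ls i)
  A ls i = proj₂ (lookup ls i)

  finOption : Finite (X × Bool × Λ)
  finOption = fin× finX (fin× finBool finΛ)

  Directions : Set
  Directions = Table finOption Dir

  State : Set
  State = X × Levels

  record Plan : Set where
    constructor plan
    field
      letter      : B
      mark        : Bool
      label       : Λ
      stay attack : Directions

  Challenge : Set
  Challenge = Dir × Vec Bool K

  Response : Set
  Response = Vec (Slot × Bool) K × Levels

  finLevels : Finite Levels
  finLevels = finVec (fin× (finTable finX finBool) (finTable finX finBool)) K

  finPlan : Finite Plan
  finPlan = finVia (fin× finB (fin× finBool (fin× finΛ (fin× (finTable finOption finDir) (finTable finOption finDir)))))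
    (λ (plan b m l s a) → b , m , l , s , a) (λ (b , m , l , s , a) → plan b m l s a) λ _ → refl

  finChallenge : Finite Challenge
  finChallenge = fin× finDir (finVec finBool K)

  finResponse : Finite Response
  finResponse = fin× (finVec (fin× (finFin K) finBool) K) finLevels

  Move : Set
  Move = Plan × Table finChallenge Response

  finMove : Finite Move
  finMove = fin× finPlan (finTable finChallenge finResponse)

  -- Candidates in order of decreasing ordinals: `i`, then the slot inserted below it, then `i + 1`.
  rank : Slot × Bool → ℕ
  rank (i , false) = toℕ i + toℕ i
  rank (i , true)  = suc (toℕ i + toℕ i)

  module Rules (ls : Levels) (p : Plan) (c : Challenge) (r : Response) where
    open Plan p

    d : Dir
    d = proj₁ c
    merged : Slot → Bool
    merged i = lookup (proj₂ c) i
    g : Slot → Slot × Bool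
    g j = lookup (proj₁ r) j
    ls' : Levels
    ls' = proj₂ r

    succ : X → Bool → Λ → X
    succ q m l = step q (m , letter) l d

    -- A claim may be strengthened on the way: smaller rank of the origin means a larger ordinal.
    Found : (Levels → Slot → Sub) → ℕ → X → Set
    Found S k q = ∃ λ j → rank (g j) ≤ k × q ∊ S ls' j

    -- `Lands` and `Merges` fix what a forced mark yields: a claim for the inserted slot if the
    -- opponent granted one, otherwise for the next old slot. If the last slot is merged, nothing
    -- has to be claimed.
    Inside Monotone Allowed Stays Attacks Lands Merges Valid : Set
    Inside   = ∀ i q → q ∊ T ls i → q ∊ A ls i
    Monotone = ∀ j j' → toℕ j ≤ toℕ j' → rank (g j) ≤ rank (g j')
    Allowed  = ∀ j → proj₂ (g j) ≡ true → merged (proj₁ (g j)) ≡ false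
    Stays    = ∀ i q m l → q ∊ T ls i → app finOption stay (q , m , l) ≡ d → Found T (toℕ i + toℕ i) (succ q m l)
    Attacks  = ∀ i q l → q ∊ A ls i → app finOption attack (q , false , l) ≡ d → Found A (toℕ i + toℕ i) (succ q false l)
    Lands    = ∀ i q l → q ∊ A ls i → app finOption attack (q , true , l) ≡ d → merged i ≡ false →
               Found T (suc (toℕ i + toℕ i)) (succ q true l)
    Merges   = ∀ i (i' : Slot) q l → q ∊ A ls i → app finOption attack (q , true , l) ≡ d → merged i ≡ true → toℕ i' ≡ suc (toℕ i) →
               Found T (toℕ i' + toℕ i') (succ q true l)
    Valid    = Inside × Monotone × Allowed × Stays × Attacks × Lands × Merges

    private
      ∊? : ∀ q S → Dec (q ∊ S)
      ∊? q S = app finX S q ≟B true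
      d? : ∀ x → Dec (x ≡ d)
      d? x = Finite._≟_ finDir x d
      found? : ∀ S k q → Dec (Found S k q)
      found? S k q = any? λ j → (rank (g j) ≤? k) ×-dec ∊? q (S ls' j)

    abstract
      valid? : Dec Valid
      valid? = (all? λ i → allF finX λ q → ∊? q (T ls i) →-dec ∊? q (A ls i))
        ×-dec (all? λ j → all? λ j' → (toℕ j ≤? toℕ j') →-dec (rank (g j) ≤? rank (g j')))
        ×-dec (all? λ j → (proj₂ (g j) ≟B true) →-dec (merged (proj₁ (g j)) ≟B false))
        ×-dec (all? λ i → allF finX λ q → allF finBool λ m → allF finΛ λ l → ∊? q (T ls i) →-dec d? (app finOption stay (q , m , l)) →-dec found? T (toℕ i + toℕ i) (succ q m l))
        ×-dec (all? λ i → allF finX λ q → allF finΛ λ l → ∊? q (A ls i) →-dec d? (app finOption attack (q , false , l)) →-dec found? A (toℕ i + toℕ i) (succ q false l))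
        ×-dec (all? λ i → allF finX λ q → allF finΛ λ l → ∊? q (A ls i) →-dec d? (app finOption attack (q , true , l)) →-dec (merged i ≟B false) →-dec found? T (suc (toℕ i + toℕ i)) (succ q true l))
        ×-dec (all? λ i → all? λ i' → allF finX λ q → allF finΛ λ l → ∊? q (A ls i) →-dec d? (app finOption attack (q , true , l)) →-dec (merged i ≟B true) →-dec
                 (toℕ i' ≟ℕ suc (toℕ i)) →-dec found? T (toℕ i' + toℕ i') (succ q true l))

  -- Level traces follow slots; the flag tells whether the last step went to an inserted slot.
  LevelState : Set
  LevelState = Slot × Bool

  finLevelState : Finite LevelState
  finLevelState = fin× (finFin K) finBool

  levelPrio : LevelState → Fin 2
  levelPrio (_ , true)  = zero
  levelPrio (_ , false) = suc zero

  module _ (s : State) (mv : Move) (c : Challenge) where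
    private
      p = proj₁ mv
      r = app finChallenge (proj₂ mv) c
      f = proj₁ s
      ls = proj₂ s
    open Plan p
    open Rules ls p c r

    nextState : State
    nextState = step f (mark , letter) label d , ls'

    -- Validity is part of the edge, so that a rule-breaking constructor cannot win by an invented
    -- descent.
    LevelEdge : LevelState → LevelState → Set
    LevelEdge (i , _) (j , b) = Valid × g j ≡ (i , b)

    levelEdge? : ∀ x y → Dec (LevelEdge x y)
    levelEdge? (i , _) (j , b) = valid? ×-dec Finite._≟_ (fin× (finFin K) finBool) (g j) (i , b)

    levelEdge : LevelState → LevelState → Bool
    levelEdge x y = does (levelEdge? x y)

  data BadState : Set where
    waiting broken    : BadState
    running attacking : X → BadState

  finBadState : Finite BadState
  finBadState = finVia (fin⊎ finBool (fin⊎ finX finX))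
    (λ { waiting → inj₁ true ; broken → inj₁ false ; (running q) → inj₂ (inj₁ q) ; (attacking q) → inj₂ (inj₂ q) })
    (λ { (inj₁ true) → waiting ; (inj₁ false) → broken ; (inj₂ (inj₁ q)) → running q ; (inj₂ (inj₂ q)) → attacking q })
    (λ { waiting → refl ; broken → refl ; (running q) → refl ; (attacking q) → refl })

  -- Even parity means bad: a broken rule at once, a rejecting run after a shift by one, and forcing
  -- along an accepting run with its own priorities. Waiting for ever is harmless.
  badPrio : BadState → Fin (suc (suc D))
  badPrio waiting       = suc zero
  badPrio broken        = zero
  badPrio (running q)   = suc (prio q)
  badPrio (attacking q) = inject₁ (prio q)

  isWaiting : BadState → Bool
  isWaiting waiting = true
  isWaiting _       = false

  module _ (s : State) (mv : Move) (c : Challenge) where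
    private
      p = proj₁ mv
      r = app finChallenge (proj₂ mv) c
      f = proj₁ s
      ls = proj₂ s
    open Plan p
    open Rules ls p c r

    Forced : X → X → Set
    Forced q q' = ∃ λ i → ∃ λ l → q ∊ A ls i × app finOption attack (q , false , l) ≡ d × q' ≡ succ q false l

    -- The trace guesses when to stop waiting. A wrong guess of the state in `running` has no
    -- successor.
    BadEdge : BadState → BadState → Set
    BadEdge waiting waiting             = ⊤
    BadEdge waiting broken              = ¬ Valid
    BadEdge waiting (running q)         = ⊤
    BadEdge waiting (attacking q)       = ⊤
    BadEdge broken broken               = ⊤
    BadEdge (running q) (running q')    = q ≡ f × q' ≡ step f (mark , letter) label d
    BadEdge (attacking q) (attacking q') = Forced q q'
    BadEdge _ _                         = ⊥

    _≟X_ : DecidableEquality X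
    _≟X_ = Finite._≟_ finX

    forced? : ∀ q q' → Dec (Forced q q')
    forced? q q' = any? λ i → anyF finΛ λ l → (app finX (A ls i) q ≟B true) ×-dec
      Finite._≟_ finDir (app finOption attack (q , false , l)) d ×-dec (q' ≟X succ q false l)

    badEdge? : ∀ x y → Dec (BadEdge x y)
    badEdge? waiting waiting             = yes tt
    badEdge? waiting broken              = ¬? valid?
    badEdge? waiting (running q)         = yes tt
    badEdge? waiting (attacking q)       = yes tt
    badEdge? broken waiting              = no λ ()
    badEdge? broken broken               = yes tt
    badEdge? broken (running q)          = no λ ()
    badEdge? broken (attacking q)        = no λ ()
    badEdge? (running q) waiting         = no λ ()
    badEdge? (running q) broken          = no λ ()
    badEdge? (running q) (running q')    = (q ≟X f) ×-dec (q' ≟X _)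
    badEdge? (running q) (attacking _)   = no λ ()
    badEdge? (attacking q) waiting       = no λ ()
    badEdge? (attacking q) broken        = no λ ()
    badEdge? (attacking q) (running _)   = no λ ()
    badEdge? (attacking q) (attacking q') = forced? q q'

    badEdge : BadState → BadState → Bool
    badEdge x y = does (badEdge? x y)

  module Judge = TraceOrNone finLevelState finBadState {1} {suc D} levelPrio badPrio (λ _ → true) isWaiting

  Pos : Set
  Pos = State × Judge.Det.State

  finPos : Finite Pos
  finPos = fin× (fin× finX finLevels) Judge.Det.finState

  next : Pos → Move → Challenge → Pos
  next (s , x) mv c = nextState s mv c , Judge.stepDet x (levelEdge s mv c) (badEdge s mv c)

  just-x₀ none : Sub
  just-x₀ = lam finX λ q → does (Finite._≟_ finX q x₀)
  none = lam finX λ _ → false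

  startLevels : Levels
  startLevels = (just-x₀ , just-x₀) ∷ᵥ replicate (n + n) (none , none)

  -- Abstract, so that the large type of positions is not unfolded wherever start occurs.
  abstract
    start : Pos
    start = (x₀ , startLevels) , Judge.Det.start

    start-state : proj₁ start ≡ (x₀ , startLevels)
    start-state = refl

    start-judge : proj₂ start ≡ Judge.Det.start
    start-judge = refl

  prioPos : Pos → ℕ
  prioPos (_ , x) = Judge.Det.prio x

  c₀ : Challenge
  c₀ = L , replicate K false

  mv₀ : Move
  mv₀ = plan b₀ true λ₀ (lam finOption λ _ → L) (lam finOption λ _ → L) ,
        lam finChallenge λ _ → replicate K (zero , false) , startLevels

  module MM = Minimax finPos finMove finChallenge mv₀ c₀ next prioPos

  abstract
    constructorWins : Bool
    constructorWins = MM.decide start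

    constructorWins-correct : Classical → (S : Solution MM.rounds) → constructorWins ≡ Solution.W S start
    constructorWins-correct em S = MM.decide-correct em S start

  -- A line of slots without a cycle passes at most as many insertions as there are pairs of a
  -- position and a level state. `K` covers the staggered start values, and the extra one keeps
  -- every value positive.
  bound : ℕ
  bound = suc (size (fin× finPos finLevelState)) + K

  module _ (em : Classical) where

    abstract
      solution : Solution MM.rounds
      solution = SolveRounds.solution em MM.rounds (suc Judge.Det.quiet) (λ (_ , x) → toℕ<n (proj₂ x))

    module Play (as : ℕ → Pos) (ms : ℕ → Move) (cs : ℕ → Challenge) (as₀ : as 0 ≡ start)
                (asₛ : ∀ t → as (suc t) ≡ next (as t) (ms t) (cs t)) where
      E₁ : ℕ → LevelState → LevelState → Bool
      E₁ t = levelEdge (proj₁ (as t)) (ms t) (cs t)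
      E₂ : ℕ → BadState → BadState → Bool
      E₂ t = badEdge (proj₁ (as t)) (ms t) (cs t)

      Good : Set
      Good = Judge.T₁.TypedTrace E₁ true ⊎ ¬ Judge.T₂.TypedTrace E₂ true

      good→even : Good → Parity true (prioPos ∘ as)
      good→even = Judge.good→even em E₁ E₂ (proj₂ ∘ as) (trans (cong proj₂ as₀) start-judge) (cong proj₂ ∘ asₛ)

      even→good : Parity true (prioPos ∘ as) → Good
      even→good par = dne em λ ng → true≢false (parity-unique par
        (Judge.bad→odd em E₁ E₂ (proj₂ ∘ as) (trans (cong proj₂ as₀) start-judge) (cong proj₂ ∘ asₛ) ng))

-- Subtrees, branches and counting functions on trees.

data _≼_ (v : List Dir) : List Dir → Set where
  self : v ≼ v
  down : ∀ {u d} → v ≼ u → v ≼ (d ∷ u)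

≼-trans : ∀ {u v w} → u ≼ v → v ≼ w → u ≼ w
≼-trans p self     = p
≼-trans p (down q) = down (≼-trans p q)

Counts : Tree Bool → Ord → Tree Ord → Set
Counts Xs η C = (∀ v → Xs v ≡ true → C v <ₒ η) ×
                (∀ v d w → Xs v ≡ true → Xs w ≡ true → (d ∷ v) ≼ w → C w <ₒ C v)

_∷ˢ_ : ∀ {A : Set} → A → (ℕ → A) → ℕ → A
(x ∷ˢ f) zero    = x
(x ∷ˢ f) (suc n) = f n

glue : List Dir → (ℕ → Dir) → ℕ → Dir
glue []      ds = ds
glue (d ∷ u) ds = glue u (d ∷ˢ ds)

ext : List Dir → (ℕ → Dir) → ℕ → List Dir
ext u ds zero    = u
ext u ds (suc n) = ds n ∷ ext u ds n

ext-suc : ∀ u d ds n → ext u (d ∷ˢ ds) (suc n) ≡ ext (d ∷ u) ds n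
ext-suc u d ds zero = refl
ext-suc u d ds (suc n) = cong (ds n ∷_) (ext-suc u d ds n)

branch-glue : ∀ u ds n → branch (glue u ds) (n + length u) ≡ ext u ds n
branch-glue [] ds n = trans (cong (branch ds) (+-identityʳ n)) (go n)
  where
  go : ∀ n → branch ds n ≡ ext [] ds n
  go zero = refl
  go (suc n) = cong (ds n ∷_) (go n)
branch-glue (d ∷ u) ds n = trans (cong (branch (glue u (d ∷ˢ ds))) (+-suc n (length u)))
  (trans (branch-glue u (d ∷ˢ ds) (suc n)) (ext-suc u d ds n))

glue-at : ∀ u ds n → glue u ds (n + length u) ≡ ds n
glue-at u ds n = proj₁ (∷-inj (trans (branch-glue u ds (suc n)) refl))

finite-max : Classical → (P : Ord → Set) → ∀ xs {x} → x ∈ᴸ xs → P x →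
  ∃ λ m → m ∈ᴸ xs × P m × (∀ y → y ∈ᴸ xs → P y → y ≤ₒ m)
finite-max em P (y ∷ xs) {x} x∈ px with em {∃ λ z → z ∈ᴸ xs × P z}
... | no none = x , x∈ , px , λ { z (here refl) pz → top z x∈ pz ; z (there z∈) pz → ⊥-elim (none (z , z∈ , pz)) }
  where
  top : ∀ z → x ∈ᴸ (z ∷ xs) → P z → z ≤ₒ x
  top z (here refl) _ = ≤ₒ-refl z
  top z (there x∈') _ = ⊥-elim (none (x , x∈' , px))
... | yes (z , z∈ , pz) with finite-max em P xs z∈ pz
...   | m , m∈ , pm , max with em {P y × m ≤ₒ y}
...     | yes (py , le) = y , here refl , py , λ { w (here refl) _ → ≤ₒ-refl y ; w (there w∈) pw → ≤ₒ-trans (max w w∈ pw) le }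
...     | no n = m , there m∈ , pm , λ { w (here refl) pw → low w pw n ; w (there w∈) pw → max w w∈ pw }
  where
  low : ∀ w → P w → ¬ (P w × m ≤ₒ w) → w ≤ₒ m
  low w pw n with ≤ₒ-total em w m
  ... | inj₁ le = le
  ... | inj₂ lt = ⊥-elim (n (pw , <ₒ⇒≤ₒ lt))

parity-suc : ∀ {b c} → Parity b c → Parity (not b) (suc ∘ c)
parity-suc (p , e , i , k , lo) = suc p , cong not e , inf-map (λ m → cong suc) i , k , λ m le → s≤s (lo m le)

-- A winning constructor forces arbitrarily large countable ranks.

module Unbounded {B : Set} (finB : Finite B) (b₀ : B) (𝒜 : Automaton (Bool × B)) (em : Classical) where
  open Automaton 𝒜
  open ClaimGame finB b₀ 𝒜
  open Solution (solution em)

  level-flag : ∀ x → toℕ (levelPrio x) ≡ 0 → proj₂ x ≡ true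
  level-flag (_ , true) e = refl

  -- The constructor's strategy is answered according to actual ordinals below `top`. Infinitely
  -- many may be needed, but at depth `d` only those in the finite list `terms d top` are considered
  -- for insertion; each subterm becomes available further down.
  module Against (won : W start ≡ true) (top : Ord) where

    record Config : Set where
      constructor config
      field
        pos : Pos
        lab : Slot → Ord
    open Config

    module _ (d : ℕ) (ls : Slot → Ord) (i : Slot) where
      -- Maximality makes the inserted ordinal dominate every available one below slot `i`, which is
      -- what a claim after a forced mark has to provide.
      Room : Set
      Room = ∃ λ e → e ∈ᴸ terms d top × e <ₒ ls i × (∀ i' → toℕ i' ≡ suc (toℕ i) → ls i' <ₒ e) ×
             (∀ e' → e' ∈ᴸ terms d top → e' <ₒ ls i → e' ≤ₒ e)

      abstract
        room : Dec Room
        room = em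

      insertion : Ord
      insertion with room
      ... | yes (e , _) = e
      -- A placeholder: `Allowed` forbids inserted slots where there is no room.
      ... | no _        = oz

      insertion-spec : does room ≡ true → insertion <ₒ ls i × (∀ i' → toℕ i' ≡ suc (toℕ i) → ls i' <ₒ insertion) ×
        (∀ e' → e' ∈ᴸ terms d top → e' <ₒ ls i → e' ≤ₒ insertion)
      insertion-spec r with room
      ... | yes (e , _ , a , b , c) = a , b , c

      no-room : does room ≡ false → ∀ e → e ∈ᴸ terms d top → e <ₒ ls i → ∃ λ i' → toℕ i' ≡ suc (toℕ i) × e ≤ₒ ls i'
      no-room r e e∈ lt with room
      ... | no n with finite-max em (_<ₒ ls i) (terms d top) e∈ lt
      ...   | m , m∈ , m< , max = dne em λ nx → n (m , m∈ , m< , (λ i' eq → above nx i' eq (≤ₒ-total em m (ls i'))) , max)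
        where
        above : ¬ (∃ λ i' → toℕ i' ≡ suc (toℕ i) × e ≤ₒ ls i') → ∀ i' → toℕ i' ≡ suc (toℕ i) → m ≤ₒ ls i' ⊎ ls i' <ₒ m → ls i' <ₒ m
        above nx i' eq (inj₁ le) = ⊥-elim (nx (i' , eq , ≤ₒ-trans (max e e∈ lt) le))
        above nx i' eq (inj₂ lt) = lt

    candidate : ℕ → (Slot → Ord) → Slot × Bool → Ord
    candidate d ls (i , false) = ls i
    candidate d ls (i , true)  = insertion d ls i

    merging : ℕ → (Slot → Ord) → Vec Bool K
    merging d ls = tabulate λ i → not (does (room d ls i))

    merging-at : ∀ d ls i → lookup (merging d ls) i ≡ not (does (room d ls i))
    merging-at d ls i = lookup∘tabulate (λ i → not (does (room d ls i))) i

    cfg : Tree Config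
    moveAt : List Dir → Move
    challengeAt : List Dir → Dir → Challenge
    responseAt : List Dir → Dir → Response
    moveAt u = σ (pos (cfg u))
    challengeAt u d = d , merging (length u) (lab (cfg u))
    responseAt u d = app finChallenge (proj₂ (moveAt u)) (challengeAt u d)
    cfg []      = config start λ { zero → top ; (suc _) → oz }
    cfg (d ∷ u) = config (next (pos (cfg u)) (moveAt u) (challengeAt u d))
                         (λ j → candidate (length u) (lab (cfg u)) (lookup (proj₁ (responseAt u d)) j))

    Y : Tree B
    Y u = Plan.letter (proj₁ (moveAt u))

    levels : List Dir → Levels
    levels u = proj₂ (proj₁ (pos (cfg u)))

    module R (u : List Dir) (d : Dir) = Rules (levels u) (proj₁ (moveAt u)) (challengeAt u d) (responseAt u d)

    module OnBranch (π : ℕ → Dir) where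
      as : ℕ → Pos
      as t = pos (cfg (branch π t))
      cs : ℕ → Challenge
      cs t = challengeAt (branch π t) (π t)

      open Play em as (λ t → moveAt (branch π t)) cs refl (λ t → refl) public

      good : Good
      good = even→good (σ-wins as cs won λ t → refl)

      -- Every flagged step strictly lowers the ordinal attached to the slot, and the other steps
      -- preserve it.
      no-descent : ¬ Judge.T₁.TypedTrace E₁ true
      no-descent Tr = go 0 (<ₒ-acc (L' 0))
        where
        open Judge.T₁.TypedTrace Tr
        L' : ℕ → Ord
        L' t = lab (cfg (branch π t)) (proj₁ (ρ t))
        edge : ∀ t → LevelEdge (proj₁ (as t)) (moveAt (branch π t)) (cs t) (ρ t) (ρ (suc t))
        edge t = dec→ (levelEdge? (proj₁ (as t)) (moveAt (branch π t)) (cs t) (ρ t) (ρ (suc t))) (edges t)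
        descend : ∀ t → L' (suc t) ≤ₒ L' t × (proj₂ (ρ (suc t)) ≡ true → L' (suc t) <ₒ L' t)
        descend t with ρ (suc t) | edge t
        ... | j , b | (_ , _ , allowed , _) , e = by b e (allowed j)
          where
          u = branch π t
          module R' = R u (π t)
          by : ∀ b → R'.g j ≡ (proj₁ (ρ t) , b) → (proj₂ (R'.g j) ≡ true → R'.merged (proj₁ (R'.g j)) ≡ false) →
            candidate (length u) (lab (cfg u)) (R'.g j) ≤ₒ L' t × (b ≡ true → candidate (length u) (lab (cfg u)) (R'.g j) <ₒ L' t)
          by false e al rewrite e = ≤ₒ-refl _ , λ ()
          by true e al rewrite e = <ₒ⇒≤ₒ lt , λ _ → lt
            where
            lt : insertion (length u) (lab (cfg u)) (proj₁ (ρ t)) <ₒ L' t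
            lt = proj₁ (insertion-spec (length u) (lab (cfg u)) (proj₁ (ρ t))
                   (not-injective (trans (sym (merging-at (length u) (lab (cfg u)) (proj₁ (ρ t)))) (al refl))))
        weak : ∀ d t → L' (d + t) ≤ₒ L' t
        weak zero t = ≤ₒ-refl _
        weak (suc d) t = ≤ₒ-trans (proj₁ (descend (d + t))) (weak d t)
        flagged : Inf (λ t → proj₂ (ρ t) ≡ true)
        flagged = by parity
          where
          by : Parity true (λ t → toℕ (levelPrio (ρ t))) → Inf (λ t → proj₂ (ρ t) ≡ true)
          by (zero , e , i , _) = inf-map (λ t → level-flag (ρ t)) i
          by (suc (suc p) , e , i , _) n with i n
          ... | m , le , eq = ⊥-elim (impossible (subst (_< 2) eq (toℕ<n (levelPrio (ρ m)))))
            where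
            impossible : ¬ suc (suc p) < 2
            impossible (s≤s (s≤s ()))
        go : ∀ t → Acc _<ₒ_ (L' t) → ⊥
        go t (acc rs) with flagged (suc t)
        ... | suc m , s≤s le , f = go (suc m) (rs (≤ₒ-trans (proj₂ (descend m) f)
                (subst (λ z → L' z ≤ₒ L' t) (m∸n+n≡m le) (weak (m ∸ t) t))))

      no-bad : ¬ Judge.T₂.TypedTrace E₂ true
      no-bad = [ (λ T₁ → ⊥-elim (no-descent T₁)) , id ]′ good

    abstract
      BadStep : List Dir → Dir → BadState → BadState → Bool
      BadStep u d = badEdge (proj₁ (pos (cfg u))) (moveAt u) (challengeAt u d)

      BadStep-intro : ∀ u d {x y} → BadEdge (proj₁ (pos (cfg u))) (moveAt u) (challengeAt u d) x y → BadStep u d x y ≡ true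
      BadStep-intro u d {x} {y} e = →dec (badEdge? (proj₁ (pos (cfg u))) (moveAt u) (challengeAt u d) x y) e

      BadStep-edge : ∀ π t x y → BadStep (branch π t) (π t) x y ≡ true → OnBranch.E₂ π t x y ≡ true
      BadStep-edge π t x y e = e

    wait : ℕ → (ℕ → BadState) → ℕ → BadState
    wait zero    tail = waiting ∷ˢ tail
    wait (suc k) tail = waiting ∷ˢ wait k tail

    wait-start : ∀ k tail → isWaiting (wait k tail 0) ≡ true
    wait-start zero tail = refl
    wait-start (suc k) tail = refl

    wait-tail : ∀ k tail n → wait k tail (suc k + n) ≡ tail n
    wait-tail zero tail n = refl
    wait-tail (suc k) tail n = wait-tail k tail n

    wait-edges : ∀ k tail (E : ℕ → BadState → BadState → Bool) → (∀ t → E t waiting waiting ≡ true) → E k waiting (tail 0) ≡ true →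
      (∀ t → E (suc k + t) (tail t) (tail (suc t)) ≡ true) → ∀ t → E t (wait k tail t) (wait k tail (suc t)) ≡ true
    wait-edges zero tail E w s es zero = s
    wait-edges zero tail E w s es (suc t) = es t
    wait-edges (suc zero) tail E w s es zero = w 0
    wait-edges (suc (suc k)) tail E w s es zero = w 0
    wait-edges (suc k) tail E w s es (suc t) = wait-edges k tail (E ∘ suc) (w ∘ suc) s es t

    -- Waiting until `u` is reached turns a bad trace below `u` into one from the root.
    no-bad-from : ∀ u ds tail → BadStep u (ds 0) waiting (tail 0) ≡ true →
      (∀ n → BadStep (ext u ds (suc n)) (ds (suc n)) (tail n) (tail (suc n)) ≡ true) → ¬ Parity true (λ n → toℕ (badPrio (tail n)))
    no-bad-from u ds tail s es par = OnBranch.no-bad π record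
      { ρ = wait k tail ; begins = wait-start k tail
      ; edges = λ t → BadStep-edge π t _ _ (wait-edges k tail (λ t → BadStep (branch π t) (π t))
          (λ t → BadStep-intro (branch π t) (π t) tt)
          (subst₂ (λ v d → BadStep v d waiting (tail 0) ≡ true) (sym (branch-glue u ds 0)) (sym (glue-at u ds 0)) s)
          (λ t → subst (λ z → BadStep (branch π z) (π z) (tail t) (tail (suc t)) ≡ true) (cong suc (+-comm t k))
            (subst₂ (λ v d → BadStep v d (tail t) (tail (suc t)) ≡ true) (sym (branch-glue u ds (suc t))) (sym (glue-at u ds (suc t))) (es t))) t)
      ; parity = parity-unshift (suc k) (parity-cong (λ n → cong (toℕ ∘ badPrio) (sym (wait-tail k tail n))) par) }
      where
      k = length u
      π = glue u ds

    abstract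
     valid : ∀ u d → R.Valid u d
     valid u d = dne em λ nv → no-bad-from u (λ _ → d) (λ _ → broken) (BadStep-intro u d {waiting} {broken} nv)
      (λ n → BadStep-intro (ext u (λ _ → d) (suc n)) d {broken} {broken} tt) (0 , refl , (λ n → n , ≤-refl , refl) , 0 , λ _ _ → z≤n)

    inside : ∀ u d → R.Inside u d
    inside u d = proj₁ (valid u d)
    monotone : ∀ u d → R.Monotone u d
    monotone u d = proj₁ (proj₂ (valid u d))
    allowed : ∀ u d → R.Allowed u d
    allowed u d = proj₁ (proj₂ (proj₂ (valid u d)))
    stays : ∀ u d → R.Stays u d
    stays u d = proj₁ (proj₂ (proj₂ (proj₂ (valid u d))))
    attacks : ∀ u d → R.Attacks u d
    attacks u d = proj₁ (proj₂ (proj₂ (proj₂ (proj₂ (valid u d)))))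
    lands : ∀ u d → R.Lands u d
    lands u d = proj₁ (proj₂ (proj₂ (proj₂ (proj₂ (proj₂ (valid u d))))))
    merges : ∀ u d → R.Merges u d
    merges u d = proj₂ (proj₂ (proj₂ (proj₂ (proj₂ (proj₂ (valid u d))))))

    marks : Tree Bool
    marks u = Plan.mark (proj₁ (moveAt u))

    labels : Tree Λ
    labels u = Plan.label (proj₁ (moveAt u))

    is-run : ∀ u → run (λ u → marks u , Y u) labels u ≡ proj₁ (proj₁ (pos (cfg u)))
    is-run [] = sym (cong proj₁ start-state)
    is-run (d ∷ u) = cong (λ x → step x (marks u , Y u) (labels u) d) (is-run u)

    accepted : Accepting (λ u → marks u , Y u) labels
    accepted π = parity-cong (λ n → cong (toℕ ∘ prio) (sym (is-run (branch π n))))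
      ([ id , (λ odd → ⊥-elim (no-bad-from [] π (λ n → running (f (suc n))) (BadStep-intro [] (π 0) tt)
          (λ n → subst (λ v → BadStep v (π (suc n)) (running (f (suc n))) (running (f (suc (suc n)))) ≡ true)
             (sym (same (suc n))) (BadStep-intro (branch π (suc n)) (π (suc n)) (refl , refl)))
          (parity-suc (parity-shift 1 odd)))) ]′ (parity-total em (suc D) λ n → n , ≤-refl , toℕ<n (prio (f n))))
      where
      f : ℕ → X
      f n = proj₁ (proj₁ (pos (cfg (branch π n))))
      same : ∀ n → ext [] π n ≡ branch π n
      same zero = refl
      same (suc n) = cong (π n ∷_) (same n)

    Decreasing : (Slot → Ord) → Set
    Decreasing ls = ∀ i i' → toℕ i ≤ toℕ i' → ls i' ≤ₒ ls i

    Usable : ℕ → (Slot → Ord) → Slot × Bool → Set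
    Usable d ls c = proj₂ c ≡ true → does (room d ls (proj₁ c)) ≡ true

    below-inserted : ∀ d ls → Decreasing ls → ∀ i i' → toℕ i < toℕ i' → does (room d ls i) ≡ true → ls i' ≤ₒ insertion d ls i
    below-inserted d ls dec i i' lt r = ≤ₒ-trans (dec k i' (≤-trans (≤-reflexive k≡) lt))
        (<ₒ⇒≤ₒ (proj₁ (proj₂ (insertion-spec d ls i r)) k k≡))
      where
      k<K : suc (toℕ i) < K
      k<K = ≤-trans (s≤s lt) (toℕ<n i')
      k : Slot
      k = fromℕ< k<K
      k≡ : toℕ k ≡ suc (toℕ i)
      k≡ = toℕ-fromℕ< k<K

    candidates-decrease : ∀ d ls → Decreasing ls → ∀ c c' → Usable d ls c → Usable d ls c' → rank c ≤ rank c' →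
      candidate d ls c' ≤ₒ candidate d ls c
    candidates-decrease d ls dec (i , false) (i' , false) u u' le = dec i i' (double-≤ (m≤n⇒m≤1+n le))
    candidates-decrease d ls dec (i , false) (i' , true) u u' le =
      ≤ₒ-trans (<ₒ⇒≤ₒ (proj₁ (insertion-spec d ls i' (u' refl)))) (dec i i' (double-≤ le))
    candidates-decrease d ls dec (i , true) (i' , false) u u' le = below-inserted d ls dec i i' (double-< le) (u refl)
    candidates-decrease d ls dec (i , true) (i' , true) u u' (s≤s le) with m≤n⇒m<n∨m≡n (double-≤ (m≤n⇒m≤1+n le))
    ... | inj₁ lt = ≤ₒ-trans (<ₒ⇒≤ₒ (proj₁ (insertion-spec d ls i' (u' refl)))) (below-inserted d ls dec i i' lt (u refl))
    ... | inj₂ eq with toℕ-injective {i = i} {j = i'} eq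
    ...   | refl = ≤ₒ-refl _

    merged-room : ∀ u d i b → R.merged u d i ≡ b → does (room (length u) (lab (cfg u)) i) ≡ not b
    merged-room u d i b e = not-injective (trans (sym (merging-at (length u) (lab (cfg u)) i)) (trans e (sym (not-involutive b))))

    usable : ∀ u d j → Usable (length u) (lab (cfg u)) (R.g u d j)
    usable u d j p = merged-room u d _ false (allowed u d j p)

    decreasing : ∀ u → Decreasing (lab (cfg u))
    decreasing [] zero zero le = ≤ₒ-refl _
    decreasing [] zero (suc _) le = z≤
    decreasing [] (suc _) (suc _) le = ≤ₒ-refl _
    decreasing (d ∷ u) j j' le = candidates-decrease (length u) (lab (cfg u)) (decreasing u) _ _ (usable u d j) (usable u d j')
      (monotone u d j j' le)

    found-label : ∀ u d c → Usable (length u) (lab (cfg u)) c → ∀ j → rank (R.g u d j) ≤ rank c →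
      candidate (length u) (lab (cfg u)) c ≤ₒ lab (cfg (d ∷ u)) j
    found-label u d c us j le = candidates-decrease (length u) (lab (cfg u)) (decreasing u) _ c (usable u d j) us le

    module Ranked (Xs : Tree Bool) (ℓ : Tree Λ) (acc' : Accepting (λ u → Xs u , Y u) ℓ) (C : Tree Ord)
      (counting : ∀ v d w → Xs v ≡ true → Xs w ≡ true → (d ∷ v) ≼ w → C w <ₒ C v) where

      ρ : Tree X
      ρ = run (λ u → Xs u , Y u) ℓ

      Above : List Dir → Ord → Set
      Above u o = ∀ v → u ≼ v → Xs v ≡ true → C v <ₒ o

      Claim : Ord → Set
      Claim c = ∀ u i o → c ≤ₒ lab (cfg u) i → ρ u ∊ T (levels u) i → Above u o → c ≤ₒ o

      module Step (x : Ord) (d₀ : ℕ) (x∈ : ∀ d → d₀ ≤ d → x ∈ᴸ terms d top) (ih : Claim x)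
                  (u : List Dir) (o : Ord) (o≤x : o ≤ₒ x) (above : Above u o) where

        unmarkable : ∀ v d j → u ≼ v → Xs v ≡ true → x ≤ₒ lab (cfg (d ∷ v)) j → ρ (d ∷ v) ∊ T (levels (d ∷ v)) j → ⊥
        unmarkable v d j uv m le t = <ₒ-irrefl o (≤ₒ-trans (s≤s (≤ₒ-trans o≤x
          (ih (d ∷ v) j (C v) le t λ w vw mw → counting v d w m mw vw))) (above v uv m))

        Staying Forcing : List Dir → Set
        Staying v = u ≼ v × ∃ λ i → ρ v ∊ T (levels v) i × x <ₒ lab (cfg v) i
        Forcing v = u ≼ v × d₀ ≤ length v × ∃ λ i → ρ v ∊ A (levels v) i × x <ₒ lab (cfg v) i

        stay-on : ∀ v → Staying v → ∃ λ d → Staying (d ∷ v)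
        stay-on v (uv , i , t , lt) = d , down uv , extend (stays v d i (ρ v) (Xs v) (ℓ v) t refl)
          where
          d : Dir
          d = app finOption (Plan.stay (proj₁ (moveAt v))) (ρ v , Xs v , ℓ v)
          extend : R.Found v d T (toℕ i + toℕ i) (ρ (d ∷ v)) → ∃ λ j → ρ (d ∷ v) ∊ T (levels (d ∷ v)) j × x <ₒ lab (cfg (d ∷ v)) j
          extend (j , le , t') = j , t' , ≤ₒ-trans lt (found-label v d (i , false) (λ ()) j le)

        module _ (v : List Dir) (uv : u ≼ v) (le₀ : d₀ ≤ length v) (i : Slot) (a : ρ v ∊ A (levels v) i) (lt : x <ₒ lab (cfg v) i) where

          toward : Bool → Dir
          toward m = app finOption (Plan.attack (proj₁ (moveAt v))) (ρ v , m , ℓ v)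

          landed : Xs v ≡ true → ∀ j → x ≤ₒ lab (cfg (toward true ∷ v)) j → step (ρ v) (true , Y v) (ℓ v) (toward true) ∊ T (levels (toward true ∷ v)) j → ⊥
          landed m j le t = unmarkable v (toward true) j uv m le
            (subst (λ b → step (ρ v) (b , Y v) (ℓ v) (toward true) ∊ T (levels (toward true ∷ v)) j) (sym m) t)

          not-marked : Xs v ≡ true → ⊥
          not-marked m = by (R.merged v e i) refl
            where
            e : Dir
            e = toward true
            inserted : R.merged v e i ≡ false → R.Found v e T (suc (toℕ i + toℕ i)) (step (ρ v) (true , Y v) (ℓ v) e) → ⊥
            inserted mg (j , le , t) = landed m j
              (≤ₒ-trans (proj₂ (proj₂ (insertion-spec (length v) (lab (cfg v)) i (merged-room v e i false mg))) x (x∈ (length v) le₀) lt)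
                (found-label v e (i , true) (λ _ → merged-room v e i false mg) j le)) t
            into-next : ∀ i' → x ≤ₒ lab (cfg v) i' → R.Found v e T (toℕ i' + toℕ i') (step (ρ v) (true , Y v) (ℓ v) e) → ⊥
            into-next i' x≤ (j , le , t) = landed m j (≤ₒ-trans x≤ (found-label v e (i' , false) (λ ()) j le)) t
            next-slot : R.merged v e i ≡ true → (∃ λ i' → toℕ i' ≡ suc (toℕ i) × x ≤ₒ lab (cfg v) i') → ⊥
            next-slot mg (i' , i'≡ , x≤) = into-next i' x≤ (merges v e i i' (ρ v) (ℓ v) a refl mg i'≡)
            by : ∀ b → R.merged v e i ≡ b → ⊥
            by false mg = inserted mg (lands v e i (ρ v) (ℓ v) a refl mg)
            by true mg = next-slot mg (no-room (length v) (lab (cfg v)) i (merged-room v e i true mg) x (x∈ (length v) le₀) lt)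

          Forces : Dir → Set
          Forces d = Forcing (d ∷ v) × Forced (proj₁ (pos (cfg v))) (moveAt v) (challengeAt v d) (ρ v) (ρ (d ∷ v))

          forced : Xs v ≡ false → R.Found v (toward false) A (toℕ i + toℕ i) (step (ρ v) (false , Y v) (ℓ v) (toward false)) → Forces (toward false)
          forced m (j , le , a') = (down uv , m≤n⇒m≤1+n le₀ , j ,
              subst (λ b → step (ρ v) (b , Y v) (ℓ v) (toward false) ∊ A (levels (toward false ∷ v)) j) (sym m) a' ,
              ≤ₒ-trans lt (found-label v (toward false) (i , false) (λ ()) j le)) ,
            i , ℓ v , a , refl , cong (λ b → step (ρ v) (b , Y v) (ℓ v) (toward false)) m

          force : ∃ Forces
          force = by (Xs v) refl
            where
            by : ∀ m → Xs v ≡ m → ∃ Forces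
            by true m = ⊥-elim (not-marked m)
            by false m = toward false , forced m (attacks v (toward false) i (ρ v) (ℓ v) a refl)

        force-on : ∀ v → Forcing v → ∃ λ d → Forcing (d ∷ v) × Forced (proj₁ (pos (cfg v))) (moveAt v) (challengeAt v d) (ρ v) (ρ (d ∷ v))
        force-on v (uv , le₀ , i , a , lt) = force v uv le₀ i a lt

        reach-forcing : ∀ k v → d₀ ≤ k + length v → Staying v → ∃ Forcing
        reach-forcing zero v le (uv , i , t , lt) = v , uv , le , i , inside v L i (ρ v) t , lt
        reach-forcing (suc k) v le s with stay-on v s
        ... | d , s' = reach-forcing k (d ∷ v) (subst (d₀ ≤_) (sym (+-suc k (length v))) le) s'

        impossible : ∀ v → Forcing v → ⊥
        impossible v F = no-bad-from v ds (λ n → attacking (ρ (ext v ds (suc n)))) (BadStep-intro v (ds 0) tt)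
            (λ n → BadStep-intro (ext v ds (suc n)) (ds (suc n)) (edge (suc n)))
            (parity-cong (λ n → trans (cong (toℕ ∘ prio ∘ ρ) (trans (cong (λ z → branch (glue v ds) (suc z)) (+-comm (length v) n)) (branch-glue v ds (suc n)))) (sym (toℕ-inject₁ _)))
              (parity-shift (suc (length v)) (acc' (glue v ds))))
          where
          seq : ℕ → ∃ Forcing
          seq zero = v , F
          seq (suc n) = let (w , G) = seq n ; (d , G' , _) = force-on w G in d ∷ w , G'
          ds : ℕ → Dir
          ds n = let (w , G) = seq n in proj₁ (force-on w G)
          node : ∀ n → proj₁ (seq n) ≡ ext v ds n
          node zero = refl
          node (suc n) = cong (ds n ∷_) (node n)
          edge : ∀ n → Forced (proj₁ (pos (cfg (ext v ds n)))) (moveAt (ext v ds n)) (challengeAt (ext v ds n) (ds n)) (ρ (ext v ds n)) (ρ (ext v ds (suc n)))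
          edge n = subst (λ w → Forced (proj₁ (pos (cfg w))) (moveAt w) (challengeAt w (ds n)) (ρ w) (ρ (ds n ∷ w))) (node n)
            (let (w , G) = seq n in proj₂ (proj₂ (force-on w G)))

      -- If `o <ₒ c`, some subterm `x` satisfies `o ≤ₒ x` and `x <ₒ c`. `Stays` leads to a depth
      -- where `x` is available, and from there the attack is followed. A mark at `v` would give a
      -- claim of `x` just below it, so by induction `x ≤ₒ C v`, contradicting `C v <ₒ o`. Without
      -- marks the attack never ends, although the run accepts: a bad trace.
      claim : ∀ c → Acc _<ₒ_ c → Term top c → Claim c
      claim c (acc rs) (d , c∈) u i o c≤ t above with ≤ₒ-total em c o
      ... | inj₁ le = le
      ... | inj₂ o<c with cofinal c o<c
      ...   | x , tx , o≤x , x<c with term-trans top d (c∈ d ≤-refl) tx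
      ...     | d₀ , x∈ = ⊥-elim (let (v , F) = S.reach-forcing d₀ u (m≤m+n d₀ (length u)) (self , i , t , ≤ₒ-trans x<c c≤) in S.impossible v F)
        where
        module S = Step x d₀ x∈ (claim x (rs x<c) (d₀ , x∈)) u o o≤x above

      start∊ : x₀ ∊ T (levels []) zero
      start∊ = subst (λ s → x₀ ∊ T (proj₂ s) zero) (sym start-state) (trans (app-lam finX (λ q → does (Finite._≟_ finX q x₀)) x₀) (dec-true (Finite._≟_ finX x₀ x₀) refl))

      top≤ : ∀ η → (∀ v → Xs v ≡ true → C v <ₒ η) → top ≤ₒ η
      top≤ η b = claim top (<ₒ-acc top) (0 , λ d _ → term-self d top) [] zero η (≤ₒ-refl top) start∊ λ v _ → b v

  unbounded : W start ≡ true → ∀ α → ∃ λ (Y : Tree B) → (∃ λ (Xs : Tree Bool) → Accepts (λ u → Xs u , Y u)) ×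
    (∀ Xs → Accepts (λ u → Xs u , Y u) → ∀ C → ¬ Counts Xs α C)
  unbounded won α = Y , (marks , labels , accepted) , λ Xs (ℓ , a) C (b , c) → <ₒ-irrefl α (Ranked.top≤ Xs ℓ a C c α b)
    -- Starting from the successor makes every rank exceed `α` itself.
    where open Against won (os α)

-- Ordinals below `ω²` and the rank game.

+ₒ-mono : ∀ x {k k'} → k ≤ k' → (x +ₒ k) ≤ₒ (x +ₒ k')
+ₒ-mono x {k} {k'} le = go (≤⇒≤′ le)
  where
  go : ∀ {k'} → k ≤′ k' → (x +ₒ k) ≤ₒ (x +ₒ k')
  go ≤′-refl = ≤ₒ-refl _
  go (≤′-step le) = ≤ₒ-trans (go le) (x≤osx _)

ω·-mono : ∀ {t t'} → t ≤ t' → (ω· t) ≤ₒ (ω· t')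
ω·-mono {t} le = go (≤⇒≤′ le)
  where
  go : ∀ {t'} → t ≤′ t' → (ω· t) ≤ₒ (ω· t')
  go ≤′-refl = ≤ₒ-refl _
  go {suc t'} (≤′-step le) = ≤ₒ-trans (go le) (≤-cocone {x = ω· t'} {f = λ k → (ω· t') +ₒ k} 0 (≤ₒ-refl _))

ordinal : ℕ × ℕ → Ord
ordinal (t , k) = (ω· t) +ₒ k

Lower : Bool → ℕ × ℕ → ℕ × ℕ → Set
Lower true  (t' , k') (t , k) = t' < t ⊎ (t' ≡ t × k' < k)
Lower false (t' , k') (t , k) = t' < t ⊎ (t' ≡ t × k' ≤ k)

ordinal-jump : ∀ {t t'} k k' → t' < t → ordinal (t' , k') <ₒ ordinal (t , k)
ordinal-jump {t} {t'} k k' lt = ≤ₒ-trans (≤-cocone {x = os (ordinal (t' , k'))} {f = λ k → (ω· t') +ₒ k} (suc k') (≤ₒ-refl _)) (≤ₒ-trans (ω·-mono lt) (+ₒ-mono (ω· t) {0} {k} z≤n))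

lower-< : ∀ {β' β} → Lower true β' β → ordinal β' <ₒ ordinal β
lower-< {t' , k'} {t , k} (inj₁ lt) = ordinal-jump k k' lt
lower-< {t' , k'} {.t' , k} (inj₂ (refl , lt)) = +ₒ-mono (ω· t') lt

lower-≤ : ∀ m {β' β} → Lower m β' β → ordinal β' ≤ₒ ordinal β
lower-≤ true l = <ₒ⇒≤ₒ (lower-< l)
lower-≤ false {t' , k'} {t , k} (inj₁ lt) = <ₒ⇒≤ₒ (ordinal-jump k k' lt)
lower-≤ false {t' , k'} {.t' , k} (inj₂ (refl , le)) = +ₒ-mono (ω· t') le

lower-trans : ∀ m {β'' t' k' t k} → Lower m β'' (t' , k') → t' < t ⊎ (t' ≡ t × k' ≤ k) → Lower m β'' (t , k)
lower-trans true  (inj₁ a)          (inj₁ b)          = inj₁ (<-trans a b)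
lower-trans true  (inj₁ a)          (inj₂ (refl , _)) = inj₁ a
lower-trans true  (inj₂ (refl , _)) (inj₁ b)          = inj₁ b
lower-trans true  (inj₂ (refl , a)) (inj₂ (refl , b)) = inj₂ (refl , <-≤-trans a b)
lower-trans false (inj₁ a)          (inj₁ b)          = inj₁ (<-trans a b)
lower-trans false (inj₁ a)          (inj₂ (refl , _)) = inj₁ a
lower-trans false (inj₂ (refl , _)) (inj₁ b)          = inj₁ b
lower-trans false (inj₂ (refl , a)) (inj₂ (refl , b)) = inj₂ (refl , ≤-trans a b)

-- On a fixed Y, the automaton runs against an opponent choosing the branch while keeping an ordinal
-- ω·t+k that must decrease at marked nodes.
module RankGame {B : Set} (𝒜 : Automaton (Bool × B)) (em : Classical) (Y : Tree B) where
  open Automaton 𝒜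

  Position Option : Set
  Position = List Dir × X × ℕ × ℕ
  Option = Bool × Λ × ℕ × ℕ

  game : Rounds
  game = record { A = Position ; M = Option ; C = Dir ; legal = λ (u , q , β) (m , l , β') → Lower m β' β
    ; next = λ (u , q , β) (m , l , β') d → d ∷ u , step q (m , Y u) l d , β' ; pr = λ (u , q , β) → toℕ (prio q)
    ; codeA = λ (u , q , t , k) → prefix (toℕ (to finX q)) (prefix t (prefix k u))
    ; codeA-inj = λ {(u , q , t , k)} {(u' , q' , t' , k')} e →
        let (e₁ , e') = prefix-inj _ _ e ; (e₂ , e'') = prefix-inj t t' e' ; (e₃ , e₄) = prefix-inj k k' e''
        in cong₂ _,_ e₄ (cong₂ _,_ (to-inj finX (toℕ-injective e₁)) (cong₂ _,_ e₂ e₃))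
    ; codeM = λ (m , l , t , k) → number (prefix (toℕ (to finBool m)) (prefix (toℕ (to finΛ l)) (prefix t (prefix k []))))
    ; codeM-inj = λ {(m , l , t , k)} {(m' , l' , t' , k')} e →
        let (e₁ , e') = prefix-inj _ _ (number-inj _ _ e) ; (e₂ , e'') = prefix-inj _ _ e'
            (e₃ , e''') = prefix-inj t t' e'' ; (e₄ , _) = prefix-inj k k' e'''
        in cong₂ _,_ (to-inj finBool (toℕ-injective e₁)) (cong₂ _,_ (to-inj finΛ (toℕ-injective e₂)) (cong₂ _,_ e₃ e₄))
    ; move = λ (u , q , β) → (false , λ₀ , β) , inj₂ (refl , ≤-refl) ; answer = L }

  abstract
    solved : Solution game
    solved = SolveRounds.solution em game (suc D) (λ (u , q , β) → toℕ<n (prio q))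

  open Solution solved

  Lose : List Dir → X → ℕ → ℕ → Set
  Lose u q t k = W (u , q , t , k) ≡ false

  module Winning (N : ℕ) (won : W ([] , x₀ , N , 0) ≡ true) where

    pos : Tree Position
    pos []      = [] , x₀ , N , 0
    pos (d ∷ u) = Rounds.next game (pos u) (σ (pos u)) d

    pos-node : ∀ u → proj₁ (pos u) ≡ u
    pos-node [] = refl
    pos-node (d ∷ u) = cong (d ∷_) (pos-node u)

    β β' : List Dir → ℕ × ℕ
    β u = proj₂ (proj₂ (pos u))
    β' u = proj₂ (proj₂ (σ (pos u)))

    Xs : Tree Bool
    Xs u = proj₁ (σ (pos u))

    ℓ : Tree Λ
    ℓ u = proj₁ (proj₂ (σ (pos u)))

    pos-run : ∀ u → proj₁ (proj₂ (pos u)) ≡ run (λ u → Xs u , Y u) ℓ u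
    pos-run [] = refl
    pos-run (d ∷ u) = cong₂ (λ v x → step x (Xs u , Y v) (ℓ u) d) (pos-node u) (pos-run u)

    accepting : Accepting (λ u → Xs u , Y u) ℓ
    accepting π = parity-cong (λ n → cong (toℕ ∘ prio) (pos-run (branch π n)))
      (σ-wins (λ n → pos (branch π n)) π won λ n → refl)

    stays-won : ∀ u → W (pos u) ≡ true
    stays-won [] = won
    stays-won (d ∷ u) = σ-stay (pos u) d (stays-won u)

    lowers : ∀ u → Lower (Xs u) (β' u) (β u)
    lowers u = σ-legal (pos u) (stays-won u)

    β-decreases : ∀ {u v} → u ≼ v → ordinal (β v) ≤ₒ ordinal (β u)
    β-decreases self = ≤ₒ-refl _
    β-decreases (down {v} p) = ≤ₒ-trans (lower-≤ (Xs v) (lowers v)) (β-decreases p)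

    marked-lowers : ∀ v → Xs v ≡ true → ordinal (β' v) <ₒ ordinal (β v)
    marked-lowers v m = lower-< (subst (λ b → Lower b (β' v) (β v)) m (lowers v))

    root≼ : ∀ v → [] ≼ v
    root≼ [] = self
    root≼ (d ∷ v) = down (root≼ v)

    -- The ordinal after the move is used: before the move it equals `ω· N` at the root, which is
    -- too large for a marked root.
    counts : Counts Xs (ω· N) (ordinal ∘ β')
    counts = (λ v m → ≤ₒ-trans (marked-lowers v m) (β-decreases (root≼ v))) ,
             λ v d w mv mw p → ≤ₒ-trans (marked-lowers w mw) (β-decreases p)

  -- T t u q and A t u q say that the rank from q at u is at least ω·t, respectively ω·(t-1)+1.
  T A : ℕ → List Dir → X → Set
  T zero    u q = ⊤
  T (suc s) u q = ∀ k → Lose u q s k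
  A zero    u q = ⊤
  A (suc s) u q = Lose u q s 0

  lose-next : ∀ {u q t k} m l t' k' → Lose u q t k → Lower m (t' , k') (t , k) →
    let d = τ (u , q , t , k) (m , l , t' , k') in Lose (d ∷ u) (step q (m , Y u) l d) t' k'
  lose-next {u} {q} {t} {k} m l t' k' f le = τ-stay (u , q , t , k) (m , l , t' , k') f le

  -- Strategy stealing: a winning move at the smaller ordinal is also legal at the larger one and
  -- leads to the same positions.
  lose-mono : ∀ {u q t k t' k'} → Lose u q t k → t' < t ⊎ (t' ≡ t × k' ≤ k) → Lose u q t' k'
  lose-mono {u} {q} {t} {k} {t'} {k'} f le = by (W (u , q , t' , k')) refl
    where
    a' = (u , q , t' , k')
    a = (u , q , t , k)
    by : ∀ b → W a' ≡ b → Lose u q t' k'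
    by false e = e
    by true e = ⊥-elim (true≢false (trans (sym (σ-stay a' (τ a (σ a')) e))
      (τ-stay a (σ a') f (lower-trans (proj₁ (σ a')) (σ-legal a' e) le))))

  T-mono : ∀ {t t'} u q → t' ≤ t → T t u q → T t' u q
  T-mono {t' = zero} u q le h = tt
  T-mono {suc s} {suc s'} u q (s≤s le) h k with m≤n⇒m<n∨m≡n le
  ... | inj₁ lt = lose-mono (h k) (inj₁ lt)
  ... | inj₂ refl = h k

  A-mono : ∀ {t t'} u q → t' ≤ t → A t u q → A t' u q
  A-mono {t' = zero} u q le h = tt
  A-mono {suc s} {suc s'} u q (s≤s le) h with m≤n⇒m<n∨m≡n le
  ... | inj₁ lt = lose-mono h (inj₁ lt)
  ... | inj₂ refl = h

  T⊆A : ∀ t u q → T t u q → A t u q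
  T⊆A zero u q h = tt
  T⊆A (suc s) u q h = h 0

  A⊆T : ∀ t u q → A (suc t) u q → T t u q
  A⊆T zero u q h = tt
  A⊆T (suc s) u q h k = lose-mono h (inj₁ ≤-refl)

  -- If each direction failed at some `k`, the opponent would have no good answer at one more than
  -- the larger of the two. That spare unit pays for a possible mark.
  stay : ∀ t u q m l → T t u q → ∃ λ d → T t (d ∷ u) (step q (m , Y u) l d)
  stay zero u q m l h = L , tt
  stay (suc s) u q m l h = dne em λ none → by none (¬∀→∃¬ em λ hL → none (L , hL)) (¬∀→∃¬ em λ hR → none (R , hR))
    where
    child : Dir → X
    child d = step q (m , Y u) l d
    by : ¬ (∃ λ d → T (suc s) (d ∷ u) (child d)) → (∃ λ k → ¬ Lose (L ∷ u) (child L) s k) →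
         (∃ λ k → ¬ Lose (R ∷ u) (child R) s k) → ⊥
    by none (kL , nL) (kR , nR) = side (τ (u , q , s , suc (kL ⊔ kR)) (m , l , s , kL ⊔ kR)) (lose-next m l s (kL ⊔ kR) (h (suc (kL ⊔ kR))) (legal m))
      where
      legal : ∀ m → Lower m (s , kL ⊔ kR) (s , suc (kL ⊔ kR))
      legal true = inj₂ (refl , ≤-refl)
      legal false = inj₂ (refl , n≤1+n _)
      side : ∀ d → Lose (d ∷ u) (child d) s (kL ⊔ kR) → ⊥
      side L f = nL (lose-mono f (inj₂ (refl , m≤m⊔n kL kR)))
      side R f = nR (lose-mono f (inj₂ (refl , m≤n⊔m kL kR)))

  attackDir : ℕ → List Dir → X → Λ → Dir
  attackDir zero    u q l = L
  attackDir (suc s) u q l = τ (u , q , s , 0) (false , l , s , 0)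

  attack : ∀ t u q l → A t u q → A t (attackDir t u q l ∷ u) (step q (false , Y u) l (attackDir t u q l))
  attack zero u q l h = tt
  attack (suc s) u q l h = lose-next false l s 0 h (inj₂ (refl , ≤-refl))

  -- At a mark the ordinal `ω·(s + 1)` may drop to `ω·s + k` for any `k`, so one direction must lose
  -- for all `k`.
  land : ∀ t u q l → A t u q → ∃ λ d → T (t ∸ 1) (d ∷ u) (step q (true , Y u) l d)
  land zero u q l h = L , tt
  land (suc zero) u q l h = L , tt
  land (suc (suc s)) u q l h = dne em λ none → by (¬∀→∃¬ em λ hL → none (L , hL)) (¬∀→∃¬ em λ hR → none (R , hR))
    where
    child : Dir → X
    child d = step q (true , Y u) l d
    by : (∃ λ k → ¬ Lose (L ∷ u) (child L) s k) → (∃ λ k → ¬ Lose (R ∷ u) (child R) s k) → ⊥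
    by (kL , nL) (kR , nR) = side (τ (u , q , suc s , 0) (true , l , s , kL ⊔ kR)) (lose-next true l s (kL ⊔ kR) h (inj₁ ≤-refl))
      where
      side : ∀ d → Lose (d ∷ u) (child d) s (kL ⊔ kR) → ⊥
      side L f = nL (lose-mono f (inj₂ (refl , m≤m⊔n kL kR)))
      side R f = nR (lose-mono f (inj₂ (refl , m≤n⊔m kL kR)))

  -- Unmarked moves may keep the ordinal `ω·s` unchanged, so this is a play against `τ`.
  attack-rejects : ∀ s (us : ℕ → List Dir) (qs : ℕ → X) (ls : ℕ → Λ) → A (suc s) (us 0) (qs 0) →
    (∀ n → us (suc n) ≡ attackDir (suc s) (us n) (qs n) (ls n) ∷ us n) →
    (∀ n → qs (suc n) ≡ step (qs n) (false , Y (us n)) (ls n) (attackDir (suc s) (us n) (qs n) (ls n))) →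
    Parity false (λ n → toℕ (prio (qs n)))
  attack-rejects s us qs ls h eu eq = τ-wins (λ n → us n , qs n , s , 0) (λ n → false , ls n , s , 0) h
    (λ n → inj₂ (refl , ≤-refl)) λ n → cong₂ (λ u q → u , q , s , 0) (eu n) (eq n)

-- Sizes of finite sets.

count : ∀ {n} → (Fin n → Bool) → ℕ
count {zero}  p = 0
count {suc n} p = (if p zero then 1 else 0) + count (p ∘ suc)

count-bound : ∀ {n} (p : Fin n → Bool) → count p ≤ n
count-bound {zero} p = z≤n
count-bound {suc n} p with p zero
... | true = s≤s (count-bound (p ∘ suc))
... | false = m≤n⇒m≤1+n (count-bound (p ∘ suc))

count-mono : ∀ {n} (p q : Fin n → Bool) → (∀ i → p i ≡ true → q i ≡ true) → count p ≤ count q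
count-mono {zero} p q h = z≤n
count-mono {suc n} p q h with p zero | q zero | h zero
... | true  | true  | _ = s≤s (count-mono (p ∘ suc) (q ∘ suc) (h ∘ suc))
... | true  | false | f = case f refl of λ ()
... | false | true  | _ = m≤n⇒m≤1+n (count-mono (p ∘ suc) (q ∘ suc) (h ∘ suc))
... | false | false | _ = count-mono (p ∘ suc) (q ∘ suc) (h ∘ suc)

count-equal : ∀ {n} (p q : Fin n → Bool) → (∀ i → p i ≡ true → q i ≡ true) → count q ≤ count p → ∀ i → q i ≡ true → p i ≡ true
count-equal {suc n} p q h le i e with p zero in ep | q zero in eq | h zero
count-equal {suc n} p q h le zero e | true | _ | _ = ep
count-equal {suc n} p q h (s≤s le) (suc i) e | true | true | _ = count-equal (p ∘ suc) (q ∘ suc) (h ∘ suc) le i e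
count-equal {suc n} p q h le (suc i) e | true | false | f = case f refl of λ ()
count-equal {suc n} p q h le i e | false | true | _ = ⊥-elim (<-irrefl refl (≤-trans le (count-mono (p ∘ suc) (q ∘ suc) (h ∘ suc))))
count-equal {suc n} p q h le zero e | false | false | _ = case trans (sym eq) e of λ ()
count-equal {suc n} p q h le (suc i) e | false | false | _ = count-equal (p ∘ suc) (q ∘ suc) (h ∘ suc) le i e

-- Playing the claim game with the true ranks on a fixed `Y`.

module Bounded {B : Set} (finB : Finite B) (b₀ : B) (𝒜 : Automaton (Bool × B)) (em : Classical) where
  open Automaton 𝒜
  open ClaimGame finB b₀ 𝒜
  open Solution (solution em)

  abstract
    pickDir : (Dir → Set) → Dir
    pickDir P with em {∃ P}
    ... | yes (d , _) = d
    ... | no _        = L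

    pickDir-spec : ∀ (P : Dir → Set) → ∃ P → P (pickDir P)
    pickDir-spec P x with em {∃ P}
    ... | yes (d , p) = p
    ... | no n        = ⊥-elim (n x)

  holds : Set → Bool
  holds P = does (em {P})

  holds-in : ∀ {P} → P → holds P ≡ true
  holds-in {P} = dec-true (em {P})

  holds-out : ∀ P → holds P ≡ true → P
  holds-out P e with em {P}
  ... | yes p = p

  rank-bound : ∀ {i i' : Slot} → toℕ i ≤ toℕ i' → rank (i , false) ≤ rank (i' , false)
  rank-bound le = +-mono-≤ le le

  nextSlot : ∀ (i i' : Slot) → toℕ i < toℕ i' → ∃ λ k → toℕ k ≡ suc (toℕ i)
  nextSlot i i' lt = fromℕ< (≤-trans (s≤s lt) (toℕ<n i')) , toℕ-fromℕ< (≤-trans (s≤s lt) (toℕ<n i'))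

  DecreasingVal : (Slot → ℕ) → Set
  DecreasingVal t = ∀ i i' → toℕ i ≤ toℕ i' → t i' ≤ t i

  module OnTree (Y : Tree B) where
    module G = RankGame 𝒜 em Y

    -- The choice of K slots among the 2K candidates after a step to w: the μ-values of the candidates measure
    -- the increasing chain of claim sets at w, and one candidate is kept for every value.
    module Select (t : Slot → ℕ) (J : Slot → Bool) (w : List Dir) where

      Cand : Set
      Cand = Slot × Bool

      val : Cand → ℕ
      val (i , false) = t i
      val (i , true)  = t i ∸ 1

      -- An inserted slot carries one unit less than `t i`; the strict drop ensures that it does not
      -- fall below slot `i + 1`.
      Usable : Cand → Set
      Usable (i , b) = b ≡ true → J i ≡ false × (∀ i' → toℕ i' ≡ suc (toℕ i) → t i' < t i)

      TB AB : ℕ → Fin n → Bool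
      TB s i = holds (G.T s w (from finX i))
      AB s i = holds (G.A s w (from finX i))

      μ : Cand → ℕ
      μ c = count (TB (val c)) + count (AB (val c))

      μ-bound : ∀ c → μ c ≤ n + n
      μ-bound c = +-mono-≤ (count-bound (TB (val c))) (count-bound (AB (val c)))

      TB-mono : ∀ {s s'} → s' ≤ s → ∀ i → TB s i ≡ true → TB s' i ≡ true
      TB-mono le i e = holds-in (G.T-mono w (from finX i) le (holds-out _ e))

      AB-mono : ∀ {s s'} → s' ≤ s → ∀ i → AB s i ≡ true → AB s' i ≡ true
      AB-mono le i e = holds-in (G.A-mono w (from finX i) le (holds-out _ e))

      μ-mono : ∀ c c' → val c' ≤ val c → μ c ≤ μ c'
      μ-mono c c' le = +-mono-≤ (count-mono (TB (val c)) (TB (val c')) (TB-mono le)) (count-mono (AB (val c)) (AB (val c')) (AB-mono le))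

      sum-tight : ∀ {a b a' b'} → a ≤ a' → b ≤ b' → a' + b' ≤ a + b → a' ≤ a × b' ≤ b
      sum-tight {a} {b} {a'} {b'} la lb le = +-cancelʳ-≤ b a' a (≤-trans (+-monoʳ-≤ a' lb) le) , +-cancelˡ-≤ a b' b (≤-trans (+-monoˡ-≤ b' la) le)

      -- Both sets can only grow as the value drops, so an equal total size forces equality of each.
      same-sets : ∀ c c' → val c' ≤ val c → μ c' ≤ μ c → ∀ q → (G.T (val c') w q → G.T (val c) w q) × (G.A (val c') w q → G.A (val c) w q)
      same-sets c c' le eq q = (λ h → subst (G.T (val c) w) (from-to finX q) (holds-out _
            (count-equal (TB (val c)) (TB (val c')) (TB-mono le) (proj₁ parts) (to finX q) (holds-in (subst (G.T (val c') w) (sym (from-to finX q)) h))))) ,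
          λ h → subst (G.A (val c) w) (from-to finX q) (holds-out _
            (count-equal (AB (val c)) (AB (val c')) (AB-mono le) (proj₂ parts) (to finX q) (holds-in (subst (G.A (val c') w) (sym (from-to finX q)) h))))
        where
        parts = sum-tight (count-mono (TB (val c)) (TB (val c')) (TB-mono le)) (count-mono (AB (val c)) (AB (val c')) (AB-mono le)) eq

      abstract
        largest : ∃ λ M → (∃ λ c → Usable c × μ c ≡ M) × (∀ c → Usable c → μ c ≤ M)
        largest with least em {λ m → ∃ λ c → Usable c × (n + n) ∸ μ c ≡ m} (_ , (zero , false) , (λ ()) , refl)
        ... | m , (c , us , e) , mn = μ c , (c , us , refl) , λ c' us' → ≮⇒≥ λ lt →
              mn ((n + n) ∸ μ c') (subst ((n + n) ∸ μ c' <_) e (∸-monoʳ-< lt (μ-bound c'))) (c' , us' , refl)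

      M : ℕ
      M = proj₁ largest

      M≤ : M ≤ n + n
      M≤ = by (proj₁ (proj₂ largest))
        where
        by : (∃ λ c → Usable c × μ c ≡ M) → M ≤ n + n
        by (c , _ , e) = subst (_≤ n + n) e (μ-bound c)

      Chosen : Slot → Cand → Set
      Chosen j c = Usable c × toℕ j ⊓ M ≤ μ c × (∀ c' → Usable c' → toℕ j ⊓ M ≤ μ c' → rank c ≤ rank c')

      abstract
        choice : ∀ j → ∃ (Chosen j)
        choice j with proj₁ (proj₂ largest)
        ... | c₁ , us₁ , e₁ with least em {λ r → ∃ λ c → Usable c × rank c ≡ r × toℕ j ⊓ M ≤ μ c}
                (_ , c₁ , us₁ , refl , ≤-trans (m⊓n≤n (toℕ j) M) (≤-reflexive (sym e₁)))
        ...   | r , (c , us , refl , le) , mn = c , us , le , λ c' us' le' → ≮⇒≥ λ lt → mn (rank c') lt (c' , us' , refl , le')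

      g : Slot → Cand
      g j = proj₁ (choice j)

      g-usable : ∀ j → Usable (g j)
      g-usable j = proj₁ (proj₂ (choice j))

      g-μ : ∀ j → toℕ j ⊓ M ≤ μ (g j)
      g-μ j = proj₁ (proj₂ (proj₂ (choice j)))

      g-least : ∀ j c → Usable c → toℕ j ⊓ M ≤ μ c → rank (g j) ≤ rank c
      g-least j = proj₂ (proj₂ (proj₂ (choice j)))

      g-mono : ∀ j j' → toℕ j ≤ toℕ j' → rank (g j) ≤ rank (g j')
      g-mono j j' le = g-least j (g j') (g-usable j') (≤-trans (⊓-monoˡ-≤ M le) (g-μ j'))

      -- Repetitive slots are left empty. The size `M` is represented by the last slot, which has no
      -- successor; below `M`, the next slot has larger sets and hence a strictly smaller value.
      Effective : Slot → Set
      Effective j = toℕ j ≡ n + n ⊎ (toℕ j < M × μ (g j) ≡ toℕ j)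

      setT setA : Slot → Sub
      setT j = lam finX λ q → holds (Effective j × G.T (val (g j)) w q)
      setA j = lam finX λ q → holds (Effective j × G.A (val (g j)) w q)

      setT-out : ∀ j q → q ∊ setT j → Effective j × G.T (val (g j)) w q
      setT-out j q e = holds-out _ (trans (sym (app-lam finX (λ q → holds (Effective j × G.T (val (g j)) w q)) q)) e)

      setA-out : ∀ j q → q ∊ setA j → Effective j × G.A (val (g j)) w q
      setA-out j q e = holds-out _ (trans (sym (app-lam finX (λ q → holds (Effective j × G.A (val (g j)) w q)) q)) e)

      setT-in : ∀ j q → Effective j → G.T (val (g j)) w q → q ∊ setT j
      setT-in j q e h = trans (app-lam finX (λ q → holds (Effective j × G.T (val (g j)) w q)) q) (holds-in (e , h))

      setA-in : ∀ j q → Effective j → G.A (val (g j)) w q → q ∊ setA j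
      setA-in j q e h = trans (app-lam finX (λ q → holds (Effective j × G.A (val (g j)) w q)) q) (holds-in (e , h))

      module _ (dec : DecreasingVal t) where

        val-mono : ∀ c c' → Usable c → rank c ≤ rank c' → val c' ≤ val c
        val-mono (i , false) (i' , false) us le = dec i i' (double-≤ (m≤n⇒m≤1+n le))
        val-mono (i , false) (i' , true) us le = ≤-trans (m∸n≤m (t i') 1) (dec i i' (double-≤ le))
        val-mono (i , true) (i' , b) us le with m≤n⇒m<n∨m≡n (lower b le)
          where
          lower : ∀ b → suc (toℕ i + toℕ i) ≤ rank (i' , b) → toℕ i ≤ toℕ i'
          lower false le = <⇒≤ (double-< le)
          lower true (s≤s le) = double-≤ (m≤n⇒m≤1+n le)
        ... | inj₁ lt = ≤-trans (drop b) (∸-monoˡ-≤ 1 strict)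
          where
          k = proj₁ (nextSlot i i' lt)
          k≡ = proj₂ (nextSlot i i' lt)
          strict : suc (t i') ≤ t i
          strict = ≤-trans (s≤s (dec k i' (≤-trans (≤-reflexive k≡) lt))) (proj₂ (us refl) k k≡)
          drop : ∀ b → val (i' , b) ≤ t i'
          drop false = ≤-refl
          drop true = m∸n≤m (t i') 1
        val-mono (i , true) (i' , true) us le | inj₂ eq with toℕ-injective {i = i} {j = i'} eq
        ... | refl = ≤-refl
        val-mono (i , true) (i' , false) us le | inj₂ eq = ⊥-elim (<-irrefl eq (double-< le))

        represented : ∀ c → Usable c → ∃ λ j → rank (g j) ≤ rank c × Effective j × val c ≤ val (g j) × μ c ≤ μ (g j)
        represented c us = by (m≤n⇒m<n∨m≡n (proj₂ (proj₂ largest) c us))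
          where
          finish : ∀ j → rank (g j) ≤ rank c → Effective j → μ c ≤ μ (g j) →
            ∃ λ j → rank (g j) ≤ rank c × Effective j × val c ≤ val (g j) × μ c ≤ μ (g j)
          finish j r ef le = j , r , ef , val-mono (g j) c (g-usable j) r , le
          by : μ c < M ⊎ μ c ≡ M → ∃ λ j → rank (g j) ≤ rank c × Effective j × val c ≤ val (g j) × μ c ≤ μ (g j)
          by (inj₁ lt) = finish j r (inj₂ (subst (_< M) (sym j≡) lt , trans (≤-antisym (μ-mono (g j) c (val-mono (g j) c (g-usable j) r)) up) (sym j≡))) up
            where
            j<K : μ c < K
            j<K = s≤s (μ-bound c)
            j : Slot
            j = fromℕ< j<K
            j≡ : toℕ j ≡ μ c
            j≡ = toℕ-fromℕ< j<K
            meet : toℕ j ⊓ M ≡ μ c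
            meet = trans (cong (_⊓ M) j≡) (m≤n⇒m⊓n≡m (<⇒≤ lt))
            r : rank (g j) ≤ rank c
            r = g-least j c us (≤-reflexive meet)
            up : μ c ≤ μ (g j)
            up = ≤-trans (≤-reflexive (sym meet)) (g-μ j)
          by (inj₂ eq) = finish j (g-least j c us (≤-reflexive (trans meet (sym eq)))) (inj₁ j≡) (≤-trans (≤-reflexive (trans eq (sym meet))) (g-μ j))
            where
            j : Slot
            j = fromℕ (n + n)
            j≡ : toℕ j ≡ n + n
            j≡ = toℕ-fromℕ (n + n)
            meet : toℕ j ⊓ M ≡ M
            meet = m≥n⇒m⊓n≡n (subst (M ≤_) (sym j≡) M≤)

        represented-T : ∀ c → Usable c → ∀ q → G.T (val c) w q → ∃ λ j → rank (g j) ≤ rank c × q ∊ setT j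
        represented-T c us q h with represented c us
        ... | j , r , ef , le , m = j , r , setT-in j q ef (proj₁ (same-sets (g j) c le m q) h)

        represented-A : ∀ c → Usable c → ∀ q → G.A (val c) w q → ∃ λ j → rank (g j) ≤ rank c × q ∊ setA j
        represented-A c us q h with represented c us
        ... | j , r , ef , le , m = j , r , setA-in j q ef (proj₂ (same-sets (g j) c le m q) h)

        effective-strict : ∀ j j' → Effective j → toℕ j' ≡ suc (toℕ j) → val (g j') < val (g j)
        effective-strict j j' (inj₁ e) e' = ⊥-elim (<-irrefl (trans e' (cong suc e)) (toℕ<n j'))
        effective-strict j j' (inj₂ (lt , m)) e' = ≤∧≢⇒< (val-mono (g j) (g j') (g-usable j) (g-mono j j' (≤-trans (n≤1+n _) (≤-reflexive (sym e'))))) λ eq →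
          <-irrefl refl (≤-trans (subst₂ _≤_ (trans (cong (_⊓ M) e') (m≤n⇒m⊓n≡m lt)) refl (g-μ j')) (≤-trans (μ-mono (g j') (g j) (≤-reflexive (sym eq))) (≤-reflexive m)))

    module Simulate (Xs₀ : Tree Bool) (ℓ₀ : Tree Λ) where

      record Config : Set where
        constructor config
        field
          node : List Dir
          pos  : Pos
          value : Slot → ℕ

        levels : Levels
        levels = proj₂ (proj₁ pos)

      module At (c : Config) where
        open Config c

        -- The plan acts on the strongest claim about `q`, that of the least slot; weaker ones
        -- follow by monotonicity.
        Least : (Levels → Slot → Sub) → X → Slot → Set
        Least S q i = q ∊ S levels i × (∀ i' → toℕ i' < toℕ i → ¬ q ∊ S levels i')

        StaySpec AttackSpec : X → Bool → Λ → Dir → Set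
        StaySpec q m l d = ∀ i → Least T q i → G.T (value i) (d ∷ node) (step q (m , Y node) l d)
        AttackSpec q m l d = ∀ i → Least A q i → (m ≡ false → d ≡ G.attackDir (value i) node q l) ×
                                                 (m ≡ true → G.T (value i ∸ 1) (d ∷ node) (step q (true , Y node) l d))

        stayOf attackOf : X × Bool × Λ → Dir
        stayOf (q , m , l) = pickDir (StaySpec q m l)
        attackOf (q , m , l) = pickDir (AttackSpec q m l)

        thePlan : Plan
        thePlan = plan (Y node) (Xs₀ node) (ℓ₀ node) (lam finOption stayOf) (lam finOption attackOf)

        module S (ch : Challenge) = Select value (lookup (proj₂ ch)) (proj₁ ch ∷ node)

        response : Challenge → Response
        response ch = tabulate (S.g ch) , tabulate λ j → S.setT ch j , S.setA ch j

        theMove : Move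
        theMove = thePlan , lam finChallenge response

        challenge : Challenge
        challenge = τ pos theMove

        after : Config
        after = config (proj₁ challenge ∷ node) (next pos theMove challenge) (λ j → S.val challenge (S.g challenge j))

        record Inv : Set where
          field
            decreasing : DecreasingVal value
            soundT     : ∀ i q → q ∊ T levels i → G.T (value i) node q
            soundA     : ∀ i q → q ∊ A levels i → G.A (value i) node q
            inside     : ∀ i q → q ∊ T levels i → q ∊ A levels i
            -- Demanded only of slots carrying claims: it makes an insertion there usable and a
            -- merge into the next slot sound.
            strict     : ∀ i q → q ∊ A levels i → ∀ i' → toℕ i' ≡ suc (toℕ i) → value i' < value i
            on-run     : proj₁ (proj₁ pos) ≡ run (λ u → Xs₀ u , Y u) ℓ₀ node
            capped     : ∀ i → value i ≤ bound

        least-slot : ∀ S q i → q ∊ S levels i → ∃ λ i★ → Least S q i★ × toℕ i★ ≤ toℕ i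
        least-slot S q i h = by (least em {λ k → ∃ λ j → toℕ j ≡ k × q ∊ S levels j} (toℕ i , i , refl , h))
          where
          by : (∃ λ k → (∃ λ j → toℕ j ≡ k × q ∊ S levels j) × (∀ m → m < k → ¬ ∃ λ j → toℕ j ≡ m × q ∊ S levels j)) →
            ∃ λ i★ → Least S q i★ × toℕ i★ ≤ toℕ i
          by (_ , (j , refl , hj) , mn) = j , (hj , λ i' lt h' → mn (toℕ i') lt (i' , refl , h')) , ≮⇒≥ λ lt → mn (toℕ i) lt (i , refl , h)

        least-unique : ∀ S q i j → Least S q i → Least S q j → i ≡ j
        least-unique S q i j (h , m) (h' , m') = toℕ-injective (≤-antisym (≮⇒≥ λ lt → m j lt h') (≮⇒≥ λ lt → m' i lt h))

        module _ (I : Inv) where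
          open Inv I

          stay-spec : ∀ q m l → ∃ (StaySpec q m l)
          stay-spec q m l = by em
            where
            by : Dec (∃ λ i → Least T q i) → ∃ (StaySpec q m l)
            by (no none) = L , λ i h → ⊥-elim (none (i , h))
            by (yes (i , h)) = let (d , x) = G.stay (value i) node q m l (soundT i q (proj₁ h)) in
              d , λ j h' → subst (λ i → G.T (value i) (d ∷ node) (step q (m , Y node) l d)) (least-unique T q i j h h') x

          attack-spec : ∀ q m l → ∃ (AttackSpec q m l)
          attack-spec q m l = by m em
            where
            by : ∀ m → Dec (∃ λ i → Least A q i) → ∃ (AttackSpec q m l)
            by m (no none) = L , λ i h → ⊥-elim (none (i , h))
            by false (yes (i , h)) = G.attackDir (value i) node q l , λ j h' →
              (λ _ → cong (λ i → G.attackDir (value i) node q l) (least-unique A q i j h h')) , λ ()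
            by true (yes (i , h)) = let (d , x) = G.land (value i) node q l (soundA i q (proj₁ h)) in
              d , λ j h' → (λ ()) , λ _ → subst (λ i → G.T (value i ∸ 1) (d ∷ node) (step q (true , Y node) l d)) (least-unique A q i j h h') x

          stays-at : ∀ {q m l d} → app finOption (lam finOption stayOf) (q , m , l) ≡ d → StaySpec q m l d
          stays-at {q} {m} {l} e = subst (StaySpec q m l) (trans (sym (app-lam finOption stayOf (q , m , l))) e) (pickDir-spec (StaySpec q m l) (stay-spec q m l))

          attacks-at : ∀ {q m l d} → app finOption (lam finOption attackOf) (q , m , l) ≡ d → AttackSpec q m l d
          attacks-at {q} {m} {l} e = subst (AttackSpec q m l) (trans (sym (app-lam finOption attackOf (q , m , l))) e) (pickDir-spec (AttackSpec q m l) (attack-spec q m l))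

          module _ (ch : Challenge) where
            module Sc = Select value (lookup (proj₂ ch)) (proj₁ ch ∷ node)
            module Rs = Rules levels thePlan ch (response ch)

            g≡ : ∀ j → Rs.g j ≡ Sc.g j
            g≡ j = lookup∘tabulate Sc.g j

            T≡ : ∀ j → T Rs.ls' j ≡ Sc.setT j
            T≡ j = cong proj₁ (lookup∘tabulate (λ j → Sc.setT j , Sc.setA j) j)

            A≡ : ∀ j → A Rs.ls' j ≡ Sc.setA j
            A≡ j = cong proj₂ (lookup∘tabulate (λ j → Sc.setT j , Sc.setA j) j)

            foundT : ∀ c → Sc.Usable c → ∀ {k q} → rank c ≤ k → G.T (Sc.val c) (proj₁ ch ∷ node) q → Rs.Found T k q
            foundT c us {k} {q} le h = let (j , r , x) = Sc.represented-T decreasing c us q h in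
              j , ≤-trans (≤-reflexive (cong rank (g≡ j))) (≤-trans r le) , subst (q ∊_) (sym (T≡ j)) x

            foundA : ∀ c → Sc.Usable c → ∀ {k q} → rank c ≤ k → G.A (Sc.val c) (proj₁ ch ∷ node) q → Rs.Found A k q
            foundA c us {k} {q} le h = let (j , r , x) = Sc.represented-A decreasing c us q h in
              j , ≤-trans (≤-reflexive (cong rank (g≡ j))) (≤-trans r le) , subst (q ∊_) (sym (A≡ j)) x

            -- A forced mark yields a claim with one unit less. An inserted slot takes it as it is;
            -- after a merge it is weakened to the next slot, whose value is no larger by
            -- strictness.
            landing : ∀ i★ q l k → Least A q i★ → app finOption (lam finOption attackOf) (q , true , l) ≡ proj₁ ch →
              (Rs.merged i★ ≡ false → rank (i★ , true) ≤ k) →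
              (Rs.merged i★ ≡ true → ∃ λ i' → toℕ i' ≡ suc (toℕ i★) × rank (i' , false) ≤ k) →
              Rs.Found T k (step q (true , Y node) l (proj₁ ch))
            landing i★ q l k h e f t = by (Rs.merged i★) refl
              where
              fact : G.T (value i★ ∸ 1) (proj₁ ch ∷ node) (step q (true , Y node) l (proj₁ ch))
              fact = proj₂ (attacks-at e i★ h) refl
              by : ∀ b → Rs.merged i★ ≡ b → Rs.Found T k (step q (true , Y node) l (proj₁ ch))
              by false m = foundT (i★ , true) (λ _ → m , strict i★ q (proj₁ h)) (f m) fact
              by true m = let (i' , e' , r) = t m in foundT (i' , false) (λ ()) r
                (G.T-mono _ _ (∸-monoˡ-≤ 1 (strict i★ q (proj₁ h) i' e')) fact)

            valid-response : Rs.Valid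
            valid-response = inside ,
              (λ j j' le → subst₂ _≤_ (cong rank (sym (g≡ j))) (cong rank (sym (g≡ j'))) (Sc.g-mono j j' le)) ,
              (λ j e → subst (λ c → Rs.merged (proj₁ c) ≡ false) (sym (g≡ j)) (proj₁ (Sc.g-usable j (trans (cong proj₂ (sym (g≡ j))) e)))) ,
              (λ i q m l h e → let (i★ , ls , le) = least-slot T q i h in
                 foundT (i★ , false) (λ ()) (rank-bound le) (stays-at e i★ ls)) ,
              (λ i q l h e → let (i★ , ls , le) = least-slot A q i h in
                 foundA (i★ , false) (λ ()) (rank-bound le)
                   (subst (λ d → G.A (value i★) (d ∷ node) (step q (false , Y node) l d)) (sym (proj₁ (attacks-at e i★ ls) refl))
                     (G.attack (value i★) node q l (soundA i★ q (proj₁ ls))))) ,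
              (λ i q l h e m → let (i★ , ls , le) = least-slot A q i h in
                 landing i★ q l _ ls e (λ _ → s≤s (rank-bound le)) (λ m' → below i i★ m m' le)) ,
              λ i i' q l h e m e' → let (i★ , ls , le) = least-slot A q i h in
                 landing i★ q l _ ls e (λ _ → ≤-trans (s≤s (+-mono-≤ le (≤-trans le (n≤1+n _)))) (≤-reflexive (sym (cong₂ _+_ e' e'))))
                   (λ m' → let (k , k≡) = slot-after i i' i★ e' le in k , k≡ , rank-bound (≤-trans (≤-reflexive k≡) (≤-trans (s≤s le) (≤-reflexive (sym e')))))
              where
              slot-after : ∀ (i i' i★ : Slot) → toℕ i' ≡ suc (toℕ i) → toℕ i★ ≤ toℕ i → ∃ λ k → toℕ k ≡ suc (toℕ i★)
              slot-after i i' i★ e' le = nextSlot i★ i' (≤-trans (s≤s le) (≤-reflexive (sym e')))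
              -- Only one of the two slots is merged, so they differ and the slot after `i★` comes
              -- no later than `i`.
              below : ∀ i i★ → Rs.merged i ≡ false → Rs.merged i★ ≡ true → toℕ i★ ≤ toℕ i →
                ∃ λ i' → toℕ i' ≡ suc (toℕ i★) × rank (i' , false) ≤ suc (toℕ i + toℕ i)
              below i i★ m m' le with m≤n⇒m<n∨m≡n le
              ... | inj₁ lt = let (k , k≡) = nextSlot i★ i lt in k , k≡ , m≤n⇒m≤1+n (rank-bound {k} {i} (≤-trans (≤-reflexive k≡) lt))
              ... | inj₂ eq with toℕ-injective {i = i★} {j = i} eq
              ...   | refl = ⊥-elim (true≢false (trans (sym m') m))

            valid-move : Rules.Valid levels thePlan ch (app finChallenge (lam finChallenge response) ch)
            valid-move = subst (Rules.Valid levels thePlan ch) (sym (app-lam finChallenge response ch)) valid-response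

      start-config : Config
      -- Staggered values give the strict drop at the start; truncation does no harm because
      -- `K ≤ bound`.
      start-config = config [] start (λ i → bound ∸ toℕ i)

      cfg : ℕ → Config
      cfg zero    = start-config
      cfg (suc m) = At.after (cfg m)

parity-pred : ∀ {b c} → Parity b (suc ∘ c) → Parity (not b) c
parity-pred (zero , e , i , _) with i 0
... | _ , _ , ()
parity-pred {b} (suc p , e , i , k , lo) = p , trans (sym (not-involutive (even p))) (cong not e) ,
  inf-map (λ m x → cong (_∸ 1) x) i , k , λ m le → ≤-pred (lo m le)

-- A winning opponent bounds the rank.

module Refute {B : Set} (finB : Finite B) (b₀ : B) (𝒜 : Automaton (Bool × B)) (em : Classical) where
  open Automaton 𝒜
  open ClaimGame finB b₀ 𝒜
  open Solution (solution em)
  open Bounded finB b₀ 𝒜 em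

  module Against (lost : W start ≡ false) (Y : Tree B) (Xs₀ : Tree Bool) (ℓ₀ : Tree Λ)
    (accepting₀ : Accepting (λ u → Xs₀ u , Y u) ℓ₀) (lost-rank : RankGame.Lose 𝒜 em Y [] x₀ bound 0) where
    open OnTree Y
    open Simulate Xs₀ ℓ₀

    start∊ : ∀ (S : Levels → Slot → Sub) → (∀ i → S startLevels (suc i) ≡ none) → S startLevels zero ≡ just-x₀ →
      ∀ i q → q ∊ S (Config.levels start-config) i → i ≡ zero × q ≡ x₀
    start∊ S hn hj i q h = by i (subst (λ s → q ∊ S (proj₂ s) i) start-state h)
      where
      by : ∀ i → q ∊ S startLevels i → i ≡ zero × q ≡ x₀
      by zero h = refl , dec→ (Finite._≟_ finX q x₀) (trans (sym (app-lam finX (λ q → does (Finite._≟_ finX q x₀)) q)) (subst (q ∊_) hj h))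
      by (suc i) h = ⊥-elim (true≢false (trans (sym (subst (q ∊_) (hn i) h)) (app-lam finX (λ _ → false) q)))

    startT : ∀ i q → q ∊ T (Config.levels start-config) i → i ≡ zero × q ≡ x₀
    startT = start∊ T (λ i → cong proj₁ (lookup-replicate i (none , none))) refl

    startA : ∀ i q → q ∊ A (Config.levels start-config) i → i ≡ zero × q ≡ x₀
    startA = start∊ A (λ i → cong proj₂ (lookup-replicate i (none , none))) refl

    top-T : G.T bound [] x₀
    top-T = G.A⊆T bound [] x₀ lost-rank

    K≤bound : K ≤ bound
    K≤bound = m≤n+m K (suc (size (fin× finPos finLevelState)))

    inv-start : At.Inv start-config
    inv-start = record
      { decreasing = λ i i' le → ∸-monoʳ-≤ bound le
      ; soundT = λ i q h → sound i q (startT i q h)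
      ; soundA = λ i q h → let (e , e') = startA i q h in G.T⊆A _ [] q (sound i q (e , e'))
      ; inside = λ i q h → inside' i q h (startT i q h)
      ; strict = λ i q h i' e → ∸-monoʳ-< (≤-reflexive (sym e)) (≤-trans (<⇒≤ (toℕ<n i')) K≤bound)
      ; on-run = cong proj₁ start-state
      ; capped = λ i → m∸n≤m bound (toℕ i) }
      where
      sound : ∀ i q → i ≡ zero × q ≡ x₀ → G.T (bound ∸ toℕ i) [] q
      sound .zero q (refl , refl) = top-T
      inside' : ∀ i q → q ∊ T (Config.levels start-config) i → i ≡ zero × q ≡ x₀ → q ∊ A (Config.levels start-config) i
      inside' .zero q h (refl , e) = subst (λ s → q ∊ A (proj₂ s) zero) (sym start-state) (subst (λ s → q ∊ T (proj₂ s) zero) start-state h)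

    module After (c : Config) (I : At.Inv c) where
      open At c hiding (module Sc)
      open Config c hiding (levels)
      open Inv I
      module Sc = Select value (lookup (proj₂ challenge)) (proj₁ challenge ∷ node)

      gives : app finChallenge (lam finChallenge response) challenge ≡ response challenge
      gives = app-lam finChallenge response challenge

      levels≡ : Config.levels after ≡ proj₂ (response challenge)
      levels≡ = cong proj₂ gives

      T≡' : ∀ j → T (Config.levels after) j ≡ Sc.setT j
      T≡' j = trans (cong (λ ls → T ls j) levels≡) (T≡ I challenge j)

      A≡' : ∀ j → A (Config.levels after) j ≡ Sc.setA j
      A≡' j = trans (cong (λ ls → A ls j) levels≡) (A≡ I challenge j)

      T-out : ∀ j q → q ∊ T (Config.levels after) j → Sc.Effective j × G.T (Config.value after j) (Config.node after) q
      T-out j q h = Sc.setT-out j q (subst (q ∊_) (T≡' j) h)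

      A-out : ∀ j q → q ∊ A (Config.levels after) j → Sc.Effective j × G.A (Config.value after j) (Config.node after) q
      A-out j q h = Sc.setA-out j q (subst (q ∊_) (A≡' j) h)

      val≤ : ∀ x → Sc.val x ≤ value (proj₁ x)
      val≤ (i , false) = ≤-refl
      val≤ (i , true) = m∸n≤m (value i) 1

      inv-after : At.Inv after
      inv-after = record
        { decreasing = λ j j' le → Sc.val-mono decreasing (Sc.g j) (Sc.g j') (Sc.g-usable j) (Sc.g-mono j j' le)
        ; soundT = λ j q h → proj₂ (T-out j q h)
        ; soundA = λ j q h → proj₂ (A-out j q h)
        ; inside = λ j q h → let (e , t) = T-out j q h in
            subst (q ∊_) (sym (A≡' j)) (Sc.setA-in j q e (G.T⊆A _ _ q t))
        ; strict = λ j q h j' e → Sc.effective-strict decreasing j j' (proj₁ (A-out j q h)) e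
        ; on-run = cong (λ x → step x (Xs₀ node , Y node) (ℓ₀ node) (proj₁ challenge)) on-run
        ; capped = λ j → ≤-trans (val≤ (Sc.g j)) (capped _) }

      level-edge : ∀ j b → LevelEdge (proj₁ pos) theMove challenge (proj₁ (Sc.g j) , b) (j , proj₂ (Sc.g j))
      level-edge j b = valid-move I challenge , trans (cong (λ r → lookup (proj₁ r) j) gives) (g≡ I challenge j)

      attack-value : ∀ q i★ l → Least A q i★ → app finOption (lam finOption attackOf) (q , false , l) ≡ proj₁ challenge →
        ∃ λ j → step q (false , Y node) l (proj₁ challenge) ∊ A (Config.levels after) j × value i★ ≤ Config.value after j
      attack-value q i★ l h e = let (j , r , x) = Sc.represented-A decreasing (i★ , false) (λ ()) q' fact in
          j , subst (q' ∊_) (sym (A≡' j)) x , Sc.val-mono decreasing (Sc.g j) (i★ , false) (Sc.g-usable j) r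
        where
        q' = step q (false , Y node) l (proj₁ challenge)
        fact : G.A (value i★) (proj₁ challenge ∷ node) q'
        fact = subst (λ d → G.A (value i★) (d ∷ node) (step q (false , Y node) l d)) (sym (proj₁ (attacks-at I e i★ h) refl))
                 (G.attack (value i★) node q l (soundA i★ q (proj₁ h)))

    inv : ∀ m → At.Inv (cfg m)
    inv zero = inv-start
    inv (suc m) = After.inv-after (cfg m) (inv m)

    module Af (m : ℕ) = After (cfg m) (inv m)

    as : ℕ → Pos
    as m = Config.pos (cfg m)
    ms : ℕ → Move
    ms m = At.theMove (cfg m)
    cs : ℕ → Challenge
    cs m = At.challenge (cfg m)

    open Play em as ms cs refl (λ m → refl)

    Vertex : Set
    Vertex = Pos × LevelState

    -- Walks in this graph are plays against `τ` carrying a level trace; the constructor's moves are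
    -- arbitrary.
    Step : Vertex → Vertex → Set
    Step (p , x) (p' , x') = ∃ λ mv → p' ≡ next p mv (τ p mv) × LevelEdge (proj₁ p) mv (τ p mv) x x'

    open Walks Step

    Flagged : Vertex → Set
    Flagged y = proj₂ (proj₂ y) ≡ true

    Reached : Vertex → Set
    Reached y = ∃ λ i → ∃ λ vs → Walk vs (start , i , false) y

    descending : ∀ {i} (f : ℕ → Vertex) → f 0 ≡ (start , i , false) → (∀ m → Step (f m) (f (suc m))) → Inf (Flagged ∘ f) → ⊥
    descending f f₀ steps inf = true≢false (parity-unique
        (P'.good→even (inj₁ record { ρ = proj₂ ∘ f ; begins = refl
          ; edges = λ t → →dec (levelEdge? (proj₁ (proj₁ (f t))) (proj₁ (steps t)) (τ (proj₁ (f t)) (proj₁ (steps t))) (proj₂ (f t)) (proj₂ (f (suc t)))) (proj₂ (proj₂ (steps t)))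
          ; parity = 0 , refl , inf-map (λ t → flag-prio (proj₂ (f t))) inf , 0 , λ _ _ → z≤n }))
        (τ-wins (proj₁ ∘ f) (λ t → proj₁ (steps t)) (subst (λ p → W p ≡ false) (sym (cong proj₁ f₀)) lost) (λ _ → tt) (λ t → proj₁ (proj₂ (steps t)))))
      where
      module P' = Play em (proj₁ ∘ f) (λ t → proj₁ (steps t)) (λ t → τ (proj₁ (f t)) (proj₁ (steps t))) (cong proj₁ f₀) (λ t → proj₁ (proj₂ (steps t)))
      flag-prio : ∀ x → proj₂ x ≡ true → toℕ (levelPrio x) ≡ 0
      flag-prio (i , true) e = refl

    -- As `τ` depends on the position alone, the cycle can be repeated for ever, an infinite descent
    -- won by the constructor.
    no-cycle : ∀ y → Flagged y → Reached y → ∀ {vs} → ¬ Walk (y ∷ vs) y y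
    no-cycle y fl (i , ws , w) c = continue (prepend w round refl round-edge)
      where
      open Cycle c
      continue : (∃ λ (f' : ℕ → Vertex) → f' 0 ≡ (start , i , false) × (∀ m → Step (f' m) (f' (suc m))) × ∃ λ k → ∀ m → f' (k + m) ≡ round m) → ⊥
      continue (f , f₀ , steps , k , same) = descending f f₀ steps
        (inf-unshift k (inf-map (λ m h → trans (cong (λ y → proj₂ (proj₂ y)) (same m)) h) (recurs {Flagged} (here fl))))

    pred : ℕ → Slot → Slot
    pred m j = proj₁ (Af.Sc.g m j)

    flag : ℕ → Slot → Bool
    flag zero    j = false
    flag (suc m) j = proj₂ (Af.Sc.g m j)

    vertex : ℕ → Slot → Vertex
    vertex m i = as m , i , flag m i

    edge : ∀ m j → Step (vertex m (pred m j)) (vertex (suc m) j)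
    edge m j = ms m , refl , Af.level-edge m j (flag m (pred m j))

    one : Bool → ℕ
    one b = if b then 1 else 0

    len : ℕ → Slot → ℕ
    len zero    i = 0
    len (suc m) j = one (flag (suc m) j) + len m (pred m j)

    -- The inserted vertices in the ancestry of a slot are distinct, since a repetition would close
    -- a cycle; this bounds `len`.
    record Trail (m : ℕ) (i : Slot) : Set where
      field
        seen    : List Vertex
        unique  : Unique seen
        long    : length seen ≡ len m i
        past    : All (λ y → Flagged y × Reached y × ∃ λ vs → Walk vs y (vertex m i)) seen
        reached : Reached (vertex m i)

    extend-trail : ∀ m j → Trail m (pred m j) → ∀ b → flag (suc m) j ≡ b → Trail (suc m) j
    extend-trail m j Tr b e = record
        { seen = seen' b ; unique = unique' b e ; long = trans (long' b) (cong (λ b → one b + len m (pred m j)) (sym e))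
        ; past = past' b e ; reached = reached' }
      where
      open Trail Tr
      v' = vertex (suc m) j
      reached' : Reached v'
      reached' = let (i , vs , w) = reached in i , _ , snoc w (edge m j)
      later : ∀ {y} → (Flagged y × Reached y × ∃ λ vs → Walk vs y (vertex m (pred m j))) → Flagged y × Reached y × ∃ λ vs → Walk vs y v'
      later (f , r , vs , w) = f , r , _ , snoc w (edge m j)
      new : ∀ {y} → (Flagged y × Reached y × ∃ λ vs → Walk vs y (vertex m (pred m j))) → v' ≢ y
      new (f , r , vs , w) refl = no-cycle v' f r (proj₂ (close w (edge m j)))
      seen' : Bool → List Vertex
      seen' true  = v' ∷ seen
      seen' false = seen
      unique' : ∀ b → flag (suc m) j ≡ b → Unique (seen' b)
      unique' true e = mapᴬ new past ∷ᵁ unique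
      unique' false e = unique
      long' : ∀ b → length (seen' b) ≡ one b + len m (pred m j)
      long' true = cong suc long
      long' false = long
      past' : ∀ b → flag (suc m) j ≡ b → All (λ y → Flagged y × Reached y × ∃ λ vs → Walk vs y v') (seen' b)
      past' true e = (e , reached' , [] , nil) ∷ᴬ mapᴬ later past
      past' false e = mapᴬ later past

    trail : ∀ m i → Trail m i
    trail zero i = record { seen = [] ; unique = []ᵁ ; long = refl ; past = []ᴬ ; reached = i , [] , nil }
    trail (suc m) j = extend-trail m j (trail m (pred m j)) (flag (suc m) j) refl

    len-bound : ∀ m i → len m i ≤ size (fin× finPos finLevelState)
    len-bound m i = subst (_≤ size (fin× finPos finLevelState)) (Trail.long (trail m i))
      (distinct-bound (fin× finPos finLevelState) (Trail.seen (trail m i)) (Trail.unique (trail m i)))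

    -- Along the ancestry of a slot only insertions lower the value, each by at most one, and the
    -- start value is within `K` of `bound`.
    spent : ∀ m i → bound ≤ Config.value (cfg m) i + (len m i + K)
    spent zero i = ≤-trans (≤-reflexive (sym (m∸n+n≡m (≤-trans (<⇒≤ (toℕ<n i)) K≤bound)))) (+-monoʳ-≤ (bound ∸ toℕ i) (<⇒≤ (toℕ<n i)))
    spent (suc m) j = ≤-trans (spent m (pred m j)) (≤-trans (+-monoˡ-≤ (len m (pred m j) + K) (drop (Af.Sc.g m j)))
        (≤-reflexive (trans (+-assoc (Config.value (cfg (suc m)) j) (one (flag (suc m) j)) (len m (pred m j) + K))
          (cong (Config.value (cfg (suc m)) j +_) (sym (+-assoc (one (flag (suc m) j)) (len m (pred m j)) K))))))
      where
      drop : ∀ c → Config.value (cfg m) (proj₁ c) ≤ Af.Sc.val m c + one (proj₂ c)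
      drop (i , false) = m≤m+n _ 0
      drop (i , true) = m≤n+m∸n' (Config.value (cfg m) i)
        where
        m≤n+m∸n' : ∀ x → x ≤ (x ∸ 1) + 1
        m≤n+m∸n' zero = z≤n
        m≤n+m∸n' (suc x) = ≤-reflexive (+-comm 1 x)

    -- A claim of value `0` is void, and an attack based on it could go on along an accepting run.
    positive : ∀ m i → Config.value (cfg m) i ≢ 0
    positive m i e = <-irrefl refl (≤-trans (subst (λ z → bound ≤ z + (len m i + K)) e (spent m i)) (+-monoˡ-≤ K (len-bound m i)))

    π : ℕ → Dir
    π m = proj₁ (cs m)

    node-branch : ∀ m → Config.node (cfg m) ≡ branch π m
    node-branch zero = refl
    node-branch (suc m) = cong (π m ∷_) (node-branch m)

    f : ℕ → X
    f m = proj₁ (proj₁ (as m))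

    f-accepting : Parity true (λ m → toℕ (prio (f m)))
    f-accepting = parity-cong (λ m → cong (toℕ ∘ prio) (sym (trans (At.Inv.on-run (inv m)) (cong (run (λ u → Xs₀ u , Y u) ℓ₀) (node-branch m)))))
      (accepting₀ π)

    module NoBad (Tr : Judge.T₂.TypedTrace E₂ true) where
      open Judge.T₂.TypedTrace Tr

      bad : ∀ m → BadEdge (proj₁ (as m)) (ms m) (cs m) (ρ m) (ρ (suc m))
      bad m = dec→ (badEdge? (proj₁ (as m)) (ms m) (cs m) (ρ m) (ρ (suc m))) (edges m)

      not-broken : ∀ m → ρ m ≢ broken
      not-broken zero e = case trans (sym begins) (cong isWaiting e) of λ ()
      not-broken (suc m) e = by (ρ m) (not-broken m) (subst (BadEdge (proj₁ (as m)) (ms m) (cs m) (ρ m)) e (bad m))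
        where
        by : ∀ x → x ≢ broken → BadEdge (proj₁ (as m)) (ms m) (cs m) x broken → ⊥
        by waiting nb nv = nv (At.valid-move (cfg m) (inv m) (cs m))
        by broken nb _ = nb refl
        by (running _) nb ()
        by (attacking _) nb ()

      module _ (t : ℕ) where

        still-running : ∀ k → (∃ λ q → ρ t ≡ running q) → ∃ λ q → ρ (k + t) ≡ running q
        still-running zero h = h
        still-running (suc k) h = by (still-running k h) (ρ (suc (k + t))) refl
          where
          by : (∃ λ q → ρ (k + t) ≡ running q) → ∀ y → ρ (suc (k + t)) ≡ y → ∃ λ q → ρ (suc (k + t)) ≡ running q
          by (q , e) y e' = go y e' (subst₂ (BadEdge (proj₁ (as (k + t))) (ms (k + t)) (cs (k + t))) e e' (bad (k + t)))
            where
            go : ∀ y → ρ (suc (k + t)) ≡ y → BadEdge (proj₁ (as (k + t))) (ms (k + t)) (cs (k + t)) (running q) y → ∃ λ q → ρ (suc (k + t)) ≡ running q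
            go (running q') e' _ = q' , e'

        is-f : (∃ λ q → ρ t ≡ running q) → ∀ k → ρ (k + t) ≡ running (f (k + t))
        is-f h k = by (still-running k h) (still-running (suc k) h)
          where
          by : (∃ λ q → ρ (k + t) ≡ running q) → (∃ λ q → ρ (suc (k + t)) ≡ running q) → ρ (k + t) ≡ running (f (k + t))
          by (q , e) (q' , e') = trans e (cong running (proj₁ (subst₂ (BadEdge (proj₁ (as (k + t))) (ms (k + t)) (cs (k + t))) e e' (bad (k + t)))))

        -- The simulated run is the accepting run of `ℓ₀`, so after the shift by one its parity is
        -- odd.
        no-running : ¬ ∃ λ q → ρ t ≡ running q
        no-running h = true≢false (parity-unique (parity-shift t f-accepting) (parity-pred
          (parity-cong (λ k → cong (toℕ ∘ badPrio) (trans (cong ρ (+-comm t k)) (trans (is-f h k) (cong (running ∘ f) (+-comm k t))))) (parity-shift t parity))))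

        still-attacking : ∀ k → (∃ λ q → ρ t ≡ attacking q) → ∃ λ q → ρ (k + t) ≡ attacking q
        still-attacking zero h = h
        still-attacking (suc k) h = by (still-attacking k h) (ρ (suc (k + t))) refl
          where
          by : (∃ λ q → ρ (k + t) ≡ attacking q) → ∀ y → ρ (suc (k + t)) ≡ y → ∃ λ q → ρ (suc (k + t)) ≡ attacking q
          by (q , e) y e' = go y e' (subst₂ (BadEdge (proj₁ (as (k + t))) (ms (k + t)) (cs (k + t))) e e' (bad (k + t)))
            where
            go : ∀ y → ρ (suc (k + t)) ≡ y → BadEdge (proj₁ (as (k + t))) (ms (k + t)) (cs (k + t)) (attacking q) y → ∃ λ q → ρ (suc (k + t)) ≡ attacking q
            go (attacking q') e' _ = q' , e'

        module Attacking (h : ∃ λ q → ρ t ≡ attacking q) where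
          qs : ℕ → X
          qs k = proj₁ (still-attacking k h)

          forcing : ∀ k → Forced (proj₁ (as (k + t))) (ms (k + t)) (cs (k + t)) (qs k) (qs (suc k))
          forcing k = subst₂ (BadEdge (proj₁ (as (k + t))) (ms (k + t)) (cs (k + t))) (proj₂ (still-attacking k h)) (proj₂ (still-attacking (suc k) h)) (bad (k + t))

          ls : ℕ → Λ
          ls k = proj₁ (proj₂ (forcing k))

          leastOf : ∀ k → ∃ λ i★ → At.Least (cfg (k + t)) A (qs k) i★
          leastOf k = let (i , l , a , _) = forcing k ; (i★ , m , _) = At.least-slot (cfg (k + t)) A (qs k) i a in i★ , m

          i★ : ℕ → Slot
          i★ k = proj₁ (leastOf k)

          v : ℕ → ℕ
          v k = Config.value (cfg (k + t)) (i★ k)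

          directed : ∀ k → app finOption (lam finOption (At.attackOf (cfg (k + t)))) (qs k , false , ls k) ≡ π (k + t)
          directed k = proj₁ (proj₂ (proj₂ (proj₂ (forcing k))))

          steps : ∀ k → qs (suc k) ≡ step (qs k) (false , Y (Config.node (cfg (k + t)))) (ls k) (π (k + t))
          steps k = proj₂ (proj₂ (proj₂ (proj₂ (forcing k))))

          -- An attack carries its claim into a slot of no smaller value, and the least slot is at
          -- least as good.
          v-up : ∀ k → v k ≤ v (suc k)
          v-up k = by (Af.attack-value (k + t) (qs k) (i★ k) (ls k) (proj₂ (leastOf k)) (directed k))
            where
            by : (∃ λ j → step (qs k) (false , Y (Config.node (cfg (k + t)))) (ls k) (π (k + t)) ∊ A (Config.levels (cfg (suc (k + t)))) j ×
                          v k ≤ Config.value (cfg (suc (k + t))) j) → v k ≤ v (suc k)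
            by (j , a , le) = ≤-trans le (At.Inv.decreasing (inv (suc (k + t))) (i★ (suc k)) j (≮⇒≥ λ lt →
              proj₂ (proj₂ (leastOf (suc k))) j lt (subst (λ q → q ∊ A (Config.levels (cfg (suc (k + t)))) j) (sym (steps k)) a)))

          v-cap : ∀ k → v k ≤ bound
          v-cap k = At.Inv.capped (inv (k + t)) (i★ k)

          -- Different values prescribe different attack strategies. Once the value is constant, the
          -- directions are those of the rank game at one ordinal `ω·s`, where every run that is
          -- attacked for ever rejects.
          rejected : (∃ λ k₀ → ∀ m → bound ∸ v (k₀ + m) ≡ bound ∸ v k₀) → Parity false (λ m → toℕ (prio (qs m)))
          rejected (k₀ , const) = by (v k₀) refl
            where
            same : ∀ m → v (k₀ + m) ≡ v k₀
            same m = ∸-cancelˡ-≡ (v-cap (k₀ + m)) (v-cap k₀) (const m)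
            by : ∀ s → v k₀ ≡ s → Parity false (λ m → toℕ (prio (qs m)))
            by zero e = ⊥-elim (positive (k₀ + t) (i★ k₀) e)
            by (suc s) e = parity-unshift k₀ (G.attack-rejects s (λ m → us (k₀ + m)) (λ m → qs (k₀ + m)) (λ m → ls (k₀ + m))
                (subst (λ z → G.A z (us (k₀ + 0)) (qs (k₀ + 0))) (trans (same 0) e) (At.Inv.soundA (inv (k₀ + 0 + t)) (i★ (k₀ + 0)) (qs (k₀ + 0)) (proj₁ (proj₂ (leastOf (k₀ + 0))))))
                (λ m → trans (cong us (+-suc k₀ m)) (cong (_∷ us (k₀ + m)) (dir m)))
                (λ m → trans (cong qs (+-suc k₀ m)) (trans (steps (k₀ + m)) (cong (step (qs (k₀ + m)) (false , Y (us (k₀ + m))) (ls (k₀ + m))) (dir m)))))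
              where
              us : ℕ → List Dir
              us k = Config.node (cfg (k + t))
              dir : ∀ m → π (k₀ + m + t) ≡ G.attackDir (suc s) (us (k₀ + m)) (qs (k₀ + m)) (ls (k₀ + m))
              dir m = trans (proj₁ (At.attacks-at (cfg (k₀ + m + t)) (inv (k₀ + m + t)) (directed (k₀ + m)) (i★ (k₀ + m)) (proj₂ (leastOf (k₀ + m)))) refl)
                (cong (λ z → G.attackDir z (us (k₀ + m)) (qs (k₀ + m)) (ls (k₀ + m))) (trans (same m) e))

          impossible : ⊥
          impossible = true≢false (parity-unique
            (parity-cong (λ k → trans (cong (toℕ ∘ badPrio) (trans (cong ρ (+-comm t k)) (proj₂ (still-attacking k h)))) (toℕ-inject₁ _)) (parity-shift t parity))
            (rejected (nonincreasing-stabilises em (λ k → bound ∸ v k) (λ k → ∸-monoʳ-≤ bound (v-up k)))))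

      all-waiting : ∀ m → ρ m ≡ waiting
      all-waiting m = by (ρ m) refl
        where
        by : ∀ x → ρ m ≡ x → ρ m ≡ waiting
        by waiting e = e
        by broken e = ⊥-elim (not-broken m e)
        by (running q) e = ⊥-elim (no-running m (q , e))
        by (attacking q) e = ⊥-elim (Attacking.impossible m (q , e))

      absurd : ⊥
      absurd = true≢false (parity-unique parity (parity-cong (λ m → cong (toℕ ∘ badPrio) (sym (all-waiting m)))
        (1 , refl , (λ m → m , ≤-refl , refl) , 0 , λ _ _ → ≤-refl)))

    refuted : ⊥
    refuted = true≢false (parity-unique (good→even (inj₂ NoBad.absurd))
      (τ-wins as ms lost (λ _ → tt) (λ m → refl)))

  -- The rank game on `Y` decides: a win at `ω· bound` contains a solution and its counting
  -- function, and a loss is refuted.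
  bounded : W start ≡ false → ∀ Y → (∃ λ Xs → Accepts (λ u → Xs u , Y u)) →
    ∃ λ Xs → Accepts (λ u → Xs u , Y u) × ∃ (Counts Xs (ω· bound))
  bounded lost Y (Xs₀ , ℓ₀ , acc₀) = by (Solution.W G.solved ([] , x₀ , bound , 0)) refl
    where
    module G = RankGame 𝒜 em Y
    by : ∀ b → Solution.W G.solved ([] , x₀ , bound , 0) ≡ b → ∃ λ Xs → Accepts (λ u → Xs u , Y u) × ∃ (Counts Xs (ω· bound))
    by true won = Xs , (ℓ , accepting) , ordinal ∘ β' , counts
      where open G.Winning bound won
    by false lr = ⊥-elim (Against.refuted lost Y Xs₀ ℓ₀ acc₀ lr)

-- Back to node sets, and the decision procedure.

≼-suffix : ∀ {v w} → v ≼ w → ∃ λ p → w ≡ p ++ v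
≼-suffix self = [] , refl
≼-suffix (down {d = d} h) = let (p , e) = ≼-suffix h in d ∷ p , cong (d ∷_) e

suffix-≼ : ∀ p v → v ≼ (p ++ v)
suffix-≼ [] v = self
suffix-≼ (d ∷ p) v = down (suffix-≼ p v)

reverse-split : ∀ (v : Node) d w → reverse (v ++ d ∷ w) ≡ reverse w ++ d ∷ reverse v
reverse-split v d w = trans (reverse-++ v (d ∷ w)) (trans (cong (_++ reverse v) (unfold-reverse d w)) (++-assoc (reverse w) [ d ] (reverse v)))

≼⇒desc : ∀ v d w → (d ∷ v) ≼ w → ProperDesc (reverse w) (reverse v)
≼⇒desc v d w h = let (p , e) = ≼-suffix h in d , reverse p , trans (cong reverse e) (reverse-split p d v)

desc⇒≼ : ∀ u v → ProperDesc u v → ∃ λ d → (d ∷ reverse v) ≼ reverse u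
desc⇒≼ u v (d , w , e) = d , subst ((d ∷ reverse v) ≼_) (sym (trans (cong reverse e) (reverse-split v d w))) (suffix-≼ (reverse w) (d ∷ reverse v))

flip-set : Tree Bool → NodeSet
flip-set Z v = Z (reverse v)

counts⇒rank : ∀ {Xs η C} → Counts Xs η C → RankLe (flip-set Xs) η
counts⇒rank {Xs} {η} {C} (b , c) = C ∘ reverse , (λ u h → b (reverse u) h) , λ u v hu hv p →
  let (d , q) = desc⇒≼ u v p in c (reverse v) d (reverse u) hv hu q

rank⇒counts : ∀ {X η} → RankLe X η → ∃ (Counts (X ∘ reverse) η)
rank⇒counts (C , b , c) = C ∘ reverse , (λ v h → b (reverse v) h) , λ v d w hv hw p →
  c (reverse w) (reverse v) hw hv (≼⇒desc v d w p)

module Decide {n : ℕ} (φ : Formula 0 (suc n)) where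
  open Translation (translate φ)

  letter : Bool × Vec Bool n → Letter 0 (suc n)
  letter (b , v) = []ᵥ , b ∷ᵥ v

  pulled : Recognisable (λ t → Lang (letter ∘ t))
  pulled = rec-pull letter recog

  𝒜 : Automaton (Bool × Vec Bool n)
  𝒜 = proj₁ pulled

  finY : Finite (Vec Bool n)
  finY = finVec finBool n

  y₀ : Vec Bool n
  y₀ = replicate n false

  module CG = ClaimGame finY y₀ 𝒜

  -- The successor turns the bound `ω· CG.bound` into the strict one that `EtaLt` asks for.
  answer : Maybe ℕ
  answer = if CG.constructorWins then nothing else just (suc CG.bound)

  module _ (em : Classical) where

    treeOf : Vec NodeSet n → Tree (Vec Bool n)
    treeOf Ys u = mapᵥ (λ Z → Z (reverse u)) Ys

    setsOf : Tree (Vec Bool n) → Vec NodeSet n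
    setsOf Y = tabulate λ i v → lookup (Y (reverse v)) i

    tree-sets : ∀ Y u → treeOf (setsOf Y) u ≡ Y u
    tree-sets Y u = vec-ext _ _ λ i → trans (lookup-map i (λ Z → Z (reverse u)) (setsOf Y))
      (trans (cong (λ Z → Z (reverse u)) (lookup∘tabulate (λ i v → lookup (Y (reverse v)) i) i)) (cong (λ v → lookup (Y v) i) (reverse-involutive u)))

    holds⇒accepts : ∀ {Ys X} → Holds φ Ys X → Automaton.Accepts 𝒜 (λ u → X (reverse u) , treeOf Ys u)
    holds⇒accepts {Ys} {X} h = proj₁ (Recognises.correct (proj₂ pulled) em _) (proj₁ (repr em []ᵥ (X ∷ᵥ Ys)) h)

    accepts⇒holds : ∀ {Ys} Xs → Automaton.Accepts 𝒜 (λ u → Xs u , treeOf Ys u) → Holds φ Ys (flip-set Xs)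
    accepts⇒holds {Ys} Xs a = proj₂ (repr em []ᵥ (flip-set Xs ∷ᵥ Ys))
      (proj₂ (Recognises.correct (proj₂ pulled) em (λ u → Xs (reverse (reverse u)) , treeOf Ys u))
        (Automaton.accepts-cong 𝒜 (λ u → cong (λ v → Xs v , treeOf Ys u) (sym (reverse-involutive u))) a))

    small : Solution.W (CG.solution em) CG.start ≡ false → EtaLt φ (ω· suc CG.bound)
    small lost = ω· CG.bound , ≤-cocone {f = λ k → (ω· CG.bound) +ₒ k} 1 (≤ₒ-refl (os (ω· CG.bound))) , λ Ys (X , h) →
      let (Xs , a , C , c) = Refute.bounded finY y₀ 𝒜 em lost (treeOf Ys) (X ∘ reverse , holds⇒accepts h)
      in flip-set Xs , accepts⇒holds Xs a , counts⇒rank c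

    large : Solution.W (CG.solution em) CG.start ≡ true → EtaIsω₁ φ
    large won α = convert (Unbounded.unbounded finY y₀ 𝒜 em won α)
      where
      Result : Set
      Result = Σ (Vec NodeSet n) λ Ys → (Σ NodeSet λ X → Holds φ Ys X) × ((X : NodeSet) → Holds φ Ys X → ¬ RankLe X α)
      convert : (∃ λ Y → (∃ λ Xs → Automaton.Accepts 𝒜 (λ u → Xs u , Y u)) ×
               (∀ Xs → Automaton.Accepts 𝒜 (λ u → Xs u , Y u) → ∀ C → ¬ Counts Xs α C)) → Result
      convert (Y , (Xs , a) , none) = setsOf Y ,
        (flip-set Xs , accepts⇒holds Xs (Automaton.accepts-cong 𝒜 (λ u → cong (Xs u ,_) (sym (tree-sets Y u))) a)) ,
        λ X h r → let (C , c) = rank⇒counts r in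
          none (X ∘ reverse) (Automaton.accepts-cong 𝒜 (λ u → cong (X (reverse u) ,_) (tree-sets Y u)) (holds⇒accepts h)) C c

    correct : Case answer φ
    correct = by CG.constructorWins (CG.constructorWins-correct em (CG.solution em))
      where
      by : ∀ b → b ≡ Solution.W (CG.solution em) CG.start → Case (if b then nothing else just (suc CG.bound)) φ
      by true e = large (sym e)
      by false e = small (sym e)

theorem1 : Σ (∀ {n} → Formula 0 (suc n) → Maybe ℕ) λ decide →
    ExcludedMiddle 0ℓ →
    ∀ {n} (φ : Formula 0 (suc n)) → ForcesWF φ →
      Case (decide φ) φ
theorem1 = (λ φ → Decide.answer φ) , λ em φ _ → Decide.correct φ em
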